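{- Let $(\mathcal{C},T,\mathcal{M},A,(\pi_t)_{t\in[\ell]})$ be an ordered storyline instance and let $\mathcal{C}'$ be the set of characters $c\in\mathcal{C}$ with $A(c)=[\ell]$. Then, given a pair $(\Delta,\overline{\Delta})$, a $(\Delta,\overline{\Delta})$-nice coordination in which the set of characters of $\mathcal{C}'$ having no wiggle (i.e. $y_{t,c}=y_{t+1,c}$ for all $t\in[\ell-1]$) is as large as possible can be computed in $\mathcal{O}(|\mathcal{C}|^2\cdot\ell)$ time.
   Context: Write $[n]=\{1,\dots,n\}$. An ordered storyline instance consists of characters $\mathcal{C}$, time steps $T=[\ell]$, meetings $\mathcal{M}$ (each meeting $M$ has a time step $\mathrm{tm}(M)$ and character set $\mathrm{char}(M)$), for each character $c$ a set $A(c)$ of consecutive active time steps, and for each $t$ a permutation $\pi_t$ of the active characters $\mathrm{Ac}(t)=\{c: t\in A(c)\}$ in which the characters of each meeting at time $t$ are consecutive; $c\prec_t c'$ means $c$ precedes $c'$ in $\pi_t$. A coordination assigns a real $y_{t,c}$ to each $t$ and $c\in\mathrm{Ac}(t)$; it is valid if $c\prec_t c'$ implies $y_{t,c}<y_{t,c'}$; it is $(\Delta,\overline{\Delta})$-nice if valid and for all $t$ and all $c,c'$ consecutive in $\pi_t$, $|y_{t,c'}-y_{t,c}|=\Delta$ if $c,c'$ lie in a common meeting at time $t$, and $|y_{t,c'}-y_{t,c}|\ge\overline{\Delta}$ otherwise. -}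

module Defs where

open import Algebra.Structures using (IsCommutativeRing)
open import Data.Bool using (Bool; true; false; if_then_else_; _∧_)
open import Data.Fin as Fin using (Fin; toℕ; fromℕ<; combine; remQuot)
open import Data.Fin.Properties using (all?)
open import Data.Fin.Subset using (Subset) renaming (_∈_ to _∈ˢ_)
open import Data.Fin.Subset.Properties using (_∈?_)
open import Data.List using (List; _++_; length; lookup; filter; allFin)
open import Data.List.Membership.Propositional using (_∈_)
open import Data.List.Relation.Unary.Unique.Propositional using (Unique)
open import Data.Nat using (ℕ; suc; _+_; _*_; _∸_; _≤_; _≟_; _<?_)
open import Data.Product using (Σ; ∃; ∃-syntax; _×_; _,_; proj₁; proj₂; uncurry)
open import Function using (_∘_; _⇔_)
open import Relation.Binary.PropositionalEquality using (_≡_; _≢_)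
open import Relation.Binary.Structures using (IsStrictTotalOrder)
open import Relation.Nullary using (¬_; does; yes; no)
open import Relation.Nullary.Decidable using (map′; _→-dec_)
open import Relation.Unary using (Decidable)

-- The library has no real numbers.  They are given by their axioms, which
-- classically determine them up to isomorphism: a complete ordered field.  The
-- order is decidable (trichotomous), as the comparisons of a real RAM require.
-- The value of 0# ⁻¹ is unspecified.
record RealField : Set₁ where
  infix  4 _<_
  infixl 6 _⊕_ _⊖_
  infixl 7 _⊗_
  field
    Carrier            : Set
    _<_                : Carrier → Carrier → Set
    _⊕_ _⊗_            : Carrier → Carrier → Carrier
    neg _⁻¹            : Carrier → Carrier
    0# 1#              : Carrier
    isCommutativeRing  : IsCommutativeRing _≡_ _⊕_ _⊗_ neg 0# 1#
    isStrictTotalOrder : IsStrictTotalOrder _≡_ _<_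
    0<1                : 0# < 1#
    ⁻¹-inverse         : ∀ x → x ≢ 0# → x ⊗ x ⁻¹ ≡ 1#
    ⊕-monoʳ-<          : ∀ x {y z} → y < z → x ⊕ y < x ⊕ z
    ⊗-pos              : ∀ {x y} → 0# < x → 0# < y → 0# < x ⊗ y
    supremum           : (P : Carrier → Set) → ∃ P →
                         (∃[ b ] (∀ x → P x → ¬ (b < x))) →
                         ∃[ s ] ((∀ x → P x → ¬ (s < x)) ×
                                 (∀ b → (∀ x → P x → ¬ (b < x)) → ¬ (b < s)))

  open IsStrictTotalOrder isStrictTotalOrder public
    using (compare) renaming (_<?_ to _<ᴿ?_; _≟_ to _≟ᴿ_)

  _⊖_ : Carrier → Carrier → Carrier
  x ⊖ y = x ⊕ neg y

  _≤ᴿ_ : Carrier → Carrier → Set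
  x ≤ᴿ y = ¬ (y < x)

  abs : Carrier → Carrier
  abs x = if does (x <ᴿ? 0#) then neg x else x

-- Characters are Fin n and time steps Fin ℓ, so numbering starts at 0.
record OrderedStoryline : Set where
  field
    n ℓ m : ℕ
    A     : Fin n → Subset ℓ
    tm    : Fin m → Fin ℓ
    char  : Fin m → Subset n
    π     : Fin ℓ → List (Fin n)

    A-consecutive : ∀ c {s t u} → s Fin.≤ t → t Fin.≤ u →
                    s ∈ˢ A c → u ∈ˢ A c → t ∈ˢ A c

    -- The meetings form a set: a meeting is determined by its time step and its
    -- characters.  Meetings at the same time step need not be disjoint.
    meeting-ext : ∀ {M M′} → tm M ≡ tm M′ → char M ≡ char M′ → M ≡ M′

    π-unique : ∀ t → Unique (π t)
    π-active : ∀ t c → c ∈ π t ⇔ t ∈ˢ A c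

    meeting-consecutive : ∀ M → ∃[ xs ] ∃[ ys ] ∃[ zs ]
      (π (tm M) ≡ xs ++ ys ++ zs × (∀ c → c ∈ ys ⇔ c ∈ˢ char M))

  meetingStart meetingSize : Fin m → ℕ
  meetingStart M = length (proj₁ (meeting-consecutive M))
  meetingSize  M = length (proj₁ (proj₂ (meeting-consecutive M)))

  _≺[_]_ : Fin n → Fin ℓ → Fin n → Set
  c ≺[ t ] c′ = ∃[ i ] ∃[ j ]
    (i Fin.< j × lookup (π t) i ≡ c × lookup (π t) j ≡ c′)

  Consecutive : Fin ℓ → Fin n → Fin n → Set
  Consecutive t c c′ = ∃[ i ] ∃[ j ]
    (toℕ j ≡ suc (toℕ i) × lookup (π t) i ≡ c × lookup (π t) j ≡ c′)

  CommonMeeting : Fin ℓ → Fin n → Fin n → Set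
  CommonMeeting t c c′ = ∃[ M ] (tm M ≡ t × c ∈ˢ char M × c′ ∈ˢ char M)

  AlwaysActive : Fin n → Set
  AlwaysActive c = ∀ t → t ∈ˢ A c

module Coordinations (ℝ : RealField) (I : OrderedStoryline) where
  open RealField ℝ
  open OrderedStoryline I

  Coordination : Set
  Coordination = (t : Fin ℓ) (c : Fin n) → .(t ∈ˢ A c) → Carrier

  Valid : Coordination → Set
  Valid y = ∀ t c c′ (p : t ∈ˢ A c) (q : t ∈ˢ A c′) →
            c ≺[ t ] c′ → y t c p < y t c′ q

  record Nice (Δ Δ̄ : Carrier) (y : Coordination) : Set where
    field
      valid    : Valid y
      together : ∀ t c c′ (p : t ∈ˢ A c) (q : t ∈ˢ A c′) →
                 Consecutive t c c′ → CommonMeeting t c c′ →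
                 abs (y t c′ q ⊖ y t c p) ≡ Δ
      apart    : ∀ t c c′ (p : t ∈ˢ A c) (q : t ∈ˢ A c′) →
                 Consecutive t c c′ → ¬ CommonMeeting t c c′ →
                 Δ̄ ≤ᴿ abs (y t c′ q ⊖ y t c p)

  NoWiggle : Coordination → Fin n → Set
  NoWiggle y c = Σ (AlwaysActive c) λ a →
    ∀ t t′ → toℕ t′ ≡ suc (toℕ t) → y t c (a t) ≡ y t′ c (a t′)

  noWiggle? : ∀ y → Decidable (NoWiggle y)
  noWiggle? y c with all? (λ t → t ∈? A c)
  ... | no ¬a = no (¬a ∘ proj₁)
  ... | yes a = map′ (a ,_) proj₂
    (all? λ t → all? λ t′ →
      (toℕ t′ ≟ suc (toℕ t)) →-dec (y t c (a t) ≟ᴿ y t′ c (a t′)))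

  noWiggleCount : Coordination → ℕ
  noWiggleCount y = length (filter (noWiggle? y) (allFin n))

  Optimal : (Δ Δ̄ : Carrier) → Coordination → Set
  Optimal Δ Δ̄ y = Nice Δ Δ̄ y ×
    (∀ y′ → Nice Δ Δ̄ y′ → noWiggleCount y′ ≤ noWiggleCount y)

-- Real-RAM programs in structured form.  Memory consists of arrays of natural
-- numbers and arrays of reals, indexed by natural numbers.  Array names are
-- literals, so a program uses only finitely many arrays; a[0] serves as a scalar
-- variable.  Each operation has unit cost.  Natural numbers have only addition
-- and truncated subtraction, and reals cannot be converted to naturals, so unit
-- cost does not hide long computations in single large numbers.
infixl 6 _`+_ _`∸_ _`⊕_ _`⊖_
infixl 7 _`⊗_ _`⊘_
infix  8 _[_]ᴺ _[_]ᴿ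
infix  4 _`<ᴺ_ _`<ᴿ_
infix  4 _[_]≔ᴺ_ _[_]≔ᴿ_
infix  3 `if_then_else_ `while_repeat_
infixr 2 _⨾_

data NExp : Set where
  `lit      : ℕ → NExp
  _[_]ᴺ     : ℕ → NExp → NExp
  _`+_ _`∸_ : NExp → NExp → NExp

data RExp : Set where
  `0 `1                   : RExp
  _[_]ᴿ                   : ℕ → NExp → RExp
  _`⊕_ _`⊖_ _`⊗_ _`⊘_ : RExp → RExp → RExp

data Test : Set where
  _`<ᴺ_ : NExp → NExp → Test
  _`<ᴿ_ : RExp → RExp → Test

data Program : Set where
  `skip         : Program
  _[_]≔ᴺ_       : ℕ → NExp → NExp → Program
  _[_]≔ᴿ_       : ℕ → NExp → RExp → Program
  _⨾_           : Program → Program → Program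
  `if_then_else_ : Test → Program → Program → Program
  `while_repeat_ : Test → Program → Program

costᴺ : NExp → ℕ
costᴺ (`lit _)   = 1
costᴺ (_ [ e ]ᴺ) = suc (costᴺ e)
costᴺ (e `+ f)   = suc (costᴺ e + costᴺ f)
costᴺ (e `∸ f)   = suc (costᴺ e + costᴺ f)

costᴿ : RExp → ℕ
costᴿ `0         = 1
costᴿ `1         = 1
costᴿ (_ [ e ]ᴿ) = suc (costᴺ e)
costᴿ (e `⊕ f)   = suc (costᴿ e + costᴿ f)
costᴿ (e `⊖ f)   = suc (costᴿ e + costᴿ f)
costᴿ (e `⊗ f)   = suc (costᴿ e + costᴿ f)
costᴿ (e `⊘ f)   = suc (costᴿ e + costᴿ f)

costᵀ : Test → ℕ
costᵀ (e `<ᴺ f) = suc (costᴺ e + costᴺ f)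
costᵀ (e `<ᴿ f) = suc (costᴿ e + costᴿ f)

Arrays : Set → Set
Arrays X = ℕ → ℕ → X

write : ∀ {X} → Arrays X → ℕ → ℕ → X → Arrays X
write mem a i v b j = if does (b ≟ a) ∧ does (j ≟ i) then v else mem b j

-- The array holding the given entries, followed by the default value.
array : ∀ {X : Set} {k} → X → (Fin k → X) → ℕ → X
array {k = k} d f i with i <? k
... | yes i<k = f (fromℕ< i<k)
... | no  _   = d

-- Row-major layout.
matrix : ∀ {X : Set} {r s} → X → (Fin r → Fin s → X) → ℕ → X
matrix {r = r} {s} d f = array d (uncurry f ∘ remQuot {r} s)

module RealRAM (ℝ : RealField) where
  open RealField ℝ

  record State : Set where
    constructor ⟪_,_⟫
    field
      nats  : Arrays ℕ
      reals : Arrays Carrier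
  open State public

  evalᴺ : State → NExp → ℕ
  evalᴺ σ (`lit k)   = k
  evalᴺ σ (a [ e ]ᴺ) = nats σ a (evalᴺ σ e)
  evalᴺ σ (e `+ f)   = evalᴺ σ e + evalᴺ σ f
  evalᴺ σ (e `∸ f)   = evalᴺ σ e ∸ evalᴺ σ f

  evalᴿ : State → RExp → Carrier
  evalᴿ σ `0         = 0#
  evalᴿ σ `1         = 1#
  evalᴿ σ (a [ e ]ᴿ) = reals σ a (evalᴺ σ e)
  evalᴿ σ (e `⊕ f)   = evalᴿ σ e ⊕ evalᴿ σ f
  evalᴿ σ (e `⊖ f)   = evalᴿ σ e ⊖ evalᴿ σ f
  evalᴿ σ (e `⊗ f)   = evalᴿ σ e ⊗ evalᴿ σ f
  evalᴿ σ (e `⊘ f)   = evalᴿ σ e ⊗ (evalᴿ σ f) ⁻¹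

  evalᵀ : State → Test → Bool
  evalᵀ σ (e `<ᴺ f) = does (evalᴺ σ e <? evalᴺ σ f)
  evalᵀ σ (e `<ᴿ f) = does (evalᴿ σ e <ᴿ? evalᴿ σ f)

  infix 1 ⟨_,_⟩⇓⟨_,_⟩

  -- ⟨ p , σ ⟩⇓⟨ σ′ , k ⟩: started in σ, p halts in σ′ after k steps.
  data ⟨_,_⟩⇓⟨_,_⟩ : Program → State → State → ℕ → Set where
    skip⇓    : ∀ {σ} → ⟨ `skip , σ ⟩⇓⟨ σ , 1 ⟩
    assignᴺ⇓ : ∀ {σ a i e} →
      ⟨ a [ i ]≔ᴺ e , σ ⟩⇓⟨ ⟪ write (nats σ) a (evalᴺ σ i) (evalᴺ σ e) , reals σ ⟫
                          , suc (costᴺ i + costᴺ e) ⟩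
    assignᴿ⇓ : ∀ {σ a i e} →
      ⟨ a [ i ]≔ᴿ e , σ ⟩⇓⟨ ⟪ nats σ , write (reals σ) a (evalᴺ σ i) (evalᴿ σ e) ⟫
                          , suc (costᴺ i + costᴿ e) ⟩
    seq⇓     : ∀ {σ σ′ σ″ p q k l} →
      ⟨ p , σ ⟩⇓⟨ σ′ , k ⟩ → ⟨ q , σ′ ⟩⇓⟨ σ″ , l ⟩ →
      ⟨ p ⨾ q , σ ⟩⇓⟨ σ″ , k + l ⟩
    ifTrue⇓  : ∀ {σ σ′ b p q k} → evalᵀ σ b ≡ true →
      ⟨ p , σ ⟩⇓⟨ σ′ , k ⟩ →
      ⟨ `if b then p else q , σ ⟩⇓⟨ σ′ , costᵀ b + k ⟩
    ifFalse⇓ : ∀ {σ σ′ b p q k} → evalᵀ σ b ≡ false →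
      ⟨ q , σ ⟩⇓⟨ σ′ , k ⟩ →
      ⟨ `if b then p else q , σ ⟩⇓⟨ σ′ , costᵀ b + k ⟩
    stop⇓    : ∀ {σ b p} → evalᵀ σ b ≡ false →
      ⟨ `while b repeat p , σ ⟩⇓⟨ σ , costᵀ b ⟩
    loop⇓    : ∀ {σ σ′ σ″ b p k l} → evalᵀ σ b ≡ true →
      ⟨ p , σ ⟩⇓⟨ σ′ , k ⟩ → ⟨ `while b repeat p , σ′ ⟩⇓⟨ σ″ , l ⟩ →
      ⟨ `while b repeat p , σ ⟩⇓⟨ σ″ , costᵀ b + (k + l) ⟩

  module _ (I : OrderedStoryline) where
    open OrderedStoryline I
    open Coordinations ℝ I using (Coordination)

    -- Input arrays of naturals:
    --   0  n, ℓ, m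
    --   1  ℓ × n matrix, entry (t , c) is 1 if t ∈ A(c) and 0 otherwise
    --   2  number of active characters for each time step
    --   3  ℓ × n matrix, row t lists π_t, padded with 0
    --   4  time step of each meeting
    --   5, 6  start and size of the block of π_t occupied by each meeting
    -- Everything else is 0.
    inputNats : Arrays ℕ
    inputNats 0 0 = n
    inputNats 0 1 = ℓ
    inputNats 0 2 = m
    inputNats 1   = matrix 0 λ t c → if does (t ∈? A c) then 1 else 0
    inputNats 2   = array 0 (length ∘ π)
    inputNats 3   = matrix {r = ℓ} {n} 0 λ t i → array 0 (toℕ ∘ lookup (π t)) (toℕ i)
    inputNats 4   = array 0 (toℕ ∘ tm)
    inputNats 5   = array 0 meetingStart
    inputNats 6   = array 0 meetingSize
    inputNats _ _ = 0

    inputReals : (Δ Δ̄ : Carrier) → Arrays Carrier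
    inputReals Δ Δ̄ 0 0 = Δ
    inputReals Δ Δ̄ 0 1 = Δ̄
    inputReals Δ Δ̄ _ _ = 0#

    input : (Δ Δ̄ : Carrier) → State
    input Δ Δ̄ = ⟪ inputNats , inputReals Δ Δ̄ ⟫

    -- The output is the ℓ × n matrix in array 1 of reals, read at the pairs
    -- (t , c) with c active at t.
    output : State → Coordination
    output σ t c _ = reals σ 1 (toℕ (combine t c))

{-# OPTIONS --safe #-}

-- At time t let packed t c be the position of c when every gap below it is as small as allowed,
-- and breaks t c the number of gaps below it that lie outside meetings.  A nice coordination
-- amounts to pushing the packed characters apart at breaks: the offset of a character from its
-- packed position depends only on its number of breaks and is monotone in it.
--
-- Let dist c c′ be the maximum over t of 0 and packed t c′ - packed t c.  Two always active
-- characters with c before c′ can both be kept free of wiggles iff for all t, breaks t c is at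
-- most breaks t c′ and, in case of equality, the packed distance at t is already dist c c′.
-- These pairs are the edges of an acyclic graph.  The characters without wiggle of a nice
-- coordination are pairwise adjacent.  Conversely a path can be realised by placing consecutive
-- characters at distance dist, and the offset of any other character is the largest offset of a
-- path character with at most as many breaks (or a lower bound of all of these).  Hence a
-- longest path, found by dynamic programming along π₀ in O(n² ℓ) time, is optimal.
module Submission where

open import Defs
open import Data.Nat using (ℕ; _+_; _*_; _≤_)
open import Data.Product using (∃; ∃-syntax; _×_)
open import Data.Sum using (_⊎_)

open import Algebra.Bundles using (CommutativeRing)
import Algebra.Properties.AbelianGroup
open import Algebra.Structures using (IsCommutativeRing)
open import Data.Bool using (Bool; true; false; if_then_else_; _∧_; _∨_; not; T)
open import Data.Fin as Fin using (Fin; toℕ; fromℕ<; combine; remQuot)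
open import Data.Fin.Properties using (toℕ-fromℕ<; fromℕ<-toℕ; fromℕ<-injective; toℕ<n; toℕ-injective; toℕ-combine; remQuot-combine; combine-injective; injective⇒≤)
open import Data.Fin.Subset using (_⊆_) renaming (_∈_ to _∈ˢ_)
open import Data.Fin.Subset.Properties using (_∈?_; ⊆-antisym)
open import Data.List using (List; []; _∷_; _++_; length; lookup; filter; allFin)
open import Data.List.Properties using (length-++)
open import Data.List.Membership.Propositional using (_∈_)
open import Data.List.Membership.Propositional.Properties using (∈-lookup; ∈-allFin; ∈-++⁺ʳ; ∈-++⁺ˡ; ∈-filter⁺; ∈-filter⁻)
open import Data.List.Relation.Unary.All as All using (All; []; _∷_)
open import Data.List.Relation.Unary.All.Properties using (all-filter)
open import Data.List.Relation.Unary.AllPairs as AllPairs using (AllPairs; []; _∷_)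
import Data.List.Relation.Unary.AllPairs.Properties as AllPairsₚ
open import Data.List.Relation.Unary.Any using (here; there; index)
open import Data.List.Relation.Unary.Any.Properties using (lookup-index)
open import Data.List.Relation.Unary.Unique.Propositional using (Unique)
import Data.List.Relation.Unary.Unique.Propositional.Properties as Uniqueₚ
open import Data.Nat as ℕ using (zero; suc; _^_; _∸_; _⊔_; z≤n; s≤s; _≟_; _<?_)
open import Data.Nat.Properties
open import Data.Nat.Tactic.RingSolver using (solve-∀)
open import Data.Product using (_,_; proj₁; proj₂; uncurry)
open import Data.Sum using (inj₁; inj₂; [_,_]′)
open import Data.Unit using (tt)
open import Function using (_∘_; _⇔_; Equivalence; mk⇔)
open import Relation.Binary.Definitions using (tri<; tri≈; tri>)
open import Relation.Binary.PropositionalEquality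
open import Relation.Binary.Structures using (IsStrictTotalOrder)
open import Relation.Nullary using (¬_; Dec; does; yes; no; contradiction)

-- The edge condition has its form because a stretch of π_t without breaks has the same width in
-- every nice coordination, whereas a break can be widened at will. So a distance common to all time
-- steps has to be at least every packed distance, and has to equal it wherever the stretch is
-- rigid. The obstacle is Δ̄ ≤ 0: a gap at a break then only has to be positive, so there is no
-- smallest one, and the packed positions need a surrogate small enough never to exclude a feasible
-- pair. Optimality is shown without a notion of longest path. The dynamic program leaves a
-- certificate for both directions: depths strictly increase along the edges that follow π₀, which
-- bounds the characters without wiggle in any nice coordination, and links to predecessors exhibit
-- as many characters. For the running time, the exponents of n and ℓ are computed from the syntax
-- of the loop program, and so is the set of arrays that a command leaves alone; this keeps the many
-- invariants small.

-- Loop programs: syntax, compilation and syntactic cost measures.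

infix  4 _[_]:=ᴺ_ _[_]:=ᴿ_
infix  3 when_then_else_ for_<_run_
infixr 2 _⨟_

-- Loop programs: for v < k run p runs v[0] from 0 up to the k-th entry of array 0, which
-- is n, ℓ or m.  They always terminate, so they denote functions on states.
data Cmd : Set where
  skip            : Cmd
  _[_]:=ᴺ_        : ℕ → NExp → NExp → Cmd
  _[_]:=ᴿ_        : ℕ → NExp → RExp → Cmd
  _⨟_             : Cmd → Cmd → Cmd
  when_then_else_ : Test → Cmd → Cmd → Cmd
  for_<_run_      : ℕ → ℕ → Cmd → Cmd

var dim : ℕ → NExp
var a = a [ `lit 0 ]ᴺ
dim k = 0 [ `lit k ]ᴺ

compile : Cmd → Program
compile skip                   = `skip
compile (a [ i ]:=ᴺ e)         = a [ i ]≔ᴺ e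
compile (a [ i ]:=ᴿ e)         = a [ i ]≔ᴿ e
compile (p ⨟ q)             = compile p ⨾ compile q
compile (when b then p else q) = `if b then compile p else compile q
compile (for v < k run p)       =
  v [ `lit 0 ]≔ᴺ `lit 0 ⨾
  `while var v `<ᴺ dim k repeat (compile p ⨾ v [ `lit 0 ]≔ᴺ var v `+ `lit 1)

-- Boolean-valued, so that for a concrete command and array the condition of not being written
-- reduces to `T true` and can be an implicit argument that is filled in automatically.
writesᴺ writesᴿ : Cmd → ℕ → Bool
writesᴺ skip                   b = false
writesᴺ (a [ _ ]:=ᴺ _)         b = does (b ≟ a)
writesᴺ (_ [ _ ]:=ᴿ _)         b = false
writesᴺ (p ⨟ q)             b = writesᴺ p b ∨ writesᴺ q b
writesᴺ (when _ then p else q) b = writesᴺ p b ∨ writesᴺ q b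
writesᴺ (for v < _ run p)       b = does (b ≟ v) ∨ writesᴺ p b
writesᴿ skip                   b = false
writesᴿ (_ [ _ ]:=ᴺ _)         b = false
writesᴿ (a [ _ ]:=ᴿ _)         b = does (b ≟ a)
writesᴿ (p ⨟ q)             b = writesᴿ p b ∨ writesᴿ q b
writesᴿ (when _ then p else q) b = writesᴿ p b ∨ writesᴿ q b
writesᴿ (for _ < _ run p)       b = writesᴿ p b

wellFormed : Cmd → Bool
wellFormed (p ⨟ q)             = wellFormed p ∧ wellFormed q
wellFormed (when _ then p else q) = wellFormed p ∧ wellFormed q
wellFormed (for v < _ run p)       =
  not (does (0 ≟ v)) ∧ not (writesᴺ p v) ∧ wellFormed p
wellFormed _                      = true

T-∧₁ : ∀ {a b} → T (a ∧ b) → T a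
T-∧₁ {true} _ = tt

T-∧₂ : ∀ {a b} → T (a ∧ b) → T b
T-∧₂ {true} t = t

T-∨₁ : ∀ {a b} → T (not (a ∨ b)) → T (not a)
T-∨₁ {false} _ = tt

T-∨₂ : ∀ {a b} → T (not (a ∨ b)) → T (not b)
T-∨₂ {false} t = t

T-not⇒false : ∀ {b} → T (not b) → b ≡ false
T-not⇒false {false} _ = refl

does⇒ : ∀ {A : Set} (a? : Dec A) → does a? ≡ true → A
does⇒ (yes a) _ = a

does⇒¬ : ∀ {A : Set} (a? : Dec A) → does a? ≡ false → ¬ A
does⇒¬ (no ¬a) _ = ¬a

does-yes : ∀ {A : Set} (a? : Dec A) → A → does a? ≡ true
does-yes (yes _) _ = refl
does-yes (no ¬a) a = contradiction a ¬a

does-no : ∀ {A : Set} (a? : Dec A) → ¬ A → does a? ≡ false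
does-no (yes a) ¬a = contradiction a ¬a
does-no (no _)  _  = refl

write-same : ∀ {X} (mem : Arrays X) a {i j} v → j ≡ i → write mem a i v a j ≡ v
write-same mem a {i} v refl
  rewrite does-yes (a ≟ a) refl | does-yes (i ≟ i) refl = refl

write-other : ∀ {X} (mem : Arrays X) a {i j} v → j ≢ i → write mem a i v a j ≡ mem a j
write-other mem a {i} {j} v j≢i
  rewrite does-yes (a ≟ a) refl | does-no (j ≟ i) j≢i = refl

iterate : ∀ {S : Set} → (S → S) → S → ℕ → S
iterate f s zero    = s
iterate f s (suc i) = f (iterate f s i)

-- Cost bounds c · nᵃ ℓᵇ.  As m ≤ 4 n² ℓ, a loop over the meetings counts as n² ℓ.
dimDegree : ℕ → ℕ × ℕ
dimDegree 0 = 1 , 0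
dimDegree 1 = 0 , 1
dimDegree _ = 2 , 1

degree : Cmd → ℕ × ℕ
degree (p ⨟ q)             = proj₁ (degree p) ⊔ proj₁ (degree q) , proj₂ (degree p) ⊔ proj₂ (degree q)
degree (when _ then p else q) = proj₁ (degree p) ⊔ proj₁ (degree q) , proj₂ (degree p) ⊔ proj₂ (degree q)
degree (for _ < k run p)       = proj₁ (dimDegree k) + proj₁ (degree p) , proj₂ (dimDegree k) + proj₂ (degree p)
degree _                      = 0 , 0

-- N passes of cost c make a loop of cost 8 + N (11 + c). The 4 bounds N relative to its monomial: m
-- is at most ℓ (n + 1)², hence at most 4 n² ℓ for n ≥ 1.
factor : Cmd → ℕ
factor skip                   = 1
factor (a [ i ]:=ᴺ e)         = suc (costᴺ i + costᴺ e)
factor (a [ i ]:=ᴿ e)         = suc (costᴺ i + costᴿ e)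
factor (p ⨟ q)             = factor p + factor q
factor (when b then p else q) = costᵀ b + (factor p + factor q)
factor (for _ < _ run p)       = 8 + 4 * (11 + factor p)

-- Semantics of loop programs: frames, invariants, termination and cost.

module LoopPrograms (ℝ : RealField) where
  open import Data.Nat using (_<_)
  open RealField ℝ using (Carrier; _<ᴿ?_; _≤ᴿ_) renaming (_<_ to _<ᴿ_)
  open RealRAM ℝ

  reset bump : ℕ → State → State
  reset v σ = ⟪ write (nats σ) v 0 0 , reals σ ⟫
  bump  v σ = ⟪ write (nats σ) v 0 (nats σ v 0 + 1) , reals σ ⟫

  exec : Cmd → State → State
  exec skip                   σ = σ
  exec (a [ i ]:=ᴺ e)         σ = ⟪ write (nats σ) a (evalᴺ σ i) (evalᴺ σ e) , reals σ ⟫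
  exec (a [ i ]:=ᴿ e)         σ = ⟪ nats σ , write (reals σ) a (evalᴺ σ i) (evalᴿ σ e) ⟫
  exec (p ⨟ q)             σ = exec q (exec p σ)
  exec (when b then p else q) σ = if evalᵀ σ b then exec p σ else exec q σ
  exec (for v < k run p)       σ =
    iterate (λ τ → bump v (exec p τ)) (reset v σ) (nats σ 0 k)

  -- The final state is a parameter rather than `exec p σ`, so that the start of a loop and any of
  -- its intermediate states are related too, as in `frame-iterate`.
  record Frame (p : Cmd) (σ τ : State) : Set where
    field
      frameᴺ : ∀ a {_ : T (not (writesᴺ p a))} j → nats τ a j ≡ nats σ a j
      frameᴿ : ∀ a {_ : T (not (writesᴿ p a))} j → reals τ a j ≡ reals σ a j
  open Frame public

  write-avoid : ∀ {X : Set} (mem : Arrays X) a i v b j → T (not (does (b ≟ a))) →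
                write mem a i v b j ≡ mem b j
  write-avoid mem a i v b j t rewrite T-not⇒false {does (b ≟ a)} t = refl

  frame : ∀ p σ → Frame p σ (exec p σ)
  frame-iterate : ∀ v k p σ i →
    Frame (for v < k run p) σ (iterate (λ τ → bump v (exec p τ)) (reset v σ) i)

  frameᴺ (frame skip σ) a j = refl
  frameᴺ (frame (a [ i ]:=ᴺ e) σ) b {t} j = write-avoid (nats σ) a _ _ b j t
  frameᴺ (frame (a [ i ]:=ᴿ e) σ) b j = refl
  frameᴺ (frame (p ⨟ q) σ) a {t} j =
    trans (frameᴺ (frame q (exec p σ)) a {T-∨₂ {writesᴺ p a} t} j)
          (frameᴺ (frame p σ) a {T-∨₁ t} j)
  frameᴺ (frame (when b then p else q) σ) a {t} j with evalᵀ σ b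
  ... | true  = frameᴺ (frame p σ) a {T-∨₁ t} j
  ... | false = frameᴺ (frame q σ) a {T-∨₂ {writesᴺ p a} t} j
  frameᴺ (frame (for v < k run p) σ) = frameᴺ (frame-iterate v k p σ (nats σ 0 k))
  frameᴿ (frame skip σ) a j = refl
  frameᴿ (frame (a [ i ]:=ᴺ e) σ) b j = refl
  frameᴿ (frame (a [ i ]:=ᴿ e) σ) b {t} j = write-avoid (reals σ) a _ _ b j t
  frameᴿ (frame (p ⨟ q) σ) a {t} j =
    trans (frameᴿ (frame q (exec p σ)) a {T-∨₂ {writesᴿ p a} t} j)
          (frameᴿ (frame p σ) a {T-∨₁ t} j)
  frameᴿ (frame (when b then p else q) σ) a {t} j with evalᵀ σ b
  ... | true  = frameᴿ (frame p σ) a {T-∨₁ t} j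
  ... | false = frameᴿ (frame q σ) a {T-∨₂ {writesᴿ p a} t} j
  frameᴿ (frame (for v < k run p) σ) = frameᴿ (frame-iterate v k p σ (nats σ 0 k))

  frameᴺ (frame-iterate v k p σ zero)    a {t} j = write-avoid (nats σ) v _ _ a j (T-∨₁ t)
  frameᴺ (frame-iterate v k p σ (suc i)) a {t} j =
    trans (write-avoid (nats (exec p τ)) v _ _ a j (T-∨₁ t))
   (trans (frameᴺ (frame p τ) a {T-∨₂ {does (a ≟ v)} t} j)
          (frameᴺ (frame-iterate v k p σ i) a {t} j))
    where τ = iterate (λ τ → bump v (exec p τ)) (reset v σ) i
  frameᴿ (frame-iterate v k p σ zero)    a j = refl
  frameᴿ (frame-iterate v k p σ (suc i)) a {t} j =
    trans (frameᴿ (frame p _) a {t} j) (frameᴿ (frame-iterate v k p σ i) a {t} j)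

  frame-⨟ : ∀ {p q σ τ υ} → Frame p σ τ → Frame q τ υ → Frame (p ⨟ q) σ υ
  frameᴺ (frame-⨟ {p} F G) a {t} j = trans (frameᴺ G a {T-∨₂ {writesᴺ p a} t} j) (frameᴺ F a {T-∨₁ t} j)
  frameᴿ (frame-⨟ {p} F G) a {t} j = trans (frameᴿ G a {T-∨₂ {writesᴿ p a} t} j) (frameᴿ F a {T-∨₁ t} j)

  counter : ∀ v p → T (not (writesᴺ p v)) → ∀ σ i →
            nats (iterate (λ τ → bump v (exec p τ)) (reset v σ) i) v 0 ≡ i
  counter v p t σ zero    = write-same (nats σ) v _ refl
  counter v p t σ (suc i) =
    trans (write-same (nats (exec p _)) v _ refl)
   (trans (+-comm _ 1) (cong suc
   (trans (frameᴺ (frame p _) v {t} 0) (counter v p t σ i))))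

  -- Besides the invariant, the step receives the frame of the passes made so far. Facts about
  -- arrays that the loop never writes thus stay out of the invariant.
  for-rule : ∀ v k p {_ : T (not (writesᴺ p v))} σ {N} (Inv : ℕ → State → Set) →
    nats σ 0 k ≡ N →
    Inv 0 (reset v σ) →
    (∀ (i : Fin N) τ → Frame (for v < k run p) σ τ → nats τ v 0 ≡ toℕ i →
     Inv (toℕ i) τ → Inv (suc (toℕ i)) (bump v (exec p τ))) →
    Inv N (exec (for v < k run p) σ)
  for-rule v k p {t} σ Inv refl base step = upTo _ ≤-refl
    where
    upTo : ∀ i → i ≤ nats σ 0 k →
           Inv i (iterate (λ τ → bump v (exec p τ)) (reset v σ) i)
    upTo zero    _  = base
    upTo (suc i) i< = subst (λ j → Inv (suc j) (bump v (exec p τ))) (toℕ-fromℕ< i<)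
      (step (fromℕ< i<) τ (frame-iterate v k p σ i)
        (trans (counter v p t σ i) (sym (toℕ-fromℕ< i<)))
        (subst (λ j → Inv j τ) (sym (toℕ-fromℕ< i<)) (upTo i (<⇒≤ i<))))
      where τ = iterate (λ τ → bump v (exec p τ)) (reset v σ) i

  when<ᴺ : ∀ (Q : State → Set) e f p q σ →
    (evalᴺ σ e < evalᴺ σ f → Q (exec p σ)) → (evalᴺ σ f ≤ evalᴺ σ e → Q (exec q σ)) →
    Q (exec (when e `<ᴺ f then p else q) σ)
  when<ᴺ Q e f p q σ yes! no! with evalᵀ σ (e `<ᴺ f) in eq
  ... | true  = yes! (does⇒ (evalᴺ σ e <? evalᴺ σ f) eq)
  ... | false = no! (≮⇒≥ (does⇒¬ (evalᴺ σ e <? evalᴺ σ f) eq))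

  when<ᴿ : ∀ (Q : State → Set) e f p q σ →
    (evalᴿ σ e <ᴿ evalᴿ σ f → Q (exec p σ)) → (evalᴿ σ f ≤ᴿ evalᴿ σ e → Q (exec q σ)) →
    Q (exec (when e `<ᴿ f then p else q) σ)
  when<ᴿ Q e f p q σ yes! no! with evalᴿ σ e <ᴿ? evalᴿ σ f
  ... | yes e<f = yes! e<f
  ... | no  e≮f = no! e≮f

  -- A conditional is charged for both branches, which makes the bound independent of the state. In
  -- a loop, 3 is the initialisation of the counter, 5 a test and 6 an increment; the last 5 is the
  -- failing test.
  cost : (ℕ → ℕ) → Cmd → ℕ
  cost N skip                   = 1
  cost N (a [ i ]:=ᴺ e)         = suc (costᴺ i + costᴺ e)
  cost N (a [ i ]:=ᴿ e)         = suc (costᴺ i + costᴿ e)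
  cost N (p ⨟ q)             = cost N p + cost N q
  cost N (when b then p else q) = costᵀ b + (cost N p + cost N q)
  cost N (for v < k run p)       = 3 + (N k * (5 + (cost N p + 6)) + 5)

  -- `exec` fixes the number of passes when it enters a loop, whereas the compiled loop rereads its
  -- bound at each test. They agree because array 0 is never written and no body touches its own
  -- counter.
  halts : ∀ p → T (wellFormed p) → T (not (writesᴺ p 0)) → ∀ N σ →
        (∀ k → nats σ 0 k ≡ N k) →
        ∃[ k ] (⟨ compile p , σ ⟩⇓⟨ exec p σ , k ⟩) × k ≤ cost N p
  halts skip           _ _ N σ _ = _ , skip⇓ , ≤-refl
  halts (a [ i ]:=ᴺ e) _ _ N σ _ = _ , assignᴺ⇓ , ≤-refl
  halts (a [ i ]:=ᴿ e) _ _ N σ _ = _ , assignᴿ⇓ , ≤-refl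
  halts (p ⨟ q) w t N σ d =
    let k , r , b = halts p (T-∧₁ w) (T-∨₁ t) N σ d
        l , s , c = halts q (T-∧₂ {wellFormed p} w) (T-∨₂ {writesᴺ p 0} t) N (exec p σ)
                      λ j → trans (frameᴺ (frame p σ) 0 {T-∨₁ t} j) (d j)
    in k + l , seq⇓ r s , +-mono-≤ b c
  halts (when b then p else q) w t N σ d with evalᵀ σ b in eq
  ... | true  = let k , r , c = halts p (T-∧₁ w) (T-∨₁ t) N σ d in
    _ , ifTrue⇓ eq r , +-monoʳ-≤ (costᵀ b) (≤-trans c (m≤m+n _ _))
  ... | false = let k , r , c = halts q (T-∧₂ {wellFormed p} w) (T-∨₂ {writesᴺ p 0} t) N σ d in
    _ , ifFalse⇓ eq r , +-monoʳ-≤ (costᵀ b) (≤-trans c (m≤n+m _ _))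
  halts (for v < k run p) w t N σ d =
    let c , r , b = while (nats σ 0 k) 0 refl in
    _ , seq⇓ assignᴺ⇓ r ,
    +-monoʳ-≤ 3 (≤-trans b (+-monoˡ-≤ 5 (*-monoˡ-≤ (5 + (cost N p + 6)) (≤-reflexive (d k)))))
    where
    states = iterate (λ τ → bump v (exec p τ)) (reset v σ)
    clean  = T-∧₁ (T-∧₂ {not (does (0 ≟ v))} w)
    dims : ∀ i j → nats (states i) 0 j ≡ nats σ 0 j
    dims i = frameᴺ (frame-iterate v k p σ i) 0 {t}
    -- Induction on the number r of remaining passes: a derivation for a while loop grows at its
    -- front, whereas `iterate` adds passes at the end.
    while : ∀ r i → i + r ≡ nats σ 0 k → ∃[ c ]
      (⟨ `while var v `<ᴺ dim k repeat (compile p ⨾ v [ `lit 0 ]≔ᴺ var v `+ `lit 1) , states i ⟩⇓⟨ states (nats σ 0 k) , c ⟩)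
      × c ≤ r * (5 + (cost N p + 6)) + 5
    while zero i eq rewrite +-identityʳ i = subst
      (λ j → ∃[ c ] (⟨ _ , states i ⟩⇓⟨ states j , c ⟩) × c ≤ 5) eq
      (_ , stop⇓ (does-no (_ <? _) λ lt → <-irrefl (trans eq (sym (dims i k))) (subst (_< nats (states i) 0 k) (counter v p clean σ i) lt)) , ≤-refl)
    while (suc r) i eq =
      let c , s , b = halts p (T-∧₂ {not (writesᴺ p v)} (T-∧₂ {not (does (0 ≟ v))} w)) (T-∨₂ {does (0 ≟ v)} t)
                        N (states i) λ j → trans (dims i j) (d j)
          e , u , f = while r (suc i) (trans (sym (+-suc i r)) eq)
          here = begin-strict
            nats (states i) v 0    ≡⟨ counter v p clean σ i ⟩
            i                      <⟨ m<m+n i (s≤s z≤n) ⟩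
            i + suc r              ≡⟨ trans eq (sym (dims i k)) ⟩
            nats (states i) 0 k    ∎
      in 5 + ((c + 6) + e) , loop⇓ (does-yes (_ <? _) here) (seq⇓ s assignᴺ⇓) u ,
         (begin-≤ b f)
      where
      open ≤-Reasoning
      begin-≤ : ∀ {c e} → c ≤ cost N p → e ≤ r * (5 + (cost N p + 6)) + 5 →
                5 + ((c + 6) + e) ≤ suc r * (5 + (cost N p + 6)) + 5
      begin-≤ {c} {e} b f = begin
        5 + ((c + 6) + e)  ≡⟨ +-assoc 5 (c + 6) e ⟨
        5 + (c + 6) + e    ≤⟨ +-mono-≤ (+-monoʳ-≤ 5 (+-monoˡ-≤ 6 b)) f ⟩
        5 + (cost N p + 6) + (r * (5 + (cost N p + 6)) + 5) ≡⟨ +-assoc (5 + (cost N p + 6)) _ 5 ⟨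
        suc r * (5 + (cost N p + 6)) + 5 ∎

  module _ (n ℓ : ℕ) (N : ℕ → ℕ) (1≤n : 1 ≤ n) (1≤ℓ : 1 ≤ ℓ) where
    monomial : ℕ × ℕ → ℕ
    monomial (a , b) = n ^ a * ℓ ^ b

    private instance
      nonZeroⁿ : ℕ.NonZero n
      nonZeroⁿ = ℕ.>-nonZero 1≤n
      nonZeroˡ : ℕ.NonZero ℓ
      nonZeroˡ = ℕ.>-nonZero 1≤ℓ

    -- Raising an exponent would lower the monomial if n or ℓ were 0, which is why empty instances
    -- are kept away from the cost analysis.
    monomial-mono : ∀ {a b c d} → a ≤ c → b ≤ d → monomial (a , b) ≤ monomial (c , d)
    monomial-mono a≤c b≤d = *-mono-≤ (^-monoʳ-≤ n a≤c) (^-monoʳ-≤ ℓ b≤d)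

    monomial≥1 : ∀ d → 1 ≤ monomial d
    monomial≥1 (a , b) = monomial-mono {0} {0} {a} {b} z≤n z≤n

    absorb : ∀ c d → c ≤ c * monomial d
    absorb c d = ≤-trans (≤-reflexive (sym (*-identityʳ c))) (*-monoʳ-≤ c (monomial≥1 d))

    sum≤ : ∀ {x y} p q → x ≤ factor p * monomial (degree p) → y ≤ factor q * monomial (degree q) →
           x + y ≤ (factor p + factor q) * monomial (degree (p ⨟ q))
    sum≤ {x} {y} p q x≤ y≤ = begin
      x + y                                        ≤⟨ +-mono-≤ x≤ y≤ ⟩
      factor p * monomial (degree p) + factor q * monomial (degree q)
        ≤⟨ +-mono-≤ (*-monoʳ-≤ (factor p) (monomial-mono {a = a} {b} (m≤m⊔n a c) (m≤m⊔n b d)))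
                    (*-monoʳ-≤ (factor q) (monomial-mono {a = c} {d} (m≤n⊔m a c) (m≤n⊔m b d))) ⟩
      factor p * U + factor q * U                  ≡⟨ *-distribʳ-+ U (factor p) (factor q) ⟨
      (factor p + factor q) * U                    ∎
      where
      open ≤-Reasoning
      U = monomial (degree (p ⨟ q))
      a = proj₁ (degree p)
      c = proj₁ (degree q)
      b = proj₂ (degree p)
      d = proj₂ (degree q)

    cost≤ : (∀ k → N k ≤ 4 * monomial (dimDegree k)) →
            ∀ p → cost N p ≤ factor p * monomial (degree p)
    cost≤ N≤ skip           = ≤-refl
    cost≤ N≤ (a [ i ]:=ᴺ e) = absorb _ (0 , 0)
    cost≤ N≤ (a [ i ]:=ᴿ e) = absorb _ (0 , 0)
    cost≤ N≤ (p ⨟ q)        = sum≤ p q (cost≤ N≤ p) (cost≤ N≤ q)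
    cost≤ N≤ (when b then p else q) = begin
      costᵀ b + (cost N p + cost N q)
        ≤⟨ +-mono-≤ (absorb (costᵀ b) (degree (p ⨟ q))) (sum≤ p q (cost≤ N≤ p) (cost≤ N≤ q)) ⟩
      costᵀ b * U + (factor p + factor q) * U         ≡⟨ *-distribʳ-+ U (costᵀ b) _ ⟨
      (costᵀ b + (factor p + factor q)) * U           ∎
      where
      open ≤-Reasoning
      U = monomial (degree (p ⨟ q))
    cost≤ N≤ (for v < k run p) = begin
      3 + (N k * (5 + (cost N p + 6)) + 5)      ≡⟨ shape (N k) (cost N p) ⟩
      8 + N k * (11 + cost N p)
        ≤⟨ +-mono-≤ (absorb 8 (degree (for v < k run p)))
             (*-mono-≤ (N≤ k) (+-mono-≤ (absorb 11 (degree p)) (cost≤ N≤ p))) ⟩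
      8 * W + 4 * V * (11 * U + factor p * U)   ≡⟨ cong (λ x → 8 * x + 4 * V * (11 * U + factor p * U)) W≡ ⟩
      8 * (V * U) + 4 * V * (11 * U + factor p * U) ≡⟨ shape′ U V (factor p) ⟩
      (8 + 4 * (11 + factor p)) * (V * U)       ≡⟨ cong ((8 + 4 * (11 + factor p)) *_) W≡ ⟨
      (8 + 4 * (11 + factor p)) * W             ∎
      where
      open ≤-Reasoning
      U = monomial (degree p)
      V = monomial (dimDegree k)
      W = monomial (degree (for v < k run p))
      shape : ∀ x c → 3 + (x * (5 + (c + 6)) + 5) ≡ 8 + x * (11 + c)
      shape = solve-∀
      shape′ : ∀ u v f → 8 * (v * u) + 4 * v * (11 * u + f * u) ≡ (8 + 4 * (11 + f)) * (v * u)
      shape′ = solve-∀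
      swap : ∀ a b c d → (a * b) * (c * d) ≡ (a * c) * (b * d)
      swap = solve-∀
      W≡ : W ≡ V * U
      W≡ = trans (cong₂ _*_ (^-distribˡ-+-* n (proj₁ (dimDegree k)) _) (^-distribˡ-+-* ℓ (proj₂ (dimDegree k)) _))
                 (swap (n ^ proj₁ (dimDegree k)) _ _ _)

-- Ordered field arithmetic, natural multiples and finite maxima.

module RealProperties (ℝ : RealField) where
  open import Data.Nat using (_<_)
  open RealField ℝ renaming (_<_ to _<ᴿ_; _≤ᴿ_ to infix 4 _≤ᴿ_)
  open IsCommutativeRing isCommutativeRing public
    using (-‿inverseˡ; -‿inverseʳ; distribʳ; zeroˡ; zeroʳ)
    renaming (+-comm to ⊕-comm; +-assoc to ⊕-assoc; +-identityˡ to ⊕-identityˡ; +-identityʳ to ⊕-identityʳ;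
              *-assoc to ⊗-assoc; *-comm to ⊗-comm; *-identityˡ to ⊗-identityˡ)
  open IsStrictTotalOrder isStrictTotalOrder public
    using () renaming (trans to <ᴿ-trans; irrefl to <ᴿ-irrefl; asym to <ᴿ-asym)

  realRing : CommutativeRing _ _
  realRing = record { isCommutativeRing = isCommutativeRing }

  open Algebra.Properties.AbelianGroup (CommutativeRing.+-abelianGroup realRing) public
    using () renaming (⁻¹-anti-homo‿- to neg-⊖; ∙-cancelˡ to ⊕-cancelˡ)
  <ᴿ⇒≤ᴿ : ∀ {x y} → x <ᴿ y → x ≤ᴿ y
  <ᴿ⇒≤ᴿ x<y y<x = <ᴿ-asym x<y y<x

  ≤ᴿ-refl : ∀ {x} → x ≤ᴿ x
  ≤ᴿ-refl = <ᴿ-irrefl refl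

  ≤ᴿ-reflexive : ∀ {x y} → x ≡ y → x ≤ᴿ y
  ≤ᴿ-reflexive refl = ≤ᴿ-refl

  <-≤ᴿ-trans : ∀ {x y z} → x <ᴿ y → y ≤ᴿ z → x <ᴿ z
  <-≤ᴿ-trans {x} {y} {z} x<y y≤z with compare y z
  ... | tri< y<z _ _  = <ᴿ-trans x<y y<z
  ... | tri≈ _ refl _ = x<y
  ... | tri> _ _ z<y  = contradiction z<y y≤z

  ≤-<ᴿ-trans : ∀ {x y z} → x ≤ᴿ y → y <ᴿ z → x <ᴿ z
  ≤-<ᴿ-trans {x} {y} {z} x≤y y<z with compare x y
  ... | tri< x<y _ _  = <ᴿ-trans x<y y<z
  ... | tri≈ _ refl _ = y<z
  ... | tri> _ _ y<x  = contradiction y<x x≤y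

  ≤ᴿ-trans : ∀ {x y z} → x ≤ᴿ y → y ≤ᴿ z → x ≤ᴿ z
  ≤ᴿ-trans x≤y y≤z z<x = x≤y (≤-<ᴿ-trans y≤z z<x)

  ≤ᴿ-antisym : ∀ {x y} → x ≤ᴿ y → y ≤ᴿ x → x ≡ y
  ≤ᴿ-antisym {x} {y} x≤y y≤x with compare x y
  ... | tri< x<y _ _ = contradiction x<y y≤x
  ... | tri≈ _ x≡y _ = x≡y
  ... | tri> _ _ y<x = contradiction y<x x≤y

  ⊕-⊖ : ∀ x y → (x ⊕ y) ⊖ y ≡ x
  ⊕-⊖ x y = trans (⊕-assoc x y (neg y)) (trans (cong (x ⊕_) (-‿inverseʳ y)) (⊕-identityʳ x))

  ⊖-⊕ : ∀ x y → (x ⊖ y) ⊕ y ≡ x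
  ⊖-⊕ x y = trans (⊕-assoc x (neg y) y) (trans (cong (x ⊕_) (-‿inverseˡ y)) (⊕-identityʳ x))

  ⊖-unique : ∀ {x y z} → z ⊕ y ≡ x → x ⊖ y ≡ z
  ⊖-unique {y = y} {z} refl = ⊕-⊖ z y

  ⊕-monoˡ-< : ∀ x {y z} → y <ᴿ z → y ⊕ x <ᴿ z ⊕ x
  ⊕-monoˡ-< x {y} {z} y<z = subst₂ _<ᴿ_ (⊕-comm x y) (⊕-comm x z) (⊕-monoʳ-< x y<z)

  ⊕-cancelʳ-< : ∀ x {y z} → y ⊕ x <ᴿ z ⊕ x → y <ᴿ z
  ⊕-cancelʳ-< x {y} {z} lt = subst₂ _<ᴿ_ (⊕-⊖ y x) (⊕-⊖ z x) (⊕-monoˡ-< (neg x) lt)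

  ⊕-cancelˡ-< : ∀ x {y z} → x ⊕ y <ᴿ x ⊕ z → y <ᴿ z
  ⊕-cancelˡ-< x {y} {z} lt = ⊕-cancelʳ-< x (subst₂ _<ᴿ_ (⊕-comm x y) (⊕-comm x z) lt)

  ⊕-monoˡ-≤ : ∀ x {y z} → y ≤ᴿ z → y ⊕ x ≤ᴿ z ⊕ x
  ⊕-monoˡ-≤ x y≤z lt = y≤z (⊕-cancelʳ-< x lt)

  ⊕-monoʳ-≤ : ∀ x {y z} → y ≤ᴿ z → x ⊕ y ≤ᴿ x ⊕ z
  ⊕-monoʳ-≤ x y≤z lt = y≤z (⊕-cancelˡ-< x lt)

  ⊕-cancelˡ-≤ : ∀ x {y z} → x ⊕ y ≤ᴿ x ⊕ z → y ≤ᴿ z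
  ⊕-cancelˡ-≤ x le lt = le (⊕-monoʳ-< x lt)

  ⊕-mono-≤ : ∀ {w x y z} → w ≤ᴿ x → y ≤ᴿ z → w ⊕ y ≤ᴿ x ⊕ z
  ⊕-mono-≤ w≤x y≤z = ≤ᴿ-trans (⊕-monoˡ-≤ _ w≤x) (⊕-monoʳ-≤ _ y≤z)

  ⊕-mono-<-≤ : ∀ {w x y z} → w <ᴿ x → y ≤ᴿ z → w ⊕ y <ᴿ x ⊕ z
  ⊕-mono-<-≤ w<x y≤z = <-≤ᴿ-trans (⊕-monoˡ-< _ w<x) (⊕-monoʳ-≤ _ y≤z)

  x<x⊕y : ∀ x {y} → 0# <ᴿ y → x <ᴿ x ⊕ y
  x<x⊕y x {y} 0<y = subst (_<ᴿ x ⊕ y) (⊕-identityʳ x) (⊕-monoʳ-< x 0<y)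

  x<y⇒0<y⊖x : ∀ {x y} → x <ᴿ y → 0# <ᴿ y ⊖ x
  x<y⇒0<y⊖x {x} {y} x<y = subst (_<ᴿ y ⊖ x) (-‿inverseʳ x) (⊕-monoˡ-< (neg x) x<y)

  neg-anti-≤ : ∀ {x y} → x ≤ᴿ y → neg y ≤ᴿ neg x
  neg-anti-≤ {x} {y} x≤y lt = x≤y (subst₂ _<ᴿ_ (left y x) (right x) (⊕-monoʳ-< (x ⊕ y) lt))
    where
    right : ∀ x → (x ⊕ y) ⊕ neg y ≡ x
    right x = ⊕-⊖ x y
    left : ∀ y x → (x ⊕ y) ⊕ neg x ≡ y
    left y x = trans (cong (_⊖ x) (⊕-comm x y)) (⊕-⊖ y x)

  abs-nonneg : ∀ {x} → 0# ≤ᴿ x → abs x ≡ x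
  abs-nonneg {x} 0≤x with x <ᴿ? 0#
  ... | yes x<0 = contradiction x<0 0≤x
  ... | no  _   = refl

  infixr 8 _·_
  _·_ : ℕ → Carrier → Carrier
  zero  · x = 0#
  suc k · x = x ⊕ k · x

  ·-homo-+ : ∀ j k x → (j + k) · x ≡ j · x ⊕ k · x
  ·-homo-+ zero    k x = sym (⊕-identityˡ _)
  ·-homo-+ (suc j) k x = trans (cong (x ⊕_) (·-homo-+ j k x)) (sym (⊕-assoc x _ _))

  ·-nonneg : ∀ k {x} → 0# ≤ᴿ x → 0# ≤ᴿ k · x
  ·-nonneg zero    0≤x = ≤ᴿ-refl
  ·-nonneg (suc k) {x} 0≤x =
    subst (_≤ᴿ x ⊕ k · x) (⊕-identityˡ 0#) (⊕-mono-≤ 0≤x (·-nonneg k 0≤x))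

  ·-monoˡ-≤ : ∀ {j k x} → 0# ≤ᴿ x → j ≤ k → j · x ≤ᴿ k · x
  ·-monoˡ-≤ {k = k} 0≤x z≤n = ·-nonneg k 0≤x
  ·-monoˡ-≤ 0≤x (s≤s j≤k) = ⊕-monoʳ-≤ _ (·-monoˡ-≤ 0≤x j≤k)

  ·-⊗ : ∀ k x → k · 1# ⊗ x ≡ k · x
  ·-⊗ zero    x = zeroˡ x
  ·-⊗ (suc k) x = trans (distribʳ x 1# _) (cong₂ _⊕_ (⊗-identityˡ x) (·-⊗ k x))

  ·-pos : ∀ k {x} → 0# <ᴿ x → 0# <ᴿ suc k · x
  ·-pos k {x} 0<x = <-≤ᴿ-trans 0<x (subst (_≤ᴿ x ⊕ k · x) (⊕-identityʳ x) (⊕-monoʳ-≤ x (·-nonneg k (<ᴿ⇒≤ᴿ 0<x))))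

  -- The inverse is unspecified only at 0, and `k · 1#` is positive for k > 0 because 0 < 1.
  ·-⊘ : ∀ k x → k ≢ 0 → k · (x ⊗ (k · 1#) ⁻¹) ≡ x
  ·-⊘ zero    x k≢0 = contradiction refl k≢0
  ·-⊘ (suc k) x _   =
    trans (sym (·-⊗ (suc k) _))
   (trans (cong (N ⊗_) (⊗-comm x _))
   (trans (sym (⊗-assoc N _ x))
   (trans (cong (_⊗ x) (⁻¹-inverse N λ N≡0 → <ᴿ-irrefl (sym N≡0) (·-pos k 0<1)))
          (⊗-identityˡ x))))
    where N = suc k · 1#

  ·-nonpos : ∀ k {x} → x ≤ᴿ 0# → k · x ≤ᴿ 0#
  ·-nonpos zero    x≤0 = ≤ᴿ-refl
  ·-nonpos (suc k) {x} x≤0 =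
    subst (x ⊕ k · x ≤ᴿ_) (⊕-identityˡ 0#) (⊕-mono-≤ x≤0 (·-nonpos k x≤0))

  ⊘-pos : ∀ k {x} → k ≢ 0 → 0# <ᴿ x → 0# <ᴿ x ⊗ (k · 1#) ⁻¹
  ⊘-pos k {x} k≢0 0<x with 0# <ᴿ? x ⊗ (k · 1#) ⁻¹
  ... | yes lt = lt
  ... | no  ge = contradiction (subst (0# <ᴿ_) (sym (·-⊘ k x k≢0)) 0<x) (·-nonpos k ge)

  -- The guarded running maximum in exactly the form in which a loop computes it; everything else
  -- uses only its properties as a least upper bound of the base z and the guarded values.
  sup : Carrier → (ℕ → Bool) → (ℕ → Carrier) → ℕ → Carrier
  sup z g f zero    = z
  sup z g f (suc i) =
    if g i then (if does (sup z g f i <ᴿ? f i) then f i else sup z g f i) else sup z g f i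

  module _ {z : Carrier} {g : ℕ → Bool} {f : ℕ → Carrier} where
    sup-step : ∀ i → sup z g f i ≤ᴿ sup z g f (suc i)
    sup-step i with g i
    ... | false = ≤ᴿ-refl
    ... | true with sup z g f i <ᴿ? f i
    ...   | yes lt = <ᴿ⇒≤ᴿ lt
    ...   | no  _  = ≤ᴿ-refl

    sup-base : ∀ k → z ≤ᴿ sup z g f k
    sup-base zero    = ≤ᴿ-refl
    sup-base (suc k) = ≤ᴿ-trans (sup-base k) (sup-step k)

    sup-upper : ∀ {i k} → i < k → g i ≡ true → f i ≤ᴿ sup z g f k
    sup-upper {i} {suc k} (s≤s i≤k) gi with m≤n⇒m<n∨m≡n i≤k
    ... | inj₁ i<k  = ≤ᴿ-trans (sup-upper i<k gi) (sup-step k)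
    ... | inj₂ refl rewrite gi with sup z g f i <ᴿ? f i
    ...   | yes _  = ≤ᴿ-refl
    ...   | no  ge = ge

    sup-least : ∀ {y} k → z ≤ᴿ y → (∀ {i} → i < k → g i ≡ true → f i ≤ᴿ y) → sup z g f k ≤ᴿ y
    sup-least zero    z≤y f≤y = z≤y
    sup-least (suc k) z≤y f≤y with g k in gk | sup-least k z≤y (λ i<k → f≤y (m<n⇒m<1+n i<k))
    ... | false | ih = ih
    ... | true  | ih with sup z g f k <ᴿ? f k
    ...   | yes _ = f≤y (n<1+n k) gk
    ...   | no  _ = ih

-- Memory layout and the program for packed positions and breaks.

-- Arrays of natural numbers, beginning with those of the input.
activeᴬ countᴬ orderᴬ timeᴬ startᴬ sizeᴬ rowᴬ reachᴬ breaksᴬ depthᴬ predᴬ markᴬ : ℕ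
tᴬ iᴬ jᴬ farᴬ breakᴬ badᴬ restᴬ srcᴬ tgtᴬ bestᴬ : ℕ
activeᴬ = 1
countᴬ  = 2
orderᴬ  = 3
timeᴬ   = 4
startᴬ  = 5
sizeᴬ   = 6
rowᴬ    = 7
reachᴬ  = 8
breaksᴬ = 9
depthᴬ  = 10
predᴬ   = 11
markᴬ   = 12
tᴬ      = 13
iᴬ      = 14
jᴬ      = 15
farᴬ    = 16
breakᴬ  = 17
badᴬ    = 18
restᴬ   = 19
srcᴬ    = 20
tgtᴬ    = 21
bestᴬ   = 22

-- Arrays of reals; array 1 is the output.
outᴬ packedᴬ heightᴬ sumᴬ gapᴬ unitsᴬ distᴬ lowᴬ shiftᴬ : ℕ
outᴬ    = 1
packedᴬ = 2
heightᴬ = 3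
sumᴬ    = 4
gapᴬ    = 5
unitsᴬ  = 6
distᴬ   = 7
lowᴬ    = 8
shiftᴬ  = 9

varᴿ : ℕ → RExp
varᴿ a = a [ `lit 0 ]ᴿ

cell : NExp → NExp → NExp
cell t c = rowᴬ [ t ]ᴺ `+ c

at : ℕ → NExp → NExp → NExp
at a t c = a [ cell t c ]ᴺ

atᴿ : ℕ → NExp → NExp → RExp
atᴿ a t c = a [ cell t c ]ᴿ

computeRows computeReach computeGap advance extendReach store computePacked : Cmd

-- Naturals cannot be multiplied by a program, so the row offsets t n are tabulated by repeated
-- addition, from an initial entry 0.
computeRows =
  for tᴬ < 1 run rowᴬ [ var tᴬ `+ `lit 1 ]:=ᴺ rowᴬ [ var tᴬ ]ᴺ `+ dim 0

blockEnd : NExp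
blockEnd = startᴬ [ var tᴬ ]ᴺ `+ sizeᴬ [ var tᴬ ]ᴺ

blockCell : NExp
blockCell = cell (timeᴬ [ var tᴬ ]ᴺ) (startᴬ [ var tᴬ ]ᴺ)

computeReach =
  for tᴬ < 2 run
    -- An empty block may start at position n, whose cell would be the first one of the next row.
    when `lit 0 `<ᴺ sizeᴬ [ var tᴬ ]ᴺ
    then when reachᴬ [ blockCell ]ᴺ `<ᴺ blockEnd
         then reachᴬ [ blockCell ]:=ᴺ blockEnd
         else skip
    else skip

computeGap =
  -- Expressions offer no conversion of a natural to a real, so n is rebuilt by adding 1; it is the
  -- denominator of the small gap.
  for iᴬ < 0 run unitsᴬ [ `lit 0 ]:=ᴿ `1 `⊕ varᴿ unitsᴬ
  ⨟ when `0 `<ᴿ 0 [ `lit 1 ]ᴿ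
    then gapᴬ [ `lit 0 ]:=ᴿ 0 [ `lit 1 ]ᴿ
    else when `0 `<ᴿ 0 [ `lit 0 ]ᴿ
         then gapᴬ [ `lit 0 ]:=ᴿ 0 [ `lit 0 ]ᴿ `⊘ varᴿ unitsᴬ
         else gapᴬ [ `lit 0 ]:=ᴿ `1

-- farᴬ holds the largest end of a meeting block that starts before position i of π_t, so
-- positions i - 1 and i share a meeting iff i < far.
advance =
  when var iᴬ `<ᴺ var farᴬ
  then sumᴬ [ `lit 0 ]:=ᴿ varᴿ sumᴬ `⊕ 0 [ `lit 0 ]ᴿ
  else (sumᴬ [ `lit 0 ]:=ᴿ varᴿ sumᴬ `⊕ varᴿ gapᴬ
        ⨟ breakᴬ [ `lit 0 ]:=ᴺ `lit 1 `+ var breakᴬ)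

extendReach =
  when var farᴬ `<ᴺ at reachᴬ (var tᴬ) (var iᴬ)
  then farᴬ [ `lit 0 ]:=ᴺ at reachᴬ (var tᴬ) (var iᴬ)
  else skip

charCell : NExp
charCell = cell (var tᴬ) (at orderᴬ (var tᴬ) (var iᴬ))

store =
  when var iᴬ `<ᴺ countᴬ [ var tᴬ ]ᴺ
  then (packedᴬ [ charCell ]:=ᴿ varᴿ sumᴬ ⨟ breaksᴬ [ charCell ]:=ᴺ var breakᴬ)
  else skip

computePacked =
  for tᴬ < 1 run (
    sumᴬ [ `lit 0 ]:=ᴿ `0
    ⨟ breakᴬ [ `lit 0 ]:=ᴺ `lit 0
    ⨟ farᴬ [ `lit 0 ]:=ᴺ `lit 0
    ⨟ for iᴬ < 0 run (advance ⨟ extendReach ⨟ store))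

elem : ℕ → List ℕ → Bool
elem a []       = false
elem a (b ∷ bs) = does (a ≟ b) ∨ elem a bs

keeps : (ℕ → Bool) → List ℕ → Bool
keeps w []       = true
keeps w (a ∷ as) = not (w a) ∧ keeps w as

keeps-elem : ∀ w as {a} → T (keeps w as) → T (elem a as) → T (not (w a))
keeps-elem w (b ∷ as) {a} k e with does (a ≟ b) in eq
... | true  rewrite does⇒ (a ≟ b) eq = T-∧₁ k
... | false = keeps-elem w as (T-∧₂ {not (w b)} k) e

module Memory (ℝ : RealField) where
  open import Data.Nat using (_<_)
  open RealField ℝ renaming (_<_ to _<ᴿ_; _≤ᴿ_ to infix 4 _≤ᴿ_)
  open RealRAM ℝ
  open LoopPrograms ℝ
  open RealProperties ℝ

  -- The counterpart of `Frame` that lists what is preserved instead of the command that ran; it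
  -- therefore composes across different commands.
  record Agree (as bs : List ℕ) (σ τ : State) : Set where
    field
      onᴺ : ∀ a {_ : T (elem a as)} j → nats τ a j ≡ nats σ a j
      onᴿ : ∀ b {_ : T (elem b bs)} j → reals τ b j ≡ reals σ b j
  open Agree public

  agree-frame : ∀ {as bs σ τ υ p} → Frame p τ υ →
    {_ : T (keeps (writesᴺ p) as)} {_ : T (keeps (writesᴿ p) bs)} →
    Agree as bs σ τ → Agree as bs σ υ
  onᴺ (agree-frame {as} {p = p} F {k} A) a {e} j =
    trans (frameᴺ F a {keeps-elem (writesᴺ p) as k e} j) (onᴺ A a {e} j)
  onᴿ (agree-frame {bs = bs} {p = p} F {_} {k} A) b {e} j =
    trans (frameᴿ F b {keeps-elem (writesᴿ p) bs k e} j) (onᴿ A b {e} j)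

  agree-refl : ∀ {as bs σ} → Agree as bs σ σ
  onᴺ agree-refl a j = refl
  onᴿ agree-refl b j = refl

  -- The maximum loops of `checkEdge` and `placeAll` are written out but are definitionally
  -- instances of this one, so a single specification serves all three.
  maximise : ℕ → ℕ → ℕ → Test → RExp → Cmd
  maximise a v k guard e =
    for v < k run
      when guard
      then when varᴿ a `<ᴿ e then a [ `lit 0 ]:=ᴿ e else skip
      else skip

  maximise-spec : ∀ a v k guard e σ {N} {g : ℕ → Bool} {f : ℕ → Carrier} {z} →
    nats σ 0 k ≡ N → reals σ a 0 ≡ z →
    (∀ (i : Fin N) τ → Frame (maximise a v k guard e) σ τ → nats τ v 0 ≡ toℕ i →
     evalᵀ τ guard ≡ g (toℕ i) × evalᴿ τ e ≡ f (toℕ i)) →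
    reals (exec (maximise a v k guard e) σ) a 0 ≡ sup z g f N
  maximise-spec a v k guard e σ {N} {g} {f} {z} N≡ z≡ read =
    for-rule v k body σ (λ i τ → reals τ a 0 ≡ sup z g f i) N≡ z≡ step
    where
    inner body : Cmd
    inner = when varᴿ a `<ᴿ e then a [ `lit 0 ]:=ᴿ e else skip
    body = when guard then inner else skip
    step : ∀ (i : Fin N) τ → Frame (maximise a v k guard e) σ τ → nats τ v 0 ≡ toℕ i →
           reals τ a 0 ≡ sup z g f (toℕ i) → reals (exec body τ) a 0 ≡ sup z g f (suc (toℕ i))
    step i τ F v≡ inv with read i τ F v≡
    ... | g≡ , f≡ with evalᵀ τ guard | g (toℕ i) | g≡
    ...   | false | false | _ = inv
    ...   | true  | true  | _ rewrite sym f≡ | sym inv with reals τ a 0 <ᴿ? evalᴿ τ e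
    ...     | yes _ = write-same (reals τ) a _ refl
    ...     | no  _ = refl

-- Entries of arrays and matrices; lists without repetitions.

array-entry : ∀ {X : Set} {k} d (f : Fin k → X) i → array d f (toℕ i) ≡ f i
array-entry {k = k} d f i with toℕ i <? k
... | yes i<k = cong f (fromℕ<-toℕ i i<k)
... | no  i≮k = contradiction (toℕ<n i) i≮k

toℕ-combine′ : ∀ {r s} (t : Fin r) (c : Fin s) → toℕ (combine t c) ≡ toℕ t * s + toℕ c
toℕ-combine′ {s = s} t c = trans (toℕ-combine t c) (cong (_+ toℕ c) (*-comm s (toℕ t)))

matrix-entry : ∀ {X : Set} {r s} d (f : Fin r → Fin s → X) t c →
               matrix d f (toℕ t * s + toℕ c) ≡ f t c
matrix-entry {r = r} {s} d f t c =
  trans (cong (matrix d f) (sym (toℕ-combine′ t c)))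
 (trans (array-entry d (uncurry f ∘ remQuot {r} s) (combine t c))
        (cong (uncurry f) (remQuot-combine t c)))

cell-injective : ∀ {r s} {t t′ : Fin r} {c c′ : Fin s} →
                 toℕ t * s + toℕ c ≡ toℕ t′ * s + toℕ c′ → t ≡ t′ × c ≡ c′
cell-injective {t = t} {t′} {c} {c′} eq =
  combine-injective t c t′ c′
    (toℕ-injective (trans (toℕ-combine′ t c) (trans eq (sym (toℕ-combine′ t′ c′)))))

lookup-injective : ∀ {A : Set} {xs : List A} → Unique xs → ∀ {i j} → lookup xs i ≡ lookup xs j → i ≡ j
lookup-injective (_ ∷ _)  {Fin.zero}  {Fin.zero}  _  = refl
lookup-injective (x∉ ∷ _) {Fin.zero}  {Fin.suc j} eq = contradiction eq (All.lookup x∉ (∈-lookup j))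
lookup-injective (x∉ ∷ _) {Fin.suc i} {Fin.zero}  eq = contradiction (sym eq) (All.lookup x∉ (∈-lookup i))
lookup-injective (_ ∷ u)  {Fin.suc i} {Fin.suc j} eq = cong Fin.suc (lookup-injective u eq)

unique⊆⇒length≤ : ∀ {A : Set} {xs ys : List A} → Unique xs → (∀ {x} → x ∈ xs → x ∈ ys) →
                  length xs ≤ length ys
unique⊆⇒length≤ {xs = xs} {ys} u sub = injective⇒≤ {f = λ i → index (sub (∈-lookup i))} λ {i} {j} eq →
  lookup-injective u (trans (lookup-index (sub (∈-lookup i)))
    (trans (cong (lookup ys) eq) (sym (lookup-index (sub (∈-lookup j))))))

unique⇒length≤ : ∀ {n} {xs : List (Fin n)} → Unique xs → length xs ≤ n
unique⇒length≤ {xs = xs} u = injective⇒≤ {f = lookup xs} (lookup-injective u)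

module Storyline (I : OrderedStoryline) where
  open OrderedStoryline I

  length≤n : ∀ t → length (π t) ≤ n
  length≤n t = unique⇒length≤ (π-unique t)

  blockEnd≤n : ∀ M → meetingStart M + meetingSize M ≤ n
  blockEnd≤n M with meeting-consecutive M
  ... | xs , ys , zs , eq , _ = begin
    length xs + length ys                ≤⟨ m≤m+n _ (length zs) ⟩
    length xs + length ys + length zs    ≡⟨ +-assoc (length xs) _ _ ⟩
    length xs + (length ys + length zs)  ≡⟨ cong (length xs +_) (length-++ ys) ⟨
    length xs + length (ys ++ zs)        ≡⟨ length-++ xs ⟨
    length (xs ++ ys ++ zs)              ≡⟨ cong length eq ⟨
    length (π (tm M))                    ≤⟨ length≤n (tm M) ⟩
    n                                    ∎
    where open ≤-Reasoning

-- Correctness of the row offsets, the block ends and the gap.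

module Preparation (ℝ : RealField) (I : OrderedStoryline) where
  open import Data.Nat using (_<_)
  open RealField ℝ renaming (_<_ to _<ᴿ_; _≤ᴿ_ to infix 4 _≤ᴿ_)
  open RealRAM ℝ
  open LoopPrograms ℝ
  open RealProperties ℝ
  open OrderedStoryline I
  open Storyline I

  ix : Fin ℓ → ℕ → ℕ
  ix t j = toℕ t * n + j

  rows-spec : ∀ σ → nats σ 0 0 ≡ n → nats σ 0 1 ≡ ℓ → nats σ rowᴬ 0 ≡ 0 →
              ∀ t → t ≤ ℓ → nats (exec computeRows σ) rowᴬ t ≡ t * n
  rows-spec σ n≡ ℓ≡ 0≡ =
    for-rule tᴬ 1 _ σ (λ k τ → ∀ t → t ≤ k → nats τ rowᴬ t ≡ t * n) ℓ≡ (λ { zero z≤n → 0≡ }) step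
    where
    step : ∀ (i : Fin ℓ) τ → Frame computeRows σ τ → nats τ tᴬ 0 ≡ toℕ i →
           (∀ t → t ≤ toℕ i → nats τ rowᴬ t ≡ t * n) → ∀ t → t ≤ suc (toℕ i) →
           write (nats τ) rowᴬ (nats τ tᴬ 0 + 1) (nats τ rowᴬ (nats τ tᴬ 0) + nats τ 0 0) rowᴬ t ≡ t * n
    step i τ F t≡ inv t t≤ with m≤n⇒m<n∨m≡n t≤
    ... | inj₁ (s≤s t≤i) = trans
      (write-other (nats τ) rowᴬ _ (<⇒≢ (subst (t <_) (sym (trans (cong (_+ 1) t≡) (+-comm _ 1))) (s≤s t≤i))))
      (inv t t≤i)
    ... | inj₂ refl = trans
      (write-same (nats τ) rowᴬ _ (sym (trans (cong (_+ 1) t≡) (+-comm _ 1))))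
      (trans (cong₂ _+_ (trans (cong (nats τ rowᴬ) t≡) (inv (toℕ i) ≤-refl)) (trans (frameᴺ F 0 0) n≡))
             (+-comm _ n))

  -- A maximum of block ends is described by the set of numbers below it: a further meeting then
  -- only enlarges a union, and the empty union matches the default 0.
  Reaches : ℕ → Fin ℓ → Fin n → ℕ → Set
  Reaches k t s x = ∃[ M ] (toℕ M < k × tm M ≡ t × meetingStart M ≡ toℕ s ×
                            0 < meetingSize M × x < meetingStart M + meetingSize M)

  reach-spec : ∀ σ → (∀ t → nats σ rowᴬ (toℕ t) ≡ toℕ t * n) → nats σ 0 2 ≡ m →
    (∀ M → nats σ timeᴬ (toℕ M) ≡ toℕ (tm M)) →
    (∀ M → nats σ startᴬ (toℕ M) ≡ meetingStart M) →
    (∀ M → nats σ sizeᴬ (toℕ M) ≡ meetingSize M) →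
    (∀ j → nats σ reachᴬ j ≡ 0) →
    ∀ t s x → x < nats (exec computeReach σ) reachᴬ (ix t (toℕ s)) ⇔ Reaches m t s x
  reach-spec σ row≡ m≡ tm≡ st≡ sz≡ 0≡ =
    for-rule tᴬ 2 _ σ Inv m≡
      (λ t s x → mk⇔ (λ lt → contradiction (subst (x <_) (0≡ _) lt) λ ()) (λ { (_ , () , _) })) step
    where
    Inv : ℕ → State → Set
    Inv k τ = ∀ t s x → x < nats τ reachᴬ (ix t (toℕ s)) ⇔ Reaches k t s x
    open Equivalence
    weaken : ∀ {k t s x} → Reaches k t s x → Reaches (suc k) t s x
    weaken (M , M<k , rest) = M , m<n⇒m<1+n M<k , rest
    inner body : Cmd
    inner = when reachᴬ [ blockCell ]ᴺ `<ᴺ blockEnd then reachᴬ [ blockCell ]:=ᴺ blockEnd else skip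
    body = when `lit 0 `<ᴺ sizeᴬ [ var tᴬ ]ᴺ then inner else skip
    step : ∀ (M : Fin m) τ → Frame computeReach σ τ → nats τ tᴬ 0 ≡ toℕ M →
           Inv (toℕ M) τ → Inv (suc (toℕ M)) (exec body τ)
    step M τ F t≡ inv =
      when<ᴺ (Inv (suc (toℕ M))) (`lit 0) (sizeᴬ [ var tᴬ ]ᴺ) inner skip τ
        (λ 0<size → when<ᴺ (Inv (suc (toℕ M))) (reachᴬ [ blockCell ]ᴺ) blockEnd (reachᴬ [ blockCell ]:=ᴺ blockEnd) skip τ
          (λ r<e → update (subst (0 <_) size≡ 0<size) r<e)
          (λ e≤r → covered (subst (0 <_) size≡ 0<size) e≤r))
        (λ size≤0 t s x → mk⇔ (weaken ∘ to (inv t s x))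
          (λ { (M′ , M′<sk , refl , st , 0<sz , x<) → from (inv t s x)
            (M′ , ≤∧≢⇒< (ℕ.s≤s⁻¹ M′<sk)
              (λ eq → <⇒≱ (subst (0 <_) (trans (cong meetingSize (toℕ-injective eq)) (sym size≡)) 0<sz) size≤0) ,
             refl , st , 0<sz , x<) }))
      where
      size≡ : nats τ sizeᴬ (nats τ tᴬ 0) ≡ meetingSize M
      size≡ = trans (cong (nats τ sizeᴬ) t≡) (trans (frameᴺ F sizeᴬ _) (sz≡ M))
      start≡ : nats τ startᴬ (nats τ tᴬ 0) ≡ meetingStart M
      start≡ = trans (cong (nats τ startᴬ) t≡) (trans (frameᴺ F startᴬ _) (st≡ M))
      end≡ : evalᴺ τ blockEnd ≡ meetingStart M + meetingSize M
      end≡ = cong₂ _+_ start≡ size≡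
      cell≡ : evalᴺ τ blockCell ≡ ix (tm M) (meetingStart M)
      cell≡ = cong₂ _+_
        (trans (cong (nats τ rowᴬ) (trans (cong (nats τ timeᴬ) t≡) (trans (frameᴺ F timeᴬ _) (tm≡ M))))
               (trans (frameᴺ F rowᴬ _) (row≡ (tm M))))
        start≡
      split : ∀ {t s x} → Reaches (suc (toℕ M)) t s x → Reaches (toℕ M) t s x ⊎
              (tm M ≡ t × meetingStart M ≡ toℕ s × x < meetingStart M + meetingSize M)
      split (M′ , M′<sk , t , st , sz , x<) with m≤n⇒m<n∨m≡n (ℕ.s≤s⁻¹ M′<sk)
      ... | inj₁ M′<k = inj₁ (M′ , M′<k , t , st , sz , x<)
      ... | inj₂ eq rewrite toℕ-injective eq = inj₂ (t , st , x<)
      covered : 0 < meetingSize M → evalᴺ τ blockEnd ≤ nats τ reachᴬ (evalᴺ τ blockCell) → Inv (suc (toℕ M)) τ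
      covered 0<size e≤r t s x = mk⇔ (weaken ∘ to (inv t s x)) λ r → [ from (inv t s x) , this ]′ (split r)
        where
        this : tm M ≡ t × meetingStart M ≡ toℕ s × x < meetingStart M + meetingSize M →
               x < nats τ reachᴬ (ix t (toℕ s))
        this (refl , st , x<) = <-≤-trans x< (subst₂ _≤_ end≡
          (cong (nats τ reachᴬ) (trans cell≡ (cong (ix (tm M)) st))) e≤r)
      update : 0 < meetingSize M → nats τ reachᴬ (evalᴺ τ blockCell) < evalᴺ τ blockEnd →
               Inv (suc (toℕ M)) (exec (reachᴬ [ blockCell ]:=ᴺ blockEnd) τ)
      update 0<size r<e t s x with ix t (toℕ s) ≟ evalᴺ τ blockCell
      ... | yes eq = mk⇔
        (λ lt → M , ≤-refl , proj₁ here≡ , trans (sym (toℕ-fromℕ< st<n)) (cong toℕ (proj₂ here≡)) , 0<size ,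
                subst (x <_) (trans (write-same (nats τ) reachᴬ _ eq) end≡) lt)
        (λ r → subst (x <_) (sym (write-same (nats τ) reachᴬ _ eq))
          ([ (λ r′ → <-trans (subst (λ c → x < nats τ reachᴬ c) eq (from (inv t s x) r′)) r<e)
           , (λ { (_ , _ , x<) → subst (x <_) (sym end≡) x< }) ]′ (split r)))
        where
        st<n : meetingStart M < n
        st<n = <-≤-trans (m<m+n _ 0<size) (blockEnd≤n M)
        here≡ : tm M ≡ t × fromℕ< st<n ≡ s
        here≡ = cell-injective (trans (cong (ix (tm M)) (toℕ-fromℕ< st<n)) (trans (sym cell≡) (sym eq)))
      ... | no ne = mk⇔
        (λ lt → weaken (to (inv t s x) (subst (x <_) (write-other (nats τ) reachᴬ _ ne) lt)))
        (λ r → subst (x <_) (sym (write-other (nats τ) reachᴬ _ ne))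
          ([ from (inv t s x)
           , (λ { (refl , st , _) → contradiction (trans (cong (ix (tm M)) (sym st)) (sym cell≡)) ne }) ]′ (split r)))

  -- For Δ̄ ≤ 0 a gap outside meetings only has to be positive.  Then Δ / n is small enough:
  -- fewer than n such gaps fit into Δ, and all rigid widths are multiples of Δ.
  effectiveGap : Carrier → Carrier → Carrier
  effectiveGap Δ Δ̄ = if does (0# <ᴿ? Δ̄) then Δ̄ else
                     if does (0# <ᴿ? Δ) then Δ ⊗ (n · 1#) ⁻¹ else 1#

  gap-spec : ∀ σ → nats σ 0 0 ≡ n → reals σ unitsᴬ 0 ≡ 0# →
             reals (exec computeGap σ) gapᴬ 0 ≡ effectiveGap (reals σ 0 0) (reals σ 0 1)
  gap-spec σ n≡ 0≡ = choose (exec (for iᴬ < 0 run body) σ)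
    (for-rule iᴬ 0 body σ (λ k τ → reals τ unitsᴬ 0 ≡ k · 1#) n≡ 0≡ λ i τ _ _ inv → cong (1# ⊕_) inv)
    (frameᴿ (frame (for iᴬ < 0 run body) σ) 0)
    where
    body = unitsᴬ [ `lit 0 ]:=ᴿ `1 `⊕ varᴿ unitsᴬ
    choice = when `0 `<ᴿ 0 [ `lit 1 ]ᴿ
      then gapᴬ [ `lit 0 ]:=ᴿ 0 [ `lit 1 ]ᴿ
      else when `0 `<ᴿ 0 [ `lit 0 ]ᴿ
           then gapᴬ [ `lit 0 ]:=ᴿ 0 [ `lit 0 ]ᴿ `⊘ varᴿ unitsᴬ
           else gapᴬ [ `lit 0 ]:=ᴿ `1
    choose : ∀ τ → reals τ unitsᴬ 0 ≡ n · 1# → (∀ j → reals τ 0 j ≡ reals σ 0 j) →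
             reals (exec choice τ) gapᴬ 0 ≡ effectiveGap (reals σ 0 0) (reals σ 0 1)
    choose τ units≡ Δ≡ rewrite sym (Δ≡ 0) | sym (Δ≡ 1) with does (0# <ᴿ? reals τ 0 1)
    ... | true  = refl
    ... | false with does (0# <ᴿ? reals τ 0 0)
    ...   | true  = cong (λ u → reals τ 0 0 ⊗ u ⁻¹) units≡
    ...   | false = refl

-- Correctness of packed positions and break numbers.

module Packing (ℝ : RealField) (I : OrderedStoryline) (σ : RealRAM.State ℝ) where
  open import Data.Nat using (_<_)
  open RealField ℝ renaming (_<_ to _<ᴿ_; _≤ᴿ_ to infix 4 _≤ᴿ_)
  open RealRAM ℝ
  open LoopPrograms ℝ
  open Memory ℝ
  open OrderedStoryline I
  open Storyline I
  open Preparation ℝ I using (ix)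

  far : Fin ℓ → ℕ → ℕ
  far t zero    = 0
  far t (suc k) = if does (far t k <? nats σ reachᴬ (ix t k)) then nats σ reachᴬ (ix t k) else far t k

  -- As `far t 0` is 0, pass 0 always adds a gap and a break, so the first character of π_t has
  -- packed position one gap and one break. This cancels in all comparisons, which are made within
  -- one time step.
  total : Fin ℓ → ℕ → Carrier
  total t zero    = 0#
  total t (suc k) = if does (k <? far t k) then total t k ⊕ reals σ 0 0 else total t k ⊕ reals σ gapᴬ 0

  broken : Fin ℓ → ℕ → ℕ
  broken t zero    = 0
  broken t (suc k) = if does (k <? far t k) then broken t k else suc (broken t k)

  Entry : State → (t : Fin ℓ) → Fin (length (π t)) → Set
  Entry τ t p = reals τ packedᴬ (ix t (toℕ (lookup (π t) p))) ≡ total t (suc (toℕ p)) ×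
                nats τ breaksᴬ (ix t (toℕ (lookup (π t) p))) ≡ broken t (suc (toℕ p))

  module _ (row≡ : ∀ (t : Fin ℓ) → nats σ rowᴬ (toℕ t) ≡ toℕ t * n)
           (n≡ : nats σ 0 0 ≡ n) (ℓ≡ : nats σ 0 1 ≡ ℓ)
           (count≡ : ∀ t → nats σ countᴬ (toℕ t) ≡ length (π t))
           (order≡ : ∀ t (p : Fin (length (π t))) →
                     nats σ orderᴬ (ix t (toℕ p)) ≡ toℕ (lookup (π t) p)) where

    Fixed : State → Set
    Fixed = Agree (0 ∷ countᴬ ∷ orderᴬ ∷ rowᴬ ∷ reachᴬ ∷ []) (0 ∷ gapᴬ ∷ []) σ

    Before : Fin ℓ → ℕ → (t : Fin ℓ) → Fin (length (π t)) → Set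
    Before t k t′ p = toℕ t′ < toℕ t ⊎ (t′ ≡ t × toℕ p < k)

    Inner : Fin ℓ → ℕ → State → Set
    Inner t k τ = reals τ sumᴬ 0 ≡ total t k × nats τ breakᴬ 0 ≡ broken t k ×
                  nats τ farᴬ 0 ≡ far t k × (∀ t′ p → Before t k t′ p → Entry τ t′ p)

    cell≡ : ∀ {t τ} → Fixed τ → nats τ tᴬ 0 ≡ toℕ t → ∀ j → nats τ rowᴬ (nats τ tᴬ 0) + j ≡ ix t j
    cell≡ {t} {τ} A t≡ j =
      cong (_+ j) (trans (cong (nats τ rowᴬ) t≡) (trans (onᴺ A rowᴬ _) (row≡ t)))

    advance-spec : ∀ {t τ} k → Fixed τ → nats τ iᴬ 0 ≡ k → reals τ sumᴬ 0 ≡ total t k →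
      nats τ breakᴬ 0 ≡ broken t k → nats τ farᴬ 0 ≡ far t k →
      reals (exec advance τ) sumᴬ 0 ≡ total t (suc k) × nats (exec advance τ) breakᴬ 0 ≡ broken t (suc k)
    advance-spec {t} k A i≡ sum≡ break≡ far≡
      rewrite i≡ | far≡ with does (k <? far t k)
    ... | true  = cong₂ _⊕_ sum≡ (onᴿ A 0 0) , break≡
    ... | false = cong₂ _⊕_ sum≡ (onᴿ A gapᴬ 0) , cong suc break≡

    extend-spec : ∀ {t τ} k → Fixed τ → nats τ tᴬ 0 ≡ toℕ t → nats τ iᴬ 0 ≡ k →
      nats τ farᴬ 0 ≡ far t k → nats (exec extendReach τ) farᴬ 0 ≡ far t (suc k)
    extend-spec {t} {τ} k A t≡ i≡ far≡
      rewrite cell≡ {t} {τ} A t≡ (nats τ iᴬ 0) | i≡ | onᴺ A reachᴬ (ix t k) | far≡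
      with does (far t k <? nats σ reachᴬ (ix t k))
    ... | true  = refl
    ... | false = far≡

    store-spec : ∀ {t τ} k → Fixed τ → nats τ tᴬ 0 ≡ toℕ t → nats τ iᴬ 0 ≡ k →
      reals τ sumᴬ 0 ≡ total t (suc k) → nats τ breakᴬ 0 ≡ broken t (suc k) →
      (∀ t′ p → Before t k t′ p → Entry τ t′ p) →
      ∀ t′ p → Before t (suc k) t′ p → Entry (exec store τ) t′ p
    store-spec {t} {τ} k A t≡ i≡ sum≡ break≡ old =
      when<ᴺ (λ υ → ∀ t′ p → Before t (suc k) t′ p → Entry υ t′ p)
        (var iᴬ) (countᴬ [ var tᴬ ]ᴺ)
        (packedᴬ [ charCell ]:=ᴿ varᴿ sumᴬ ⨟ breaksᴬ [ charCell ]:=ᴺ var breakᴬ) skip τ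
        (λ lt → write-both (fromℕ< (k<len lt)) (toℕ-fromℕ< (k<len lt)))
        (λ le → keep λ k<len → <⇒≱ (subst₂ _<_ (sym i≡) (sym len≡) k<len) le)
      where
      len≡ : nats τ countᴬ (nats τ tᴬ 0) ≡ length (π t)
      len≡ = trans (cong (nats τ countᴬ) t≡) (trans (onᴺ A countᴬ _) (count≡ t))
      k<len : nats τ iᴬ 0 < nats τ countᴬ (nats τ tᴬ 0) → k < length (π t)
      k<len = subst₂ _<_ i≡ len≡
      keep : ¬ (k < length (π t)) → ∀ t′ p → Before t (suc k) t′ p → Entry τ t′ p
      keep k≮ t′ p (inj₁ t′<t) = old t′ p (inj₁ t′<t)
      keep k≮ t′ p (inj₂ (refl , p<sk)) = old t′ p (inj₂ (refl ,
        ≤∧≢⇒< (ℕ.s≤s⁻¹ p<sk) λ { refl → k≮ (toℕ<n p) }))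
      write-both : ∀ (q : Fin (length (π t))) → toℕ q ≡ k → ∀ t′ p → Before t (suc k) t′ p →
        Entry (exec (packedᴬ [ charCell ]:=ᴿ varᴿ sumᴬ ⨟ breaksᴬ [ charCell ]:=ᴺ var breakᴬ) τ) t′ p
      write-both q q≡ t′ p b = go (ix t′ (toℕ (lookup (π t′) p)) ≟ evalᴺ τ charCell)
        where
        charCell≡ : evalᴺ τ charCell ≡ ix t (toℕ (lookup (π t) q))
        charCell≡ = trans (cell≡ {t} {τ} A t≡ _) (cong (ix t)
          (trans (cong (nats τ orderᴬ) (trans (cell≡ {t} {τ} A t≡ _) (cong (ix t) (trans i≡ (sym q≡)))))
                 (trans (onᴺ A orderᴬ _) (order≡ t q))))
        go : Dec (ix t′ (toℕ (lookup (π t′) p)) ≡ evalᴺ τ charCell) →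
          Entry (exec (packedᴬ [ charCell ]:=ᴿ varᴿ sumᴬ ⨟ breaksᴬ [ charCell ]:=ᴺ var breakᴬ) τ) t′ p
        -- Equal cells force equal positions, as π_t has no repetitions; so the write hits the entry
        -- of position k and no other.
        go (yes eq) with cell-injective {t = t′} {t} {lookup (π t′) p} {lookup (π t) q} (trans eq charCell≡)
        ... | refl , c≡ with lookup-injective (π-unique t) {p} {q} c≡
        ...   | refl =
          trans (write-same (reals τ) packedᴬ _ eq) (trans sum≡ (cong (total t ∘ suc) (sym q≡))) ,
          trans (write-same (nats τ) breaksᴬ _ eq) (trans break≡ (cong (broken t ∘ suc) (sym q≡)))
        go (no ne) = trans (write-other (reals τ) packedᴬ _ ne) (proj₁ e) ,
                     trans (write-other (nats τ) breaksᴬ _ ne) (proj₂ e)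
          where
          earlier : Before t (suc k) t′ p → Before t k t′ p
          earlier (inj₁ t′<t) = inj₁ t′<t
          earlier (inj₂ (refl , p<sk)) = inj₂ (refl , ≤∧≢⇒< (ℕ.s≤s⁻¹ p<sk) λ p≡k →
            ne (trans (cong (λ r → ix t (toℕ (lookup (π t) r))) (toℕ-injective (trans p≡k (sym q≡)))) (sym charCell≡)))
          e = old t′ p (earlier b)

    innerBody : Cmd
    innerBody = advance ⨟ extendReach ⨟ store

    inner-spec : ∀ t τ → Fixed τ → nats τ tᴬ 0 ≡ toℕ t → Inner t 0 τ →
                 Inner t n (exec (for iᴬ < 0 run innerBody) τ)
    inner-spec t τ A t≡ start = for-rule iᴬ 0 innerBody τ (Inner t) (trans (onᴺ A 0 0) n≡) start step
      where
      step : ∀ (i : Fin n) υ → Frame (for iᴬ < 0 run innerBody) τ υ → nats υ iᴬ 0 ≡ toℕ i →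
             Inner t (toℕ i) υ → Inner t (suc (toℕ i)) (exec innerBody υ)
      step i υ F i≡ (sum≡ , break≡ , far≡ , old) =
        trans (frameᴿ F₂₃ sumᴬ 0) (proj₁ adv) ,
        trans (frameᴺ F₂₃ breakᴬ 0) (proj₂ adv) ,
        trans (frameᴺ F₃ farᴬ 0) (extend-spec (toℕ i) A₁ t₁ i₁ (trans (frameᴺ F₁ farᴬ 0) far≡)) ,
        store-spec (toℕ i) (agree-frame F₂ A₁) (trans (frameᴺ F₂ tᴬ 0) t₁) (trans (frameᴺ F₂ iᴬ 0) i₁)
          (trans (frameᴿ F₂ sumᴬ 0) (proj₁ adv)) (trans (frameᴺ F₂ breakᴬ 0) (proj₂ adv))
          (λ t′ p b → let e₁ , e₂ = old t′ p b in
             trans (trans (frameᴿ F₂ packedᴬ _) (frameᴿ F₁ packedᴬ _)) e₁ ,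
             trans (trans (frameᴺ F₂ breaksᴬ _) (frameᴺ F₁ breaksᴬ _)) e₂)
        where
        A₀ : Fixed υ
        A₀ = agree-frame F A
        υ₁ = exec advance υ
        F₁ = frame advance υ
        F₂ = frame extendReach υ₁
        F₃ = frame store (exec extendReach υ₁)
        F₂₃ = frame (extendReach ⨟ store) υ₁
        adv = advance-spec {t} (toℕ i) A₀ i≡ sum≡ break≡ far≡
        A₁ : Fixed υ₁
        A₁ = agree-frame F₁ A₀
        t₁ : nats υ₁ tᴬ 0 ≡ toℕ t
        t₁ = trans (frameᴺ F₁ tᴬ 0) (trans (frameᴺ F tᴬ 0) t≡)
        i₁ : nats υ₁ iᴬ 0 ≡ toℕ i
        i₁ = trans (frameᴺ F₁ iᴬ 0) i≡

    packed-spec : ∀ t p → Entry (exec computePacked σ) t p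
    packed-spec t p = for-rule tᴬ 1 body σ (λ k τ → ∀ t p → toℕ t < k → Entry τ t p) ℓ≡
      (λ _ _ ()) step t p (toℕ<n t)
      where
      -- `⨟` associates to the right, so `prelude` is not a subterm of `body`; still `exec body τ`
      -- is definitionally the loop executed after `prelude`.
      prelude body : Cmd
      prelude = sumᴬ [ `lit 0 ]:=ᴿ `0 ⨟ breakᴬ [ `lit 0 ]:=ᴺ `lit 0 ⨟ farᴬ [ `lit 0 ]:=ᴺ `lit 0
      body = sumᴬ [ `lit 0 ]:=ᴿ `0 ⨟ breakᴬ [ `lit 0 ]:=ᴺ `lit 0 ⨟ farᴬ [ `lit 0 ]:=ᴺ `lit 0
             ⨟ for iᴬ < 0 run innerBody
      step : ∀ (i : Fin ℓ) τ → Frame computePacked σ τ → nats τ tᴬ 0 ≡ toℕ i →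
             (∀ t p → toℕ t < toℕ i → Entry τ t p) → ∀ t p → toℕ t < suc (toℕ i) → Entry (exec body τ) t p
      step i τ F t≡ old t p t<si = proj₂ (proj₂ (proj₂ done)) t p (before (m≤n⇒m<n∨m≡n (ℕ.s≤s⁻¹ t<si)))
        where
        done : Inner i n (exec body τ)
        done = inner-spec i (exec prelude τ) (agree-frame (frame prelude τ) (agree-frame F agree-refl)) t≡
          (refl , refl , refl , λ { t′ p (inj₁ t′<i) → old t′ p t′<i ; t′ p (inj₂ (_ , ())) })
        before : toℕ t < toℕ i ⊎ toℕ t ≡ toℕ i → Before i n t p
        before (inj₁ t<i) = inj₁ t<i
        before (inj₂ t≡i) = inj₂ (toℕ-injective t≡i , <-≤-trans (toℕ<n p) (length≤n t))

-- Edges and the dynamic program for longest paths.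

packedDiff : RExp
packedDiff = atᴿ packedᴬ (var tᴬ) (var tgtᴬ) `⊖ atᴿ packedᴬ (var tᴬ) (var srcᴬ)

flag checkTarget checkBreaks checkTight check checkEdge relax computeLongest : Cmd

flag = badᴬ [ `lit 0 ]:=ᴺ `lit 1

checkTight =
  when at breaksᴬ (var tᴬ) (var srcᴬ) `<ᴺ at breaksᴬ (var tᴬ) (var tgtᴬ)
  then skip
  else when packedDiff `<ᴿ varᴿ distᴬ then flag else skip

checkBreaks =
  when at breaksᴬ (var tᴬ) (var tgtᴬ) `<ᴺ at breaksᴬ (var tᴬ) (var srcᴬ)
  then flag else checkTight

checkTarget = when at activeᴬ (var tᴬ) (var tgtᴬ) `<ᴺ `lit 1 then flag else checkBreaks

check = when at activeᴬ (var tᴬ) (var srcᴬ) `<ᴺ `lit 1 then flag else checkTarget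

checkEdge =
  distᴬ [ `lit 0 ]:=ᴿ `0
  ⨟ badᴬ [ `lit 0 ]:=ᴺ `lit 0
  ⨟ (for tᴬ < 1 run
       -- The guard is always true; it gives the loop the shape of `maximise`.
       when `lit 0 `<ᴺ `lit 1
       then when varᴿ distᴬ `<ᴿ packedDiff then distᴬ [ `lit 0 ]:=ᴿ packedDiff else skip
       else skip)
  ⨟ for tᴬ < 1 run check

relax =
  when `lit 0 `<ᴺ var badᴬ
  then skip
  else when depthᴬ [ var tgtᴬ ]ᴺ `<ᴺ `lit 1 `+ depthᴬ [ var srcᴬ ]ᴺ
       then (heightᴬ [ var tgtᴬ ]:=ᴿ heightᴬ [ var srcᴬ ]ᴿ `⊕ varᴿ distᴬ
             ⨟ predᴬ [ var tgtᴬ ]:=ᴺ var srcᴬ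
             ⨟ depthᴬ [ var tgtᴬ ]:=ᴺ `lit 1 `+ depthᴬ [ var srcᴬ ]ᴺ)
       else skip

computeLongest =
  -- Targets form the outer loop, so the depths of all positions before j are final when j is
  -- treated. Loops can only run up to n; the test against the count cuts this down to the length of
  -- π₀.
  for jᴬ < 0 run for iᴬ < 0 run
    when var jᴬ `<ᴺ countᴬ [ `lit 0 ]ᴺ
    then when var iᴬ `<ᴺ var jᴬ
         then (srcᴬ [ `lit 0 ]:=ᴺ orderᴬ [ var iᴬ ]ᴺ
               ⨟ tgtᴬ [ `lit 0 ]:=ᴺ orderᴬ [ var jᴬ ]ᴺ
               ⨟ checkEdge ⨟ relax)
         else skip
    else skip

module Chains (ℝ : RealField) (I : OrderedStoryline) (σ : RealRAM.State ℝ) where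
  open import Data.Nat using (_<_)
  open RealField ℝ renaming (_<_ to _<ᴿ_; _≤ᴿ_ to infix 4 _≤ᴿ_)
  open RealRAM ℝ
  open LoopPrograms ℝ
  open RealProperties ℝ
  open Memory ℝ
  open OrderedStoryline I

  packed : ℕ → Fin n → Carrier
  packed t c = reals σ packedᴬ (t * n + toℕ c)

  breaks : Fin ℓ → Fin n → ℕ
  breaks t c = nats σ breaksᴬ (toℕ t * n + toℕ c)

  dist : Fin n → Fin n → Carrier
  dist c c′ = sup 0# (λ _ → true) (λ t → packed t c′ ⊖ packed t c) ℓ

  record EdgeAt (c c′ : Fin n) (t : Fin ℓ) : Set where
    constructor edgeAt
    field
      source : t ∈ˢ A c
      target : t ∈ˢ A c′
      ordered : breaks t c ≤ breaks t c′
      -- The converse inequality holds at every t, as `dist` is a maximum over time steps; so this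
      -- amounts to equality.
      tight   : breaks t c ≡ breaks t c′ → dist c c′ ≤ᴿ packed (toℕ t) c′ ⊖ packed (toℕ t) c

  Edge : Fin n → Fin n → Set
  Edge c c′ = ∀ t → EdgeAt c c′ t

  module _ (row≡ : ∀ (t : Fin ℓ) → nats σ rowᴬ (toℕ t) ≡ toℕ t * n)
           (n≡ : nats σ 0 0 ≡ n) (ℓ≡ : nats σ 0 1 ≡ ℓ)
           (active≡ : ∀ t c → nats σ activeᴬ (toℕ t * n + toℕ c) ≡ (if does (t ∈? A c) then 1 else 0)) where

    Fixed : State → Set
    Fixed = Agree (0 ∷ activeᴬ ∷ countᴬ ∷ orderᴬ ∷ rowᴬ ∷ breaksᴬ ∷ []) (packedᴬ ∷ []) σ

    cell≡ : ∀ {t : Fin ℓ} {c : Fin n} v {τ} → Fixed τ → nats τ tᴬ 0 ≡ toℕ t → nats τ v 0 ≡ toℕ c →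
            evalᴺ τ (cell (var tᴬ) (var v)) ≡ toℕ t * n + toℕ c
    cell≡ {t} v {τ} A t≡ c≡ =
      cong₂ _+_ (trans (cong (nats τ rowᴬ) t≡) (trans (onᴺ A rowᴬ _) (row≡ t))) c≡

    packed≡ : ∀ {t : Fin ℓ} {c : Fin n} v {τ} → Fixed τ → nats τ tᴬ 0 ≡ toℕ t → nats τ v 0 ≡ toℕ c →
              evalᴿ τ (atᴿ packedᴬ (var tᴬ) (var v)) ≡ packed (toℕ t) c
    packed≡ {t} {c} v {τ} A t≡ c≡ =
      trans (cong (reals τ packedᴬ) (cell≡ {t} {c} v {τ} A t≡ c≡)) (onᴿ A packedᴬ _)

    breaks≡ : ∀ {t : Fin ℓ} {c : Fin n} v {τ} → Fixed τ → nats τ tᴬ 0 ≡ toℕ t → nats τ v 0 ≡ toℕ c →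
              evalᴺ τ (at breaksᴬ (var tᴬ) (var v)) ≡ breaks t c
    breaks≡ {t} {c} v {τ} A t≡ c≡ =
      trans (cong (nats τ breaksᴬ) (cell≡ {t} {c} v {τ} A t≡ c≡)) (onᴺ A breaksᴬ _)

    activity≡ : ∀ {t : Fin ℓ} {c : Fin n} v {τ} → Fixed τ → nats τ tᴬ 0 ≡ toℕ t → nats τ v 0 ≡ toℕ c →
                evalᴺ τ (at activeᴬ (var tᴬ) (var v)) ≡ (if does (t ∈? A c) then 1 else 0)
    activity≡ {t} {c} v {τ} A t≡ c≡ =
      trans (cong (nats τ activeᴬ) (cell≡ {t} {c} v {τ} A t≡ c≡)) (trans (onᴺ A activeᴬ _) (active≡ t c))

    inactive : ∀ {t c x} → x ≡ (if does (t ∈? A c) then 1 else 0) → x < 1 → ¬ (t ∈ˢ A c)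
    inactive {t} {c} eq x<1 with t ∈? A c
    inactive refl (s≤s ()) | yes _
    ... | no t∉A = t∉A

    isActive : ∀ {t c x} → x ≡ (if does (t ∈? A c) then 1 else 0) → 1 ≤ x → t ∈ˢ A c
    isActive {t} {c} eq 1≤x with t ∈? A c
    ... | yes t∈A = t∈A
    isActive refl () | no _

    -- On success the flag is kept rather than cleared, because it accumulates failures over all
    -- time steps.
    check-spec : ∀ {c c′ : Fin n} {t : Fin ℓ} τ → Fixed τ →
      nats τ srcᴬ 0 ≡ toℕ c → nats τ tgtᴬ 0 ≡ toℕ c′ → nats τ tᴬ 0 ≡ toℕ t → reals τ distᴬ 0 ≡ dist c c′ →
      (EdgeAt c c′ t × nats (exec check τ) badᴬ 0 ≡ nats τ badᴬ 0) ⊎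
      (¬ EdgeAt c c′ t × nats (exec check τ) badᴬ 0 ≡ 1)
    check-spec {c} {c′} {t} τ A src≡ tgt≡ t≡ dist≡ =
      when<ᴺ Q (at activeᴬ (var tᴬ) (var srcᴬ)) (`lit 1) flag checkTarget τ
        (λ lt → inj₂ ((λ e → inactive srcActive lt (EdgeAt.source e)) , refl)) λ src≥ →
      when<ᴺ Q (at activeᴬ (var tᴬ) (var tgtᴬ)) (`lit 1) flag checkBreaks τ
        (λ lt → inj₂ ((λ e → inactive tgtActive lt (EdgeAt.target e)) , refl)) λ tgt≥ →
      when<ᴺ Q (at breaksᴬ (var tᴬ) (var tgtᴬ)) (at breaksᴬ (var tᴬ) (var srcᴬ)) flag checkTight τ
        (λ lt → inj₂ ((λ e → <⇒≱ (subst₂ _<_ tgtBreaks srcBreaks lt) (EdgeAt.ordered e)) , refl)) λ b≤ →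
      when<ᴺ Q (at breaksᴬ (var tᴬ) (var srcᴬ)) (at breaksᴬ (var tᴬ) (var tgtᴬ)) skip
        (when packedDiff `<ᴿ varᴿ distᴬ then flag else skip) τ
        (λ lt → inj₁ (edgeAt (isActive srcActive src≥) (isActive tgtActive tgt≥)
                             (subst₂ _≤_ srcBreaks tgtBreaks b≤)
                             (λ eq → contradiction eq (<⇒≢ (subst₂ _<_ srcBreaks tgtBreaks lt))) , refl)) λ b≥ →
      when<ᴿ Q packedDiff (varᴿ distᴬ) flag skip τ
        (λ lt → inj₂ ((λ e → EdgeAt.tight e
            (≤-antisym (subst₂ _≤_ srcBreaks tgtBreaks b≤) (subst₂ _≤_ tgtBreaks srcBreaks b≥))
            (subst₂ _<ᴿ_ diff dist≡ lt)) , refl))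
        (λ ge → inj₁ (edgeAt (isActive srcActive src≥) (isActive tgtActive tgt≥)
                             (subst₂ _≤_ srcBreaks tgtBreaks b≤)
                             (λ _ → subst₂ _≤ᴿ_ dist≡ diff ge) , refl))
      where
      Q : State → Set
      Q υ = (EdgeAt c c′ t × nats υ badᴬ 0 ≡ nats τ badᴬ 0) ⊎ (¬ EdgeAt c c′ t × nats υ badᴬ 0 ≡ 1)
      srcActive = activity≡ {t} {c} srcᴬ {τ} A t≡ src≡
      tgtActive = activity≡ {t} {c′} tgtᴬ {τ} A t≡ tgt≡
      srcBreaks = breaks≡ {t} {c} srcᴬ {τ} A t≡ src≡
      tgtBreaks = breaks≡ {t} {c′} tgtᴬ {τ} A t≡ tgt≡
      diff : evalᴿ τ packedDiff ≡ packed (toℕ t) c′ ⊖ packed (toℕ t) c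
      diff = cong₂ _⊖_ (packed≡ {t} {c′} tgtᴬ {τ} A t≡ tgt≡) (packed≡ {t} {c} srcᴬ {τ} A t≡ src≡)

    checkEdge-spec : ∀ {c c′ : Fin n} τ → Fixed τ → nats τ srcᴬ 0 ≡ toℕ c → nats τ tgtᴬ 0 ≡ toℕ c′ →
      reals (exec checkEdge τ) distᴬ 0 ≡ dist c c′ ×
      (nats (exec checkEdge τ) badᴬ 0 ≡ 0 ⇔ Edge c c′)
    checkEdge-spec {c} {c′} τ A src≡ tgt≡ =
      trans (frameᴿ (frame (for tᴬ < 1 run check) τ₂) distᴬ 0) dist≡ ,
      mk⇔ (λ b t → Equivalence.to (flags) b t (toℕ<n t)) (λ e → Equivalence.from flags λ t _ → e t)
      where
      τ₁ = exec (distᴬ [ `lit 0 ]:=ᴿ `0 ⨟ badᴬ [ `lit 0 ]:=ᴺ `lit 0) τ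
      measure = maximise distᴬ tᴬ 1 (`lit 0 `<ᴺ `lit 1) packedDiff
      τ₂ = exec measure τ₁
      A₁ : Fixed τ₁
      A₁ = agree-frame (frame (distᴬ [ `lit 0 ]:=ᴿ `0 ⨟ badᴬ [ `lit 0 ]:=ᴺ `lit 0) τ) A
      F₂ = frame measure τ₁
      A₂ : Fixed τ₂
      A₂ = agree-frame F₂ A₁
      dist≡ : reals τ₂ distᴬ 0 ≡ dist c c′
      dist≡ = maximise-spec distᴬ tᴬ 1 (`lit 0 `<ᴺ `lit 1) packedDiff τ₁
        (trans (onᴺ A₁ 0 1) ℓ≡) refl λ i υ F t≡ →
        refl , cong₂ _⊖_
          (packed≡ {i} {c′} tgtᴬ {υ} (agree-frame F A₁) t≡ (trans (frameᴺ F tgtᴬ 0) tgt≡))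
          (packed≡ {i} {c} srcᴬ {υ} (agree-frame F A₁) t≡ (trans (frameᴺ F srcᴬ 0) src≡))
      Inv : ℕ → State → Set
      Inv k υ = nats υ badᴬ 0 ≡ 0 ⇔ (∀ t → toℕ t < k → EdgeAt c c′ t)
      open Equivalence
      step : ∀ (i : Fin ℓ) υ → Frame (for tᴬ < 1 run check) τ₂ υ → nats υ tᴬ 0 ≡ toℕ i →
             Inv (toℕ i) υ → Inv (suc (toℕ i)) (exec check υ)
      step i υ F t≡ inv with check-spec {c} {c′} {i} υ (agree-frame F A₂)
        (trans (frameᴺ F srcᴬ 0) (trans (frameᴺ F₂ srcᴬ 0) src≡))
        (trans (frameᴺ F tgtᴬ 0) (trans (frameᴺ F₂ tgtᴬ 0) tgt≡))
        t≡ (trans (frameᴿ F distᴬ 0) dist≡)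
      ... | inj₁ (e , same) = mk⇔
        (λ b t t<si → [ to inv (trans (sym same) b) t , (λ t≡i → subst (EdgeAt c c′) (sym (toℕ-injective t≡i)) e) ]′
                        (m≤n⇒m<n∨m≡n (ℕ.s≤s⁻¹ t<si)))
        (λ all → trans same (from inv λ t t<i → all t (m<n⇒m<1+n t<i)))
      ... | inj₂ (¬e , set) = mk⇔
        (λ b → contradiction (trans (sym set) b) λ ())
        (λ all → contradiction (all i ≤-refl) ¬e)
      flags : Inv ℓ (exec (for tᴬ < 1 run check) τ₂)
      flags = for-rule tᴬ 1 check τ₂ Inv (trans (onᴺ A₂ 0 1) ℓ≡)
        (mk⇔ (λ _ _ ()) (λ _ → trans (frameᴺ F₂ badᴬ 0) refl)) step

    module Longest (xs : List (Fin n)) (xs-unique : Unique xs)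
                   (count≡ : nats σ countᴬ 0 ≡ length xs)
                   (order≡ : ∀ p → nats σ orderᴬ (toℕ p) ≡ toℕ (lookup xs p)) where

      depth : State → Fin n → ℕ
      depth τ c = nats τ depthᴬ (toℕ c)

      height : State → Fin n → Carrier
      height τ c = reals τ heightᴬ (toℕ c)

      Pos : Set
      Pos = Fin (length xs)

      ch : Pos → Fin n
      ch = lookup xs

      record LinkTo (τ : State) (q p : Pos) : Set where
        constructor linkTo
        field
          p<q     : toℕ p < toℕ q
          pred≡   : nats τ predᴬ (toℕ (ch q)) ≡ toℕ (ch p)
          edge    : Edge (ch p) (ch q)
          depth≡  : depth τ (ch q) ≡ suc (depth τ (ch p))
          height≡ : height τ (ch q) ≡ height τ (ch p) ⊕ dist (ch p) (ch q)

      -- The half of the certificate that bounds other coordinations: pairwise adjacent characters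
      -- have distinct depths. The relation R restricts it to the pairs treated so far.
      Increasing : (Pos → Pos → Set) → State → Set
      Increasing R τ = ∀ p q → toℕ p < toℕ q → R p q → Edge (ch p) (ch q) → depth τ (ch p) < depth τ (ch q)

      -- The half that exhibits a path. A linked position is at most j and its predecessor lies
      -- strictly before it, so overwriting the entries of the target j disturbs no other link.
      Linked : ℕ → State → Set
      Linked j τ = ∀ q → depth τ (ch q) ≡ 0 ⊎ (toℕ q ≤ j × ∃ (LinkTo τ q))

      Done : ℕ → ℕ → Pos → Pos → Set
      Done j i p q = toℕ q < j ⊎ (toℕ q ≡ j × toℕ p < i)

      Inv : ℕ → ℕ → State → Set
      Inv j i τ = Increasing (Done j i) τ × Linked j τ

      inv-frame : ∀ {j i p τ υ} → Frame p τ υ → {_ : T (keeps (writesᴺ p) (depthᴬ ∷ predᴬ ∷ []))}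
                  {_ : T (keeps (writesᴿ p) (heightᴬ ∷ []))} → Inv j i τ → Inv j i υ
      inv-frame {j} {i} {P} {τ} {υ} F {kᴺ} {kᴿ} (inc , lnk) =
        (λ p q p<q d e → subst₂ _<_ (sym (d≡ (ch p))) (sym (d≡ (ch q))) (inc p q p<q d e)) , lnk′
        where
        B : Agree (depthᴬ ∷ predᴬ ∷ []) (heightᴬ ∷ []) τ υ
        B = agree-frame {p = P} F {kᴺ} {kᴿ} agree-refl
        d≡ : ∀ c → depth υ c ≡ depth τ c
        d≡ c = onᴺ B depthᴬ (toℕ c)
        h≡ : ∀ c → height υ c ≡ height τ c
        h≡ c = onᴿ B heightᴬ (toℕ c)
        lnk′ : Linked j υ
        lnk′ q with lnk q
        ... | inj₁ z = inj₁ (trans (d≡ _) z)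
        ... | inj₂ (q≤j , p , linkTo p<q pr e dp ht) = inj₂ (q≤j , p , linkTo p<q (trans (onᴺ B predᴬ _) pr) e
                (trans (d≡ _) (trans dp (cong suc (sym (d≡ _)))))
                (trans (h≡ _) (trans ht (cong (_⊕ dist (ch p) (ch q)) (sym (h≡ _))))))

      extend : ∀ q₀ p₀ τ {i} → toℕ p₀ ≡ i → Increasing (Done (toℕ q₀) i) τ →
               (Edge (ch p₀) (ch q₀) → depth τ (ch p₀) < depth τ (ch q₀)) →
               Increasing (Done (toℕ q₀) (suc i)) τ
      extend q₀ p₀ τ p₀≡ inc new p q p<q (inj₁ q<j) e = inc p q p<q (inj₁ q<j) e
      extend q₀ p₀ τ p₀≡ inc new p q p<q (inj₂ (q≡j , p<si)) e with m≤n⇒m<n∨m≡n (ℕ.s≤s⁻¹ p<si)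
      ... | inj₁ p<i = inc p q p<q (inj₂ (q≡j , p<i)) e
      ... | inj₂ p≡i with toℕ-injective {i = p} {p₀} (trans p≡i (sym p₀≡)) | toℕ-injective {i = q} {q₀} q≡j
      ...   | refl | refl = new e

      relink : Cmd
      relink = heightᴬ [ var tgtᴬ ]:=ᴿ heightᴬ [ var srcᴬ ]ᴿ `⊕ varᴿ distᴬ
               ⨟ predᴬ [ var tgtᴬ ]:=ᴺ var srcᴬ
               ⨟ depthᴬ [ var tgtᴬ ]:=ᴺ `lit 1 `+ depthᴬ [ var srcᴬ ]ᴺ

      relax-spec : ∀ p q τ → toℕ p < toℕ q →
        nats τ srcᴬ 0 ≡ toℕ (ch p) → nats τ tgtᴬ 0 ≡ toℕ (ch q) →
        reals τ distᴬ 0 ≡ dist (ch p) (ch q) → (nats τ badᴬ 0 ≡ 0 ⇔ Edge (ch p) (ch q)) →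
        Inv (toℕ q) (toℕ p) τ → Inv (toℕ q) (suc (toℕ p)) (exec relax τ)
      relax-spec p q τ p<q src≡ tgt≡ dist≡ bad⇔ (inc , lnk) =
        when<ᴺ (Inv (toℕ q) (suc (toℕ p))) (`lit 0) (var badᴬ) skip
          (when depthᴬ [ var tgtᴬ ]ᴺ `<ᴺ `lit 1 `+ depthᴬ [ var srcᴬ ]ᴺ then relink else skip) τ
          (λ 0<bad → extend q p τ refl inc (λ e → contradiction (Equivalence.from bad⇔ e) (m<n⇒n≢0 0<bad)) , lnk) λ bad≤0 →
        when<ᴺ (Inv (toℕ q) (suc (toℕ p))) (depthᴬ [ var tgtᴬ ]ᴺ) (`lit 1 `+ depthᴬ [ var srcᴬ ]ᴺ) relink skip τ
          (λ lt → deepen (Equivalence.to bad⇔ (n≤0⇒n≡0 bad≤0))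
                    (subst₂ _<_ (cong (nats τ depthᴬ) tgt≡) (cong (suc ∘ nats τ depthᴬ) src≡) lt))
          (λ ge → extend q p τ refl inc (λ _ → subst₂ _≤_ (cong (suc ∘ nats τ depthᴬ) src≡) (cong (nats τ depthᴬ) tgt≡) ge) , lnk)
        where
        υ = exec relink τ
        other : ∀ r → toℕ r ≢ toℕ q → toℕ (ch r) ≢ nats τ tgtᴬ 0
        other r r≢q eq = r≢q (cong toℕ (lookup-injective xs-unique {r} {q} (toℕ-injective (trans eq tgt≡))))
        depth-new : depth υ (ch q) ≡ suc (depth τ (ch p))
        depth-new = trans (write-same (nats τ) depthᴬ _ (sym tgt≡)) (cong (suc ∘ nats τ depthᴬ) src≡)
        depth-old : ∀ r → toℕ r ≢ toℕ q → depth υ (ch r) ≡ depth τ (ch r)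
        depth-old r r≢q = write-other (nats τ) depthᴬ _ (other r r≢q)
        height-old : ∀ r → toℕ r ≢ toℕ q → height υ (ch r) ≡ height τ (ch r)
        height-old r r≢q = write-other (reals τ) heightᴬ _ (other r r≢q)
        deepen : Edge (ch p) (ch q) → depth τ (ch q) < suc (depth τ (ch p)) → Inv (toℕ q) (suc (toℕ p)) υ
        deepen e lt = extend q p υ refl inc′
            (λ _ → subst₂ _<_ (sym (depth-old p (<⇒≢ p<q))) (sym depth-new) ≤-refl) , lnk′
          where
          grows : ∀ r → depth τ (ch r) ≤ depth υ (ch r)
          grows r with toℕ r ≟ toℕ q
          ... | yes r≡q rewrite toℕ-injective {i = r} {q} r≡q = ≤-trans (<⇒≤ lt) (≤-reflexive (sym depth-new))
          ... | no  r≢q = ≤-reflexive (sym (depth-old r r≢q))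
          -- Raising the depth of q cannot spoil a treated pair: a < b ≤ q keeps a away from q, and
          -- the depth of b can only grow.
          inc′ : Increasing (Done (toℕ q) (toℕ p)) υ
          inc′ a b a<b d e′ = <-≤-trans
            (subst (_< depth τ (ch b)) (sym (depth-old a (<⇒≢ (<-≤-trans a<b (b≤q d))))) (inc a b a<b d e′)) (grows b)
            where
            b≤q : Done (toℕ q) (toℕ p) a b → toℕ b ≤ toℕ q
            b≤q (inj₁ b<q) = <⇒≤ b<q
            b≤q (inj₂ (b≡q , _)) = ≤-reflexive b≡q
          lnk′ : Linked (toℕ q) υ
          lnk′ r with toℕ r ≟ toℕ q
          ... | yes r≡q rewrite toℕ-injective {i = r} {q} r≡q = inj₂ (≤-refl , p , linkTo p<q
                  (trans (write-same (nats τ) predᴬ _ (sym tgt≡)) src≡) e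
                  (trans depth-new (cong suc (sym (depth-old p (<⇒≢ p<q)))))
                  (trans (write-same (reals τ) heightᴬ _ (sym tgt≡))
                    (cong₂ _⊕_ (trans (cong (reals τ heightᴬ) src≡) (sym (height-old p (<⇒≢ p<q)))) dist≡)))
          ... | no r≢q with lnk r
          ...   | inj₁ z = inj₁ (trans (depth-old r r≢q) z)
          ...   | inj₂ (r≤q , s , linkTo s<r pr e′ dp ht) = inj₂ (r≤q , s , linkTo s<r
                    (trans (write-other (nats τ) predᴬ _ (other r r≢q)) pr) e′
                    (trans (depth-old r r≢q) (trans dp (cong suc (sym (depth-old s s≢q)))))
                    (trans (height-old r r≢q) (trans ht (cong (_⊕ dist (ch s) (ch r)) (sym (height-old s s≢q))))))
            where
            s≢q : toℕ s ≢ toℕ q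
            s≢q = <⇒≢ (<-≤-trans s<r r≤q)

      load pairBody inner : Cmd
      load = srcᴬ [ `lit 0 ]:=ᴺ orderᴬ [ var iᴬ ]ᴺ ⨟ tgtᴬ [ `lit 0 ]:=ᴺ orderᴬ [ var jᴬ ]ᴺ
      pairBody = srcᴬ [ `lit 0 ]:=ᴺ orderᴬ [ var iᴬ ]ᴺ
                 ⨟ tgtᴬ [ `lit 0 ]:=ᴺ orderᴬ [ var jᴬ ]ᴺ
                 ⨟ checkEdge ⨟ relax
      inner = when var jᴬ `<ᴺ countᴬ [ `lit 0 ]ᴺ
              then when var iᴬ `<ᴺ var jᴬ then pairBody else skip
              else skip

      pair-spec : ∀ p q τ → toℕ p < toℕ q → Fixed τ → nats τ iᴬ 0 ≡ toℕ p → nats τ jᴬ 0 ≡ toℕ q →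
                  Inv (toℕ q) (toℕ p) τ → Inv (toℕ q) (suc (toℕ p)) (exec pairBody τ)
      pair-spec p q τ p<q A i≡ j≡ inv = relax-spec p q τ₂ p<q
          (trans (frameᴺ F₂ srcᴬ 0) src≡) (trans (frameᴺ F₂ tgtᴬ 0) tgt≡) (proj₁ checked) (proj₂ checked)
          (inv-frame F₂ (inv-frame (frame load τ) inv))
        where
        τ₁ = exec load τ
        τ₂ = exec checkEdge τ₁
        F₂ = frame checkEdge τ₁
        src≡ : nats τ₁ srcᴬ 0 ≡ toℕ (ch p)
        src≡ = trans (cong (nats τ orderᴬ) i≡) (trans (onᴺ A orderᴬ _) (order≡ p))
        tgt≡ : nats τ₁ tgtᴬ 0 ≡ toℕ (ch q)
        tgt≡ = trans (cong (nats τ orderᴬ) j≡) (trans (onᴺ A orderᴬ _) (order≡ q))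
        checked = checkEdge-spec {ch p} {ch q} τ₁ (agree-frame (frame load τ) A) src≡ tgt≡

      inner-spec : ∀ i j τ → Fixed τ → nats τ iᴬ 0 ≡ i → nats τ jᴬ 0 ≡ j →
                   Inv j i τ → Inv j (suc i) (exec inner τ)
      inner-spec i j τ A i≡ j≡ inv =
        when<ᴺ (Inv j (suc i)) (var jᴬ) (countᴬ [ `lit 0 ]ᴺ) (when var iᴬ `<ᴺ var jᴬ then pairBody else skip) skip τ
          (λ j<len → when<ᴺ (Inv j (suc i)) (var iᴬ) (var jᴬ) pairBody skip τ
            (λ i<j → go (subst₂ _<_ j≡ len≡ j<len) (subst₂ _<_ i≡ j≡ i<j))
            (λ j≤i → unchanged λ q≡j p<q → <-≤-trans p<q (subst₂ _≤_ (trans j≡ (sym q≡j)) i≡ j≤i)))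
          (λ len≤j → unchanged λ {p} {q} q≡j _ → contradiction (subst (_< _) q≡j (toℕ<n q)) (≤⇒≯ (subst₂ _≤_ len≡ j≡ len≤j)))
        where
        len≡ : nats τ countᴬ 0 ≡ length xs
        len≡ = trans (onᴺ A countᴬ 0) count≡
        unchanged : (∀ {p q : Pos} → toℕ q ≡ j → toℕ p < toℕ q → toℕ p < i) → Inv j (suc i) τ
        unchanged p<i = (λ p q p<q → λ { (inj₁ q<j) → proj₁ inv p q p<q (inj₁ q<j)
                                       ; (inj₂ (q≡j , _)) → proj₁ inv p q p<q (inj₂ (q≡j , p<i {p} {q} q≡j p<q)) })
                        , proj₂ inv
        go : j < length xs → i < j → Inv j (suc i) (exec pairBody τ)
        go j<len i<j = subst₂ (λ j i → Inv j (suc i) (exec pairBody τ)) q≡ p≡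
          (pair-spec (fromℕ< i<len) (fromℕ< j<len) τ (subst₂ _<_ (sym p≡) (sym q≡) i<j) A
            (trans i≡ (sym p≡)) (trans j≡ (sym q≡)) (subst₂ (λ j i → Inv j i τ) (sym q≡) (sym p≡) inv))
          where
          i<len = <-trans i<j j<len
          p≡ = toℕ-fromℕ< i<len
          q≡ = toℕ-fromℕ< j<len

      longest-spec : (∀ j → nats σ depthᴬ j ≡ 0) → Inv n 0 (exec computeLongest σ)
      longest-spec 0≡ = for-rule jᴬ 0 row σ (λ j → Inv j 0) n≡
        ((λ p q _ → λ { (inj₁ ()) _ ; (inj₂ (_ , ())) _ }) , (λ q → inj₁ (0≡ _))) step
        where
        row : Cmd
        row = for iᴬ < 0 run inner
        step : ∀ (j : Fin n) τ → Frame computeLongest σ τ → nats τ jᴬ 0 ≡ toℕ j →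
               Inv (toℕ j) 0 τ → Inv (suc (toℕ j)) 0 (bump jᴬ (exec row τ))
        -- `bump` and `reset` coincide with the execution of such assignments, so frames cover the
        -- bookkeeping of the loops as well.
        step j τ F j≡ inv = inv-frame (frame (jᴬ [ `lit 0 ]:=ᴺ var jᴬ `+ `lit 1) (exec row τ))
          (next (for-rule iᴬ 0 inner τ (Inv (toℕ j)) (trans (frameᴺ F 0 0) n≡)
            (inv-frame (frame (iᴬ [ `lit 0 ]:=ᴺ `lit 0) τ) inv)
            λ i υ G i≡ inv′ → inv-frame (frame (iᴬ [ `lit 0 ]:=ᴺ var iᴬ `+ `lit 1) (exec inner υ))
              (inner-spec (toℕ i) (toℕ j) υ (agree-frame G (agree-frame F agree-refl)) i≡ (trans (frameᴺ G jᴬ 0) j≡) inv′)))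
          where
          next : Inv (toℕ j) n (exec row τ) → Inv (suc (toℕ j)) 0 (exec row τ)
          next (inc , lnk) =
            (λ p q p<q → λ { (inj₁ q<sj) → inc p q p<q ([ inj₁ , (λ q≡j → inj₂ (q≡j , <-≤-trans (toℕ<n p) (unique⇒length≤ xs-unique))) ]′
                                                     (m≤n⇒m<n∨m≡n (ℕ.s≤s⁻¹ q<sj)))
                           ; (inj₂ (_ , ())) }) ,
            (λ q → [ inj₁ , (λ { (q≤j , l) → inj₂ (m≤n⇒m≤1+n q≤j , l) }) ]′ (lnk q))

-- Selecting the end of a longest path; programs for tracing and placement.

selectBest traceChain placeAll : Cmd

selectBest =
  for iᴬ < 0 run (
    -- A character is adjacent to itself exactly if it is always active, so `checkEdge` doubles as
    -- the activity test.
    srcᴬ [ `lit 0 ]:=ᴺ var iᴬ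
    ⨟ tgtᴬ [ `lit 0 ]:=ᴺ var iᴬ
    ⨟ checkEdge
    ⨟ when `lit 0 `<ᴺ var badᴬ
      then skip
      else when var restᴬ `<ᴺ `lit 1 `+ depthᴬ [ var iᴬ ]ᴺ
           then (restᴬ [ `lit 0 ]:=ᴺ `lit 1 `+ depthᴬ [ var iᴬ ]ᴺ ⨟ bestᴬ [ `lit 0 ]:=ᴺ var iᴬ)
           else skip)

traceChain =
  for iᴬ < 0 run
    when `lit 0 `<ᴺ var restᴬ
    then (markᴬ [ var bestᴬ ]:=ᴺ `lit 1
          ⨟ restᴬ [ `lit 0 ]:=ᴺ var restᴬ `∸ `lit 1
          ⨟ bestᴬ [ `lit 0 ]:=ᴺ predᴬ [ var bestᴬ ]ᴺ)
    else skip

-- Marks are 0 or 1, so this says that c is marked and does not have more breaks than d.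
before : Test
before = at breaksᴬ (var tᴬ) (var iᴬ) `∸ at breaksᴬ (var tᴬ) (var jᴬ) `<ᴺ markᴬ [ var iᴬ ]ᴺ

slack drop : RExp
slack = heightᴬ [ var iᴬ ]ᴿ `⊖ atᴿ packedᴬ (var tᴬ) (var iᴬ)
drop  = atᴿ packedᴬ (var tᴬ) (var iᴬ) `⊖ heightᴬ [ var iᴬ ]ᴿ

placeAll =
  for tᴬ < 1 run (
    lowᴬ [ `lit 0 ]:=ᴿ `0
    ⨟ (for iᴬ < 0 run
         when `lit 0 `<ᴺ markᴬ [ var iᴬ ]ᴺ
         then when varᴿ lowᴬ `<ᴿ drop then lowᴬ [ `lit 0 ]:=ᴿ drop else skip
         else skip)
    ⨟ for jᴬ < 0 run (
        shiftᴬ [ `lit 0 ]:=ᴿ `0 `⊖ varᴿ lowᴬ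
        ⨟ (for iᴬ < 0 run
             when before
             then when varᴿ shiftᴬ `<ᴿ slack then shiftᴬ [ `lit 0 ]:=ᴿ slack else skip
             else skip)
        ⨟ outᴬ [ cell (var tᴬ) (var jᴬ) ]:=ᴿ atᴿ packedᴬ (var tᴬ) (var jᴬ) `⊕ varᴿ shiftᴬ))

module Selection (ℝ : RealField) (I : OrderedStoryline) (σ : RealRAM.State ℝ) where
  open import Data.Nat using (_<_)
  open RealField ℝ using (Carrier)
  open RealRAM ℝ
  open LoopPrograms ℝ
  open Memory ℝ
  open OrderedStoryline I
  open Chains ℝ I σ using (Edge)

  module _ (row≡ : ∀ (t : Fin ℓ) → nats σ rowᴬ (toℕ t) ≡ toℕ t * n)
           (n≡ : nats σ 0 0 ≡ n) (ℓ≡ : nats σ 0 1 ≡ ℓ)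
           (active≡ : ∀ t c → nats σ activeᴬ (toℕ t * n + toℕ c) ≡ (if does (t ∈? A c) then 1 else 0)) where
    open Chains ℝ I σ using (checkEdge-spec) renaming (Fixed to Fixed′)

    Fixed : State → Set
    Fixed = Fixed′ row≡ n≡ ℓ≡ active≡

    module _ (τ₀ : State) (fixed : Fixed τ₀) (rest≡0 : nats τ₀ restᴬ 0 ≡ 0) where
      depth : Fin n → ℕ
      depth c = nats τ₀ depthᴬ (toℕ c)

      -- The first component is the bound used for optimality; the second supplies the starting
      -- point of the trace.
      Selected : ℕ → State → Set
      Selected k τ = (∀ c → toℕ c < k → Edge c c → depth c < nats τ restᴬ 0) ×
        (nats τ restᴬ 0 ≡ 0 ⊎ ∃[ c ] (nats τ bestᴬ 0 ≡ toℕ c × Edge c c × nats τ restᴬ 0 ≡ suc (depth c)))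

      select-spec : Selected n (exec selectBest τ₀)
      select-spec = for-rule iᴬ 0 body τ₀ Selected (trans (onᴺ fixed 0 0) n≡) ((λ _ ()) , inj₁ rest≡0) step
        where
        load choose improve body : Cmd
        load = srcᴬ [ `lit 0 ]:=ᴺ var iᴬ ⨟ tgtᴬ [ `lit 0 ]:=ᴺ var iᴬ
        improve = restᴬ [ `lit 0 ]:=ᴺ `lit 1 `+ depthᴬ [ var iᴬ ]ᴺ ⨟ bestᴬ [ `lit 0 ]:=ᴺ var iᴬ
        choose = when `lit 0 `<ᴺ var badᴬ
          then skip
          else when var restᴬ `<ᴺ `lit 1 `+ depthᴬ [ var iᴬ ]ᴺ then improve else skip
        body = srcᴬ [ `lit 0 ]:=ᴺ var iᴬ ⨟ tgtᴬ [ `lit 0 ]:=ᴺ var iᴬ ⨟ checkEdge ⨟ choose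
        step : ∀ (i : Fin n) τ → Frame selectBest τ₀ τ → nats τ iᴬ 0 ≡ toℕ i →
               Selected (toℕ i) τ → Selected (suc (toℕ i)) (exec body τ)
        step i τ F i≡ (below , now) =
          when<ᴺ (Selected (suc (toℕ i))) (`lit 0) (var badᴬ) skip
            (when var restᴬ `<ᴺ `lit 1 `+ depthᴬ [ var iᴬ ]ᴺ then improve else skip) υ
            (λ 0<bad → (λ c c<si e → widen (λ { refl e → contradiction (from edge⇔ e) (m<n⇒n≢0 0<bad) }) c c<si e) , now′)
            λ bad≤0 →
          when<ᴺ (Selected (suc (toℕ i))) (var restᴬ) (`lit 1 `+ depthᴬ [ var iᴬ ]ᴺ) improve skip υ
            (λ lt → (λ c c<si e → subst (depth c <_) (sym (cong suc depth≡)) (deeper (subst (nats υ restᴬ 0 <_) (cong suc depth≡) lt) c c<si e)) ,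
                    inj₂ (i , i≡′ , to edge⇔ (n≤0⇒n≡0 bad≤0) , cong suc depth≡))
            (λ ge → widen (λ { refl _ → subst (_≤ nats υ restᴬ 0) (cong suc depth≡) ge }) , now′)
          where
          open Equivalence
          υ = exec checkEdge (exec load τ)
          G = frame (load ⨟ checkEdge) τ
          i≡′ : nats υ iᴬ 0 ≡ toℕ i
          i≡′ = trans (frameᴺ G iᴬ 0) i≡
          edge⇔ : nats υ badᴬ 0 ≡ 0 ⇔ Edge i i
          edge⇔ = proj₂ (checkEdge-spec row≡ n≡ ℓ≡ active≡ {i} {i} (exec load τ)
            (agree-frame (frame load τ) (agree-frame F fixed)) i≡ i≡)
          depth≡ : nats υ depthᴬ (nats υ iᴬ 0) ≡ depth i
          depth≡ = trans (cong (nats υ depthᴬ) i≡′) (trans (frameᴺ G depthᴬ _) (frameᴺ F depthᴬ _))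
          rest≡ : nats υ restᴬ 0 ≡ nats τ restᴬ 0
          rest≡ = frameᴺ G restᴬ 0
          now′ : nats υ restᴬ 0 ≡ 0 ⊎ ∃[ c ] (nats υ bestᴬ 0 ≡ toℕ c × Edge c c × nats υ restᴬ 0 ≡ suc (depth c))
          now′ = [ (λ z → inj₁ (trans rest≡ z)) , (λ { (c , b , e , r) → inj₂ (c , trans (frameᴺ G bestᴬ 0) b , e , trans rest≡ r) }) ]′ now
          widen : (∀ {c} → c ≡ i → Edge c c → depth c < nats υ restᴬ 0) →
                  ∀ c → toℕ c < suc (toℕ i) → Edge c c → depth c < nats υ restᴬ 0
          widen new c c<si e with m≤n⇒m<n∨m≡n (ℕ.s≤s⁻¹ c<si)
          ... | inj₁ c<i = subst (depth c <_) (sym rest≡) (below c c<i e)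
          ... | inj₂ c≡i = new (toℕ-injective c≡i) e
          deeper : nats υ restᴬ 0 < suc (depth i) → ∀ c → toℕ c < suc (toℕ i) → Edge c c → depth c < suc (depth i)
          deeper lt c c<si e with m≤n⇒m<n∨m≡n (ℕ.s≤s⁻¹ c<si)
          ... | inj₁ c<i = <-trans (subst (depth c <_) (sym rest≡) (below c c<i e)) lt
          ... | inj₂ c≡i rewrite toℕ-injective c≡i = ≤-refl

-- Tracing the path back along predecessors.

module Tracing (ℝ : RealField) {n : ℕ} (σ : RealRAM.State ℝ) where
  open import Data.Nat using (_<_)
  open RealRAM ℝ
  open LoopPrograms ℝ

  Marking : State → List (Fin n) → Set
  Marking τ xs = ∀ c → (nats τ markᴬ (toℕ c) ≡ 1 × c ∈ xs) ⊎ (nats τ markᴬ (toℕ c) ≡ 0 × ¬ (c ∈ xs))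

  module _ (n≡ : nats σ 0 0 ≡ n) (unmarked : ∀ j → nats σ markᴬ j ≡ 0)
           (depth : Fin n → ℕ) (Good : Fin n → Set) (_≼_ : Fin n → Fin n → Set)
           (≼-trans : ∀ {a b c} → a ≼ b → b ≼ c → a ≼ c)
           (link : ∀ c → Good c → depth c ≡ 0 ⊎
             ∃[ b ] (nats σ predᴬ (toℕ c) ≡ toℕ b × Good b × depth c ≡ suc (depth b) × b ≼ c)) where

    -- Increasing depth keeps the traced characters distinct, while `_≼_` is what placement relies
    -- on. Both are transitive, so comparing each new character with the latest one settles all
    -- pairs.
    Above : Fin n → Fin n → Set
    Above c x = depth c < depth x × c ≼ x

    -- Either the path is used up, or every pass so far has contributed a character. The latter is
    -- impossible after n passes, since it would yield n + 1 distinct characters.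
    Front : ℕ → State → List (Fin n) → Set
    Front k τ xs = nats τ restᴬ 0 ≡ 0 ⊎
      (length xs ≡ k × ∃[ c ] (nats τ bestᴬ 0 ≡ toℕ c × Good c × nats τ restᴬ 0 ≡ suc (depth c) × All (Above c) xs))

    Trace : ℕ → State → Set
    Trace k τ = ∃[ xs ] (AllPairs Above xs × All Good xs × Marking τ xs ×
                         length xs + nats τ restᴬ 0 ≡ nats σ restᴬ 0 × Front k τ xs)

    above⇒unique : ∀ {xs} → AllPairs Above xs → Unique xs
    above⇒unique = AllPairs.map λ (lt , _) eq → <⇒≢ lt (cong depth eq)

    trace-spec : (nats σ restᴬ 0 ≡ 0 ⊎ ∃[ c ] (nats σ bestᴬ 0 ≡ toℕ c × Good c × nats σ restᴬ 0 ≡ suc (depth c))) →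
      ∃[ xs ] (AllPairs Above xs × All Good xs × Marking (exec traceChain σ) xs × length xs ≡ nats σ restᴬ 0)
    trace-spec start = finish (for-rule iᴬ 0 body σ Trace n≡
        ([] , [] , [] , (λ c → inj₂ (unmarked _ , λ ())) , refl ,
         [ inj₁ , (λ { (c , b , g , r) → inj₂ (refl , c , b , g , r , []) }) ]′ start) step)
      where
      visit body : Cmd
      visit = markᴬ [ var bestᴬ ]:=ᴺ `lit 1
              ⨟ restᴬ [ `lit 0 ]:=ᴺ var restᴬ `∸ `lit 1
              ⨟ bestᴬ [ `lit 0 ]:=ᴺ predᴬ [ var bestᴬ ]ᴺ
      body = when `lit 0 `<ᴺ var restᴬ then visit else skip
      finish : Trace n (exec traceChain σ) →
        ∃[ xs ] (AllPairs Above xs × All Good xs × Marking (exec traceChain σ) xs × length xs ≡ nats σ restᴬ 0)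
      finish (xs , ord , good , mk , len , inj₁ r≡0) =
        xs , ord , good , mk , trans (sym (+-identityʳ _)) (trans (cong (length xs +_) (sym r≡0)) len)
      finish (xs , ord , good , mk , len , inj₂ (len≡n , c , _ , _ , _ , abv)) =
        contradiction (unique⇒length≤ (above⇒unique (abv ∷ ord))) (<⇒≱ (s≤s (≤-reflexive (sym len≡n))))
      step : ∀ (i : Fin n) τ → Frame traceChain σ τ → nats τ iᴬ 0 ≡ toℕ i →
             Trace (toℕ i) τ → Trace (suc (toℕ i)) (exec body τ)
      step i τ F i≡ (xs , ord , good , mk , len , front) =
        when<ᴺ (Trace (suc (toℕ i))) (`lit 0) (var restᴬ) visit skip τ
          (λ 0<r → [ (λ r≡0 → contradiction r≡0 (m<n⇒n≢0 0<r)) , go ]′ front)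
          (λ r≤0 → xs , ord , good , mk , len , inj₁ (n≤0⇒n≡0 r≤0))
        where
        go : length xs ≡ toℕ i × ∃[ c ] (nats τ bestᴬ 0 ≡ toℕ c × Good c × nats τ restᴬ 0 ≡ suc (depth c) × All (Above c) xs) →
             Trace (suc (toℕ i)) (exec visit τ)
        go (len≡ , c , best≡ , gc , rest≡ , abv) =
          c ∷ xs , abv ∷ ord , gc ∷ good , marking , len′ , front′
          where
          υ = exec visit τ
          rest′ : nats υ restᴬ 0 ≡ depth c
          rest′ = cong (_∸ 1) rest≡
          len′ : suc (length xs) + nats υ restᴬ 0 ≡ nats σ restᴬ 0
          len′ = trans (sym (+-suc (length xs) _)) (trans (cong (length xs +_) (trans (cong suc rest′) (sym rest≡))) len)
          marking : Marking υ (c ∷ xs)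
          marking d with toℕ d ≟ nats τ bestᴬ 0
          ... | yes eq = inj₁ (write-same (nats τ) markᴬ 1 eq , here (toℕ-injective (trans eq best≡)))
          ... | no  ne with mk d
          ...   | inj₁ (m1 , d∈) = inj₁ (trans (write-other (nats τ) markᴬ 1 ne) m1 , there d∈)
          ...   | inj₂ (m0 , d∉) = inj₂ (trans (write-other (nats τ) markᴬ 1 ne) m0 ,
                    λ { (here refl) → ne (sym best≡) ; (there d∈) → d∉ d∈ })
          front′ : Front (suc (toℕ i)) υ (c ∷ xs)
          front′ with link c gc
          ... | inj₁ d≡0 = inj₁ (trans rest′ d≡0)
          ... | inj₂ (b , pr , gb , d≡ , b≼c) = inj₂ (cong suc len≡ , b ,
                  trans (cong (nats τ predᴬ) best≡) (trans (frameᴺ F predᴬ _) pr) , gb , trans rest′ d≡ ,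
                  (b<c , b≼c) ∷ All.map (λ { (lt , c≼x) → <-trans b<c lt , ≼-trans b≼c c≼x }) abv)
            where
            b<c : depth b < depth c
            b<c = ≤-reflexive (sym d≡)

-- Placing all characters at every time step.

module Placement (ℝ : RealField) (I : OrderedStoryline) (σ : RealRAM.State ℝ) where
  open import Data.Nat using (_<_)
  open RealField ℝ renaming (_<_ to _<ᴿ_; _≤ᴿ_ to infix 4 _≤ᴿ_)
  open RealRAM ℝ
  open LoopPrograms ℝ
  open RealProperties ℝ
  open Memory ℝ
  open OrderedStoryline I
  open Preparation ℝ I using (ix)

  -- `sup` yields maxima, so a lower bound of the marked offsets is obtained as `0# ⊖ low t` from
  -- the maximum of the negated offsets. The base 0 serves when nothing is marked.
  low : Fin ℓ → Carrier
  low t = sup 0# (λ c → does (0 <? nats σ markᴬ c)) (λ c → reals σ packedᴬ (ix t c) ⊖ reals σ heightᴬ c) n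

  shift : Fin ℓ → Fin n → Carrier
  shift t d = sup (0# ⊖ low t)
    (λ c → does (nats σ breaksᴬ (ix t c) ∸ nats σ breaksᴬ (ix t (toℕ d)) <? nats σ markᴬ c))
    (λ c → reals σ heightᴬ c ⊖ reals σ packedᴬ (ix t c)) n

  placed : Fin ℓ → Fin n → Carrier
  placed t d = reals σ packedᴬ (ix t (toℕ d)) ⊕ shift t d

  module _ (row≡ : ∀ (t : Fin ℓ) → nats σ rowᴬ (toℕ t) ≡ toℕ t * n)
           (n≡ : nats σ 0 0 ≡ n) (ℓ≡ : nats σ 0 1 ≡ ℓ) where
    Fixed : State → Set
    Fixed = Agree (0 ∷ rowᴬ ∷ breaksᴬ ∷ markᴬ ∷ []) (packedᴬ ∷ heightᴬ ∷ []) σ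

    cell≡ : ∀ {t : Fin ℓ} {c} v {τ} → Fixed τ → nats τ tᴬ 0 ≡ toℕ t → nats τ v 0 ≡ c →
            evalᴺ τ (cell (var tᴬ) (var v)) ≡ ix t c
    cell≡ {t} v {τ} A t≡ c≡ =
      cong₂ _+_ (trans (cong (nats τ rowᴬ) t≡) (trans (onᴺ A rowᴬ _) (row≡ t))) c≡

    packed≡ : ∀ {t : Fin ℓ} {c} v {τ} → Fixed τ → nats τ tᴬ 0 ≡ toℕ t → nats τ v 0 ≡ c →
              evalᴿ τ (atᴿ packedᴬ (var tᴬ) (var v)) ≡ reals σ packedᴬ (ix t c)
    packed≡ {t} {c} v {τ} A t≡ c≡ =
      trans (cong (reals τ packedᴬ) (cell≡ {t} {c} v {τ} A t≡ c≡)) (onᴿ A packedᴬ _)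

    breaks≡ : ∀ {t : Fin ℓ} {c} v {τ} → Fixed τ → nats τ tᴬ 0 ≡ toℕ t → nats τ v 0 ≡ c →
              evalᴺ τ (at breaksᴬ (var tᴬ) (var v)) ≡ nats σ breaksᴬ (ix t c)
    breaks≡ {t} {c} v {τ} A t≡ c≡ =
      trans (cong (nats τ breaksᴬ) (cell≡ {t} {c} v {τ} A t≡ c≡)) (onᴺ A breaksᴬ _)

    height≡ : ∀ {c τ} → Fixed τ → nats τ iᴬ 0 ≡ c → reals τ heightᴬ (nats τ iᴬ 0) ≡ reals σ heightᴬ c
    height≡ {τ = τ} A c≡ = trans (cong (reals τ heightᴬ) c≡) (onᴿ A heightᴬ _)

    mark≡ : ∀ {c τ} → Fixed τ → nats τ iᴬ 0 ≡ c → nats τ markᴬ (nats τ iᴬ 0) ≡ nats σ markᴬ c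
    mark≡ {τ = τ} A c≡ = trans (cong (nats τ markᴬ) c≡) (onᴺ A markᴬ _)

    Before : ℕ → ℕ → Fin ℓ → Fin n → Set
    Before i j t d = toℕ t < i ⊎ (toℕ t ≡ i × toℕ d < j)

    Placed : ℕ → ℕ → State → Set
    Placed i j τ = ∀ t d → Before i j t d → reals τ outᴬ (ix t (toℕ d)) ≡ placed t d

    lower raise : Cmd
    lower = maximise lowᴬ iᴬ 0 (`lit 0 `<ᴺ markᴬ [ var iᴬ ]ᴺ) drop
    raise = maximise shiftᴬ iᴬ 0 before slack

    lower-spec : ∀ {t} τ → Fixed τ → nats τ tᴬ 0 ≡ toℕ t → reals τ lowᴬ 0 ≡ 0# →
                 reals (exec lower τ) lowᴬ 0 ≡ low t
    lower-spec {t} τ A t≡ 0≡ = maximise-spec lowᴬ iᴬ 0 (`lit 0 `<ᴺ markᴬ [ var iᴬ ]ᴺ) drop τ (trans (onᴺ A 0 0) n≡) 0≡ λ i υ F i≡ →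
      let B = agree-frame F A
          t≡′ = trans (frameᴺ F tᴬ 0) t≡
      in cong (λ x → does (0 <? x)) (mark≡ {τ = υ} B i≡) ,
         cong₂ _⊖_ (packed≡ {t} iᴬ {υ} B t≡′ i≡) (height≡ {τ = υ} B i≡)

    raise-spec : ∀ {t d} τ → Fixed τ → nats τ tᴬ 0 ≡ toℕ t → nats τ jᴬ 0 ≡ toℕ d →
                 reals τ shiftᴬ 0 ≡ 0# ⊖ low t → reals (exec raise τ) shiftᴬ 0 ≡ shift t d
    raise-spec {t} {d} τ A t≡ j≡ z≡ = maximise-spec shiftᴬ iᴬ 0 before slack τ (trans (onᴺ A 0 0) n≡) z≡ λ i υ F i≡ →
      let B = agree-frame F A
          t≡′ = trans (frameᴺ F tᴬ 0) t≡
          j≡′ = trans (frameᴺ F jᴬ 0) j≡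
      in cong₂ (λ x y → does (x <? y))
           (cong₂ _∸_ (breaks≡ {t} iᴬ {υ} B t≡′ i≡) (breaks≡ {t} jᴬ {υ} B t≡′ j≡′)) (mark≡ {τ = υ} B i≡) ,
         cong₂ _⊖_ (height≡ {τ = υ} B i≡) (packed≡ {t} iᴬ {υ} B t≡′ i≡)

    placeOne : Cmd
    placeOne = shiftᴬ [ `lit 0 ]:=ᴿ `0 `⊖ varᴿ lowᴬ ⨟ raise
               ⨟ outᴬ [ cell (var tᴬ) (var jᴬ) ]:=ᴿ atᴿ packedᴬ (var tᴬ) (var jᴬ) `⊕ varᴿ shiftᴬ

    placeOne-spec : ∀ t d τ → Fixed τ → nats τ tᴬ 0 ≡ toℕ t → nats τ jᴬ 0 ≡ toℕ d → reals τ lowᴬ 0 ≡ low t →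
                    Placed (toℕ t) (toℕ d) τ → Placed (toℕ t) (suc (toℕ d)) (exec placeOne τ)
    placeOne-spec t d τ A t≡ j≡ low≡ old t′ d′ b = go (ix t′ (toℕ d′) ≟ evalᴺ υ (cell (var tᴬ) (var jᴬ)))
      where
      init = shiftᴬ [ `lit 0 ]:=ᴿ `0 `⊖ varᴿ lowᴬ
      υ = exec raise (exec init τ)
      F = frame (init ⨟ raise) τ
      B : Fixed υ
      B = agree-frame F A
      t≡′ = trans (frameᴺ F tᴬ 0) t≡
      j≡′ = trans (frameᴺ F jᴬ 0) j≡
      shift≡ : reals υ shiftᴬ 0 ≡ shift t d
      shift≡ = raise-spec {t} {d} (exec init τ) (agree-frame (frame init τ) A) t≡ j≡ (cong (0# ⊖_) low≡)
      cell≡′ : evalᴺ υ (cell (var tᴬ) (var jᴬ)) ≡ ix t (toℕ d)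
      cell≡′ = cell≡ {t} jᴬ {υ} B t≡′ j≡′
      go : Dec (ix t′ (toℕ d′) ≡ evalᴺ υ (cell (var tᴬ) (var jᴬ))) →
           reals (exec placeOne τ) outᴬ (ix t′ (toℕ d′)) ≡ placed t′ d′
      go (yes eq) with cell-injective {t = t′} {t} {d′} {d} (trans eq cell≡′)
      ... | refl , refl = trans (write-same (reals υ) outᴬ _ eq) (cong₂ _⊕_ (packed≡ {t} jᴬ {υ} B t≡′ j≡′) shift≡)
      go (no ne) = trans (write-other (reals υ) outᴬ _ ne) (trans (frameᴿ F outᴬ _) (old t′ d′ (earlier b)))
        where
        earlier : Before (toℕ t) (suc (toℕ d)) t′ d′ → Before (toℕ t) (toℕ d) t′ d′
        earlier (inj₁ lt) = inj₁ lt
        earlier (inj₂ (t≡ , d<)) = inj₂ (t≡ , ≤∧≢⇒< (ℕ.s≤s⁻¹ d<) λ d≡ →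
          ne (trans (cong₂ ix (toℕ-injective t≡) d≡) (sym cell≡′)))

    place-spec : ∀ t d → reals (exec placeAll σ) outᴬ (ix t (toℕ d)) ≡ placed t d
    place-spec t d = for-rule tᴬ 1 body σ (λ i → Placed i 0) ℓ≡ (λ { _ _ (inj₁ ()) ; _ _ (inj₂ (_ , ())) }) step t d (inj₁ (toℕ<n t))
      where
      init body : Cmd
      init = lowᴬ [ `lit 0 ]:=ᴿ `0
      body = init ⨟ lower ⨟ for jᴬ < 0 run placeOne
      step : ∀ (i : Fin ℓ) τ → Frame placeAll σ τ → nats τ tᴬ 0 ≡ toℕ i →
             Placed (toℕ i) 0 τ → Placed (suc (toℕ i)) 0 (exec body τ)
      step i τ F t≡ old t d b = row t d (now b)
        where
        υ = exec lower (exec init τ)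
        G = frame (init ⨟ lower) τ
        fixed : Fixed υ
        fixed = agree-frame G (agree-frame F agree-refl)
        low≡ : reals υ lowᴬ 0 ≡ low i
        low≡ = lower-spec {i} (exec init τ) (agree-frame (frame init τ) (agree-frame F agree-refl)) t≡ refl
        row : Placed (toℕ i) n (exec (for jᴬ < 0 run placeOne) υ)
        row = for-rule jᴬ 0 placeOne υ (Placed (toℕ i)) (trans (onᴺ fixed 0 0) n≡)
          (λ t d b → trans (frameᴿ G outᴬ _) (old t d b))
          λ j χ H j≡ → placeOne-spec i j χ (agree-frame H fixed)
            (trans (frameᴺ H tᴬ 0) (trans (frameᴺ G tᴬ 0) t≡)) j≡ (trans (frameᴿ H lowᴬ 0) low≡)
        now : Before (suc (toℕ i)) 0 t d → Before (toℕ i) n t d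
        now (inj₁ t<si) = [ inj₁ , (λ t≡i → inj₂ (t≡i , toℕ<n d)) ]′ (m≤n⇒m<n∨m≡n (ℕ.s≤s⁻¹ t<si))
        now (inj₂ (_ , ()))

-- Blocks of lists and pairwise ordered lists.

lookup-block : ∀ {A : Set} (xs ys zs : List A) (p : Fin (length (xs ++ ys ++ zs))) →
  length xs ≤ toℕ p → toℕ p ℕ.< length xs + length ys → lookup (xs ++ ys ++ zs) p ∈ ys
lookup-block []       (y ∷ ys) zs Fin.zero    _         _         = here refl
lookup-block []       (y ∷ ys) zs (Fin.suc p) _         (s≤s p<) = there (lookup-block [] ys zs p z≤n p<)
lookup-block (x ∷ xs) ys       zs (Fin.suc p) (s≤s xs≤) (s≤s p<) = lookup-block xs ys zs p xs≤ p<

block-position : ∀ {A : Set} (xs ys zs : List A) (p : Fin (length (xs ++ ys ++ zs))) →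
  Unique (xs ++ ys ++ zs) → lookup (xs ++ ys ++ zs) p ∈ ys →
  length xs ≤ toℕ p × toℕ p ℕ.< length xs + length ys
block-position []       (y ∷ ys) zs Fin.zero    _        _          = z≤n , s≤s z≤n
block-position []       (y ∷ ys) zs (Fin.suc p) (y∉ ∷ _) (here eq)  = contradiction (sym eq) (All.lookup y∉ (∈-lookup p))
block-position []       (y ∷ ys) zs (Fin.suc p) (_ ∷ u)  (there ∈ys) = z≤n , s≤s (proj₂ (block-position [] ys zs p u ∈ys))
block-position (x ∷ xs) ys       zs Fin.zero    (x∉ ∷ _) ∈ys        =
  contradiction refl (All.lookup x∉ (∈-++⁺ʳ xs (∈-++⁺ˡ ∈ys)))
block-position (x ∷ xs) ys       zs (Fin.suc p) (_ ∷ u)  ∈ys        =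
  let l , r = block-position xs ys zs p u ∈ys in s≤s l , s≤s r

allPairs-lookup : ∀ {A : Set} {R : A → A → Set} (xs : List A) →
  (∀ p q → toℕ p ℕ.< toℕ q → R (lookup xs p) (lookup xs q)) → AllPairs R xs
allPairs-lookup []       f = []
allPairs-lookup {R = R} (x ∷ xs) f =
  All.tabulate (λ y∈ → subst (R x) (sym (lookup-index y∈)) (f Fin.zero (Fin.suc (index y∈)) (s≤s z≤n))) ∷
  allPairs-lookup xs λ p q p<q → f (Fin.suc p) (Fin.suc q) (s≤s p<q)

allPairs-∈ : ∀ {A : Set} {R : A → A → Set} {xs : List A} → AllPairs R xs →
             ∀ {x y} → x ∈ xs → y ∈ xs → x ≡ y ⊎ R x y ⊎ R y x
allPairs-∈ (r ∷ rs) (here refl) (here refl) = inj₁ refl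
allPairs-∈ (r ∷ rs) (here refl) (there y∈)  = inj₂ (inj₁ (All.lookup r y∈))
allPairs-∈ (r ∷ rs) (there x∈)  (here refl) = inj₂ (inj₂ (All.lookup r x∈))
allPairs-∈ (r ∷ rs) (there x∈)  (there y∈)  = allPairs-∈ rs x∈ y∈

allPairs-given : ∀ {A : Set} {P : A → Set} {R : A → A → Set} {xs : List A} →
  All P xs → AllPairs (λ x y → P x → P y → R x y) xs → AllPairs R xs
allPairs-given []       []       = []
allPairs-given (p ∷ ps) (r ∷ rs) = All.zipWith (λ (py , f) → f p py) (ps , r) ∷ allPairs-given ps rs

-- The values are distinct numbers in the interval from k to m. The lower end k, needed only as 0,
-- moves up in the induction along the list.
increasing⇒length≤ : ∀ {A : Set} (f : A → ℕ) {m k xs} → k ≤ m → AllPairs (λ x y → f x ℕ.< f y) xs →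
  All (λ x → k ≤ f x × f x ℕ.< m) xs → k + length xs ≤ m
increasing⇒length≤ f {m} {k} k≤m [] [] = subst (_≤ m) (sym (+-identityʳ k)) k≤m
increasing⇒length≤ f {m} {k} {x ∷ xs} _ (r ∷ rs) ((k≤ , <m) ∷ bs) = begin
  k + suc (length xs)    ≡⟨ +-suc k _ ⟩
  suc k + length xs      ≤⟨ +-monoˡ-≤ _ (s≤s k≤) ⟩
  suc (f x) + length xs  ≤⟨ increasing⇒length≤ f <m rs (All.zipWith (λ (lt , _ , b) → lt , b) (r , bs)) ⟩
  m                      ∎
  where open ≤-Reasoning

-- Meetings as intervals of positions, and their number.

module Meetings (I : OrderedStoryline) where
  open import Data.Nat using (_<_)
  open OrderedStoryline I
  open Storyline I

  ∈-π : ∀ {t c} → t ∈ˢ A c → c ∈ π t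
  ∈-π {t} {c} = Equivalence.from (π-active t c)

  active : ∀ t (p : Fin (length (π t))) → t ∈ˢ A (lookup (π t) p)
  active t p = Equivalence.to (π-active t _) (∈-lookup p)

  meeting-position : ∀ M (p : Fin (length (π (tm M)))) → lookup (π (tm M)) p ∈ˢ char M ⇔
    (meetingStart M ≤ toℕ p × toℕ p < meetingStart M + meetingSize M)
  meeting-position M p with meeting-consecutive M
  ... | xs , ys , zs , eq , mem = go (π (tm M)) eq (π-unique (tm M)) p
    where
    -- π (tm M) is replaced by a variable L, so that the equation can be matched although the type
    -- of p depends on the list.
    go : ∀ L → L ≡ xs ++ ys ++ zs → Unique L → ∀ p → lookup L p ∈ˢ char M ⇔
         (length xs ≤ toℕ p × toℕ p < length xs + length ys)
    go _ refl u p = mk⇔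
      (λ ∈M → block-position xs ys zs p u (Equivalence.from (mem _) ∈M))
      (λ (l , r) → Equivalence.to (mem _) (lookup-block xs ys zs p l r))

  block-cong : ∀ M M′ → tm M ≡ tm M′ → meetingStart M ≡ meetingStart M′ → meetingSize M ≡ meetingSize M′ →
               char M ⊆ char M′
  block-cong M M′ tm≡ st≡ sz≡ {c} c∈ = subst (_∈ˢ char M′) (sym (lookup-index c∈π)) (go M′ (sym tm≡)
      (subst (_≤ toℕ p) st≡ (proj₁ bounds)) (subst (toℕ p <_) (cong₂ _+_ st≡ sz≡) (proj₂ bounds)))
    where
    c∈π : c ∈ π (tm M)
    c∈π with meeting-consecutive M
    ... | xs , ys , zs , eq , mem = subst (c ∈_) (sym eq) (∈-++⁺ʳ xs (∈-++⁺ˡ (Equivalence.from (mem c) c∈)))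
    p = index c∈π
    bounds = Equivalence.to (meeting-position M p) (subst (_∈ˢ char M) (lookup-index c∈π) c∈)
    go : ∀ {t} {p : Fin (length (π t))} M → tm M ≡ t → meetingStart M ≤ toℕ p →
         toℕ p < meetingStart M + meetingSize M → lookup (π t) p ∈ˢ char M
    go {p = p} M refl l r = Equivalence.from (meeting-position M p) (l , r)

  -- Time step, start and size of the block determine the characters and hence, by `meeting-ext`,
  -- the meeting. Start and size both range from 0 to n.
  meetings≤ : m ≤ ℓ * (suc n * suc n)
  meetings≤ = injective⇒≤ {f = code} λ {M} {M′} eq →
    let t≡ , block≡ = combine-injective (tm M) (combine (start M) (size M)) (tm M′) (combine (start M′) (size M′)) eq
        st , sz = combine-injective (start M) (size M) (start M′) (size M′) block≡
        st≡ = fromℕ<-injective _ _ (start< M) (start< M′) st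
        sz≡ = fromℕ<-injective _ _ (size< M) (size< M′) sz
    in meeting-ext t≡ (⊆-antisym (block-cong M M′ t≡ st≡ sz≡) (block-cong M′ M (sym t≡) (sym st≡) (sym sz≡)))
    where
    start< : ∀ M → meetingStart M < suc n
    start< M = s≤s (≤-trans (m≤m+n _ (meetingSize M)) (blockEnd≤n M))
    size< : ∀ M → meetingSize M < suc n
    size< M = s≤s (≤-trans (m≤n+m _ (meetingStart M)) (blockEnd≤n M))
    start size : Fin m → Fin (suc n)
    start M = fromℕ< (start< M)
    size M = fromℕ< (size< M)
    code : Fin m → Fin (ℓ * (suc n * suc n))
    code M = combine (tm M) (combine (start M) (size M))

-- Widths of stretches in nice coordinations.

module Geometry (ℝ : RealField) (I : OrderedStoryline)
                (Δ Δ̄ : RealField.Carrier ℝ) where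
  open import Data.Nat using (_<_)
  open RealField ℝ renaming (_<_ to _<ᴿ_; _≤ᴿ_ to infix 4 _≤ᴿ_)
  open RealProperties ℝ
  open OrderedStoryline I
  open Storyline I
  open Meetings I public using (∈-π; active)
  open Meetings I using (meeting-position)
  open Preparation ℝ I using (effectiveGap; Reaches)
  open Coordinations ℝ I

  -- A meeting is an interval of positions, so neighbours share one as soon as a block begun by p
  -- extends beyond q. Hence the largest end among the blocks begun so far decides.
  reaches⇔common : ∀ t (p q : Fin (length (π t))) → toℕ q ≡ suc (toℕ p) →
    (∃[ s ] (toℕ s ≤ toℕ p × Reaches m t s (toℕ q))) ⇔ CommonMeeting t (lookup (π t) p) (lookup (π t) q)
  reaches⇔common t p q q≡ = mk⇔
    (λ { (s , s≤p , M , _ , refl , st , _ , q<) →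
      let start≤p = subst (_≤ toℕ p) (sym st) s≤p
          p<q = ≤-reflexive (sym q≡)
      in M , refl , Equivalence.from (meeting-position M p) (start≤p , <-trans p<q q<)
                  , Equivalence.from (meeting-position M q) (≤-trans start≤p (<⇒≤ p<q) , q<) })
    (λ { (M , refl , p∈ , q∈) →
      let start≤p , _ = Equivalence.to (meeting-position M p) p∈
          _ , q< = Equivalence.to (meeting-position M q) q∈
          start<n = ≤-<-trans start≤p (<-≤-trans (toℕ<n p) (length≤n (tm M)))
          start≡ = toℕ-fromℕ< start<n
          start<end = ≤-<-trans start≤p (<-trans (≤-reflexive (sym q≡)) q<)
      in fromℕ< start<n , subst (_≤ toℕ p) (sym start≡) start≤p , M , toℕ<n M , refl , sym start≡ ,
         +-cancelˡ-< (meetingStart M) _ _ (subst (_< meetingStart M + meetingSize M) (sym (+-identityʳ _)) start<end) , q< })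

  Γ : Carrier
  Γ = effectiveGap Δ Δ̄

  Step : Carrier → Carrier → ℕ → ℕ → Set → Set
  Step x x′ b b′ Common = (Common × x′ ≡ x ⊕ Δ × b′ ≡ b) ⊎ (¬ Common × x′ ≡ x ⊕ Γ × b′ ≡ suc b)

  step-cong : ∀ {x x′ z z′ b b′ d d′ Common} → x ≡ z → x′ ≡ z′ → b ≡ d → b′ ≡ d′ →
              Step z z′ d d′ Common → Step x x′ b b′ Common
  step-cong refl refl refl refl s = s

  -- In the last case any positive value would do: given `Δ-pos`, no neighbours share a meeting, so
  -- there is no rigid width to compare with.
  gap-cases : (0# <ᴿ Δ̄ × Γ ≡ Δ̄) ⊎ (Δ̄ ≤ᴿ 0# × 0# <ᴿ Δ × Γ ≡ Δ ⊗ (n · 1#) ⁻¹) ⊎ (Δ̄ ≤ᴿ 0# × Δ ≤ᴿ 0# × Γ ≡ 1#)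
  gap-cases with 0# <ᴿ? Δ̄ | 0# <ᴿ? Δ
  ... | yes 0<Δ̄ | _        = inj₁ (0<Δ̄ , refl)
  ... | no  Δ̄≤0 | yes 0<Δ  = inj₂ (inj₁ (Δ̄≤0 , 0<Δ , refl))
  ... | no  Δ̄≤0 | no  Δ≤0  = inj₂ (inj₂ (Δ̄≤0 , Δ≤0 , refl))

  module _ (n≢0 : n ≢ 0) where
    Γ-pos : 0# <ᴿ Γ
    Γ-pos with gap-cases
    ... | inj₁ (0<Δ̄ , eq)            = subst (0# <ᴿ_) (sym eq) 0<Δ̄
    ... | inj₂ (inj₁ (_ , 0<Δ , eq)) = subst (0# <ᴿ_) (sym eq) (⊘-pos n n≢0 0<Δ)
    ... | inj₂ (inj₂ (_ , _ , eq))   = subst (0# <ᴿ_) (sym eq) 0<1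

    Δ̄≤Γ : Δ̄ ≤ᴿ Γ
    Δ̄≤Γ with gap-cases
    ... | inj₁ (_ , eq)            = ≤ᴿ-reflexive (sym eq)
    ... | inj₂ (inj₁ (Δ̄≤0 , _ , _)) = ≤ᴿ-trans Δ̄≤0 (<ᴿ⇒≤ᴿ Γ-pos)
    ... | inj₂ (inj₂ (Δ̄≤0 , _ , _)) = ≤ᴿ-trans Δ̄≤0 (<ᴿ⇒≤ᴿ Γ-pos)

    -- `Δ-pos` is conditional because without neighbours in a common meeting a nice coordination
    -- says nothing about the sign of Δ.
    module Packed (Δ-pos : ∀ t c c′ → Consecutive t c c′ → CommonMeeting t c c′ → 0# <ᴿ Δ)
                  (X : Fin ℓ → Fin n → Carrier) (B : Fin ℓ → Fin n → ℕ)
             (step : ∀ t (p q : Fin (length (π t))) → toℕ q ≡ suc (toℕ p) →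
               Step (X t (lookup (π t) p)) (X t (lookup (π t) q)) (B t (lookup (π t) p)) (B t (lookup (π t) q))
                    (CommonMeeting t (lookup (π t) p) (lookup (π t) q))) where

      addΔ : ∀ x u v w → (x ⊕ (u ⊕ v)) ⊕ w ≡ x ⊕ ((w ⊕ u) ⊕ v)
      addΔ x u v w = trans (⊕-assoc x (u ⊕ v) w) (cong (x ⊕_)
        (trans (⊕-comm (u ⊕ v) w) (sym (⊕-assoc w u v))))

      addΓ : ∀ x u v w → (x ⊕ (u ⊕ v)) ⊕ w ≡ x ⊕ (u ⊕ (w ⊕ v))
      addΓ x u v w = trans (⊕-assoc x (u ⊕ v) w) (cong (x ⊕_)
        (trans (⊕-assoc u v w) (cong (u ⊕_) (⊕-comm v w))))

      -- The stretch of π_t from c to c′ has a gaps within meetings and b others.  It is rigid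
      -- if b = 0.
      record Stretch (t : Fin ℓ) (c c′ : Fin n) (a b : ℕ) : Set where
        field
          packed≡ : X t c′ ≡ X t c ⊕ (a · Δ ⊕ b · Γ)
          breaks≡ : B t c′ ≡ b + B t c
          Δ>0     : a ≢ 0 → 0# <ᴿ Δ
          -- Niceness bounds a gap outside meetings by Δ̄ and not by Γ. For Δ̄ ≤ 0 this bound is too
          -- weak, and `above` records the strictness that validity provides.
          atLeast : ∀ {y} → Nice Δ Δ̄ y → ∀ p q → y t c p ⊕ (a · Δ ⊕ b · Δ̄) ≤ᴿ y t c′ q
          exactly : ∀ {y} → Nice Δ Δ̄ y → b ≡ 0 → ∀ p q → y t c′ q ≡ y t c p ⊕ a · Δ
          above   : ∀ {y} → Nice Δ Δ̄ y → b ≢ 0 → ∀ p q → y t c p ⊕ a · Δ <ᴿ y t c′ q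
      open Stretch

      stretch-refl : ∀ t c → Stretch t c c 0 0
      packed≡ (stretch-refl t c) = sym (trans (cong (_ ⊕_) (⊕-identityˡ 0#)) (⊕-identityʳ _))
      breaks≡ (stretch-refl t c) = refl
      Δ>0     (stretch-refl t c) 0≢0 = contradiction refl 0≢0
      atLeast (stretch-refl t c) _ p q = ≤ᴿ-reflexive (trans (cong (_ ⊕_) (⊕-identityˡ 0#)) (⊕-identityʳ _))
      exactly (stretch-refl t c) _ _ p q = sym (⊕-identityʳ _)
      above   (stretch-refl t c) _ 0≢0 = contradiction refl 0≢0

      gap-together : ∀ {y} → Nice Δ Δ̄ y → ∀ {t c c′} p q → Consecutive t c c′ → CommonMeeting t c c′ →
                     y t c′ q ≡ y t c p ⊕ Δ
      gap-together {y} nice {t} {c} {c′} p q con com = trans (sym (⊖-⊕ _ _))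
        (trans (⊕-comm _ _) (cong (y t c p ⊕_)
          (trans (sym (abs-nonneg (<ᴿ⇒≤ᴿ (x<y⇒0<y⊖x (Nice.valid nice t c c′ p q (precedes con))))))
                 (Nice.together nice t c c′ p q con com))))
        where
        precedes : Consecutive t c c′ → c ≺[ t ] c′
        precedes (i , j , j≡ , ci , cj) = i , j , ≤-reflexive (sym j≡) , ci , cj

      gap-apart : ∀ {y} → Nice Δ Δ̄ y → ∀ {t c c′} p q → Consecutive t c c′ → ¬ CommonMeeting t c c′ →
                  y t c p ⊕ Δ̄ ≤ᴿ y t c′ q × y t c p <ᴿ y t c′ q
      gap-apart {y} nice {t} {c} {c′} p q con@(i , j , j≡ , ci , cj) ¬com =
        subst (y t c p ⊕ Δ̄ ≤ᴿ_) (trans (⊕-comm _ _) (⊖-⊕ _ _)) (⊕-monoʳ-≤ (y t c p)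
          (subst (Δ̄ ≤ᴿ_) (abs-nonneg (<ᴿ⇒≤ᴿ (x<y⇒0<y⊖x lt))) (Nice.apart nice t c c′ p q con ¬com))) , lt
        where
        lt = Nice.valid nice t c c′ p q (i , j , ≤-reflexive (sym j≡) , ci , cj)

      stretch-together : ∀ {t c d e a b} → t ∈ˢ A d → Stretch t c d a b → Consecutive t d e → CommonMeeting t d e →
        X t e ≡ X t d ⊕ Δ → B t e ≡ B t d → Stretch t c e (suc a) b
      packed≡ (stretch-together _ s con com x≡ b≡) = trans x≡ (trans (cong (_⊕ Δ) (packed≡ s)) (addΔ _ _ _ _))
      breaks≡ (stretch-together _ s con com x≡ b≡) = trans b≡ (breaks≡ s)
      Δ>0     (stretch-together _ s con com x≡ b≡) _ = Δ-pos _ _ _ con com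
      atLeast (stretch-together {t} {d = d} r s con com x≡ b≡) nice p q =
        subst₂ _≤ᴿ_ (addΔ _ _ _ _) (sym (gap-together nice r q con com)) (⊕-monoˡ-≤ Δ (atLeast s nice p r))
      exactly (stretch-together r s con com x≡ b≡) nice b≡0 p q =
        trans (gap-together nice r q con com) (trans (cong (_⊕ Δ) (exactly s nice b≡0 p r))
          (trans (⊕-assoc _ _ _) (cong (_ ⊕_) (⊕-comm _ _))))
      above   (stretch-together r s con com x≡ b≡) nice b≢0 p q =
        subst₂ _<ᴿ_ (trans (⊕-assoc _ _ _) (cong (_ ⊕_) (⊕-comm _ _))) (sym (gap-together nice r q con com))
          (⊕-monoˡ-< Δ (above s nice b≢0 p r))

      stretch-apart : ∀ {t c d e a b} → t ∈ˢ A d → Stretch t c d a b → Consecutive t d e → ¬ CommonMeeting t d e →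
        X t e ≡ X t d ⊕ Γ → B t e ≡ suc (B t d) → Stretch t c e a (suc b)
      packed≡ (stretch-apart _ s con ¬com x≡ b≡) = trans x≡ (trans (cong (_⊕ Γ) (packed≡ s)) (addΓ _ _ _ _))
      breaks≡ (stretch-apart _ s con ¬com x≡ b≡) = trans b≡ (cong suc (breaks≡ s))
      Δ>0     (stretch-apart _ s con ¬com x≡ b≡) = Δ>0 s
      atLeast (stretch-apart r s con ¬com x≡ b≡) nice p q =
        subst (_≤ᴿ _) (addΓ _ _ _ _) (≤ᴿ-trans (⊕-monoˡ-≤ Δ̄ (atLeast s nice p r)) (proj₁ (gap-apart nice r q con ¬com)))
      exactly (stretch-apart _ s con ¬com x≡ b≡) _ ()
      -- Up to d the stretch is rigid, so its width is known exactly, and validity makes the first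
      -- break strict.
      above   (stretch-apart {b = zero}  r s con ¬com x≡ b≡) nice _ p q =
        subst (_<ᴿ _) (exactly s nice refl p r) (proj₂ (gap-apart nice r q con ¬com))
      above   (stretch-apart {b = suc b} r s con ¬com x≡ b≡) nice _ p q =
        <ᴿ-trans (above s nice (λ ()) p r) (proj₂ (gap-apart nice r q con ¬com))

      stretch : ∀ t (p q : Fin (length (π t))) d → toℕ q ≡ d + toℕ p →
                ∃[ a ] ∃[ b ] (a + b ≡ d × Stretch t (lookup (π t) p) (lookup (π t) q) a b)
      stretch t p q zero q≡ rewrite toℕ-injective {i = q} {p} q≡ = 0 , 0 , refl , stretch-refl t _
      stretch t p q (suc d) q≡ = go (stretch t p r d (toℕ-fromℕ< r<)) (step t r q q≡sr)
        where
        r< : d + toℕ p < length (π t)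
        r< = <-trans (≤-reflexive (sym q≡)) (toℕ<n q)
        r = fromℕ< r<
        q≡sr : toℕ q ≡ suc (toℕ r)
        q≡sr = trans q≡ (cong suc (sym (toℕ-fromℕ< r<)))
        con : Consecutive t (lookup (π t) r) (lookup (π t) q)
        con = r , q , q≡sr , refl , refl
        go : ∃[ a ] ∃[ b ] (a + b ≡ d × Stretch t (lookup (π t) p) (lookup (π t) r) a b) →
             Step (X t (lookup (π t) r)) (X t (lookup (π t) q)) (B t (lookup (π t) r)) (B t (lookup (π t) q))
                  (CommonMeeting t (lookup (π t) r) (lookup (π t) q)) →
             ∃[ a ] ∃[ b ] (a + b ≡ suc d × Stretch t (lookup (π t) p) (lookup (π t) q) a b)
        go (a , b , ab , s) (inj₁ (com , x≡ , b≡)) =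
          suc a , b , cong suc ab , stretch-together (active t r) s con com x≡ b≡
        go (a , b , ab , s) (inj₂ (¬com , x≡ , b≡)) =
          a , suc b , trans (+-suc a b) (cong suc ab) , stretch-apart (active t r) s con ¬com x≡ b≡

      stretch-< : ∀ t (p q : Fin (length (π t))) → toℕ p < toℕ q →
                  ∃[ a ] ∃[ b ] (a + b ≢ 0 × b ≤ n × Stretch t (lookup (π t) p) (lookup (π t) q) a b)
      stretch-< t p q p<q with stretch t p q (toℕ q ∸ toℕ p) (sym (m∸n+n≡m (<⇒≤ p<q)))
      ... | a , b , ab , s = a , b , (λ eq → m>n⇒m∸n≢0 p<q (trans (sym ab) eq)) ,
        ≤-trans (m≤n+m b a) (≤-trans (≤-reflexive ab) (≤-trans (m∸n≤m (toℕ q) (toℕ p))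
          (≤-trans (<⇒≤ (toℕ<n q)) (length≤n t)))) , s

      width-pos : ∀ a b → a + b ≢ 0 → (a ≢ 0 → 0# <ᴿ Δ) → 0# <ᴿ a · Δ ⊕ b · Γ
      width-pos zero    zero    ab≢0 _  = contradiction refl ab≢0
      width-pos zero    (suc b) _    _  = subst (0# <ᴿ_) (sym (⊕-identityˡ _)) (·-pos b Γ-pos)
      width-pos (suc a) b       _    Δ+ = <-≤ᴿ-trans (·-pos a (Δ+ λ ())) (subst (_≤ᴿ suc a · Δ ⊕ b · Γ) (⊕-identityʳ _)
        (⊕-monoʳ-≤ _ (·-nonneg b (<ᴿ⇒≤ᴿ Γ-pos))))

      packed-< : ∀ t (p q : Fin (length (π t))) → toℕ p < toℕ q → X t (lookup (π t) p) <ᴿ X t (lookup (π t) q)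
      packed-< t p q p<q with stretch-< t p q p<q
      ... | a , b , ab , _ , s = subst (_ <ᴿ_) (sym (packed≡ s)) (x<x⊕y _ (width-pos a b ab (Δ>0 s)))

      breaks-≤ : ∀ t (p q : Fin (length (π t))) → toℕ p < toℕ q → B t (lookup (π t) p) ≤ B t (lookup (π t) q)
      breaks-≤ t p q p<q with stretch-< t p q p<q
      ... | a , b , _ , _ , s = ≤-trans (m≤n+m _ b) (≤-reflexive (sym (breaks≡ s)))

      -- If Δ̄ ≤ 0 and the second stretch is not rigid, then a′ Δ < a Δ, hence a′ + 1 ≤ a, and the
      -- b′ ≤ n gaps of Δ / n fit into the remaining Δ.
      widths : ∀ {y} → Nice Δ Δ̄ y → ∀ {t t′ c c′ a a′ b′} → a ≢ 0 → b′ ≤ n →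
        (p : t ∈ˢ A c) (q : t ∈ˢ A c′) (p′ : t′ ∈ˢ A c) (q′ : t′ ∈ˢ A c′) →
        y t c p ≡ y t′ c p′ → y t c′ q ≡ y t′ c′ q′ →
        Stretch t c c′ a 0 → Stretch t′ c c′ a′ b′ → a′ · Δ ⊕ b′ · Γ ≤ᴿ a · Δ
      widths {y} nice {t} {t′} {c} {c′} {a} {a′} {b′} a≢0 b′≤n p q p′ q′ c≡ c′≡ s s′ = go gap-cases
        where
        v = y t c p
        rigid : y t′ c′ q′ ≡ v ⊕ a · Δ
        rigid = trans (sym c′≡) (exactly s nice refl p q)
        go : (0# <ᴿ Δ̄ × Γ ≡ Δ̄) ⊎ (Δ̄ ≤ᴿ 0# × 0# <ᴿ Δ × Γ ≡ Δ ⊗ (n · 1#) ⁻¹) ⊎ (Δ̄ ≤ᴿ 0# × Δ ≤ᴿ 0# × Γ ≡ 1#) →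
             a′ · Δ ⊕ b′ · Γ ≤ᴿ a · Δ
        go (inj₁ (_ , eq)) = subst (λ g → a′ · Δ ⊕ b′ · g ≤ᴿ a · Δ) (sym eq)
          (⊕-cancelˡ-≤ v (subst₂ _≤ᴿ_ (cong (_⊕ _) (sym c≡)) rigid (atLeast s′ nice p′ q′)))
        go (inj₂ (inj₂ (_ , Δ≤0 , _))) = contradiction (Δ>0 s a≢0) Δ≤0
        go (inj₂ (inj₁ (_ , 0<Δ , eq))) with b′ ≟ 0
        ... | yes refl = ≤ᴿ-reflexive (trans (⊕-identityʳ _) (⊕-cancelˡ v _ _
                (trans (cong (_⊕ a′ · Δ) c≡) (trans (sym (exactly s′ nice refl p′ q′)) rigid))))
        ... | no b′≢0 = ≤ᴿ-trans (⊕-monoʳ-≤ (a′ · Δ)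
                (≤ᴿ-trans (·-monoˡ-≤ (<ᴿ⇒≤ᴿ Γ-pos) b′≤n)
                  (≤ᴿ-reflexive (trans (cong (n ·_) eq) (·-⊘ n Δ n≢0)))))
                (subst (_≤ᴿ a · Δ) (⊕-comm Δ (a′ · Δ)) (·-monoˡ-≤ {suc a′} {a} (<ᴿ⇒≤ᴿ 0<Δ) a′<a))
          where
          a′<a : a′ < a
          a′<a = ≰⇒> λ a≤a′ → ·-monoˡ-≤ (<ᴿ⇒≤ᴿ 0<Δ) a≤a′
            (⊕-cancelˡ-< v (subst₂ _<ᴿ_ (cong (_⊕ _) (sym c≡)) rigid (above s′ nice b′≢0 p′ q′)))

-- From the computed block ends to the gaps between neighbours.

module Steps (ℝ : RealField) (I : OrderedStoryline) (Δ Δ̄ : RealField.Carrier ℝ)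
             (σ : RealRAM.State ℝ) where
  open import Data.Nat using (_<_)
  open RealField ℝ using (_⊕_)
  open RealRAM ℝ
  open OrderedStoryline I
  open Storyline I
  open Preparation ℝ I using (ix; Reaches)
  open Packing ℝ I σ using (far; total; broken; Entry)
  open Geometry ℝ I Δ Δ̄ using (Γ; Step; reaches⇔common)
  open Equivalence

  module _ (reach⇔ : ∀ t s x → x < nats σ reachᴬ (ix t (toℕ s)) ⇔ Reaches m t s x)
           (Δ≡ : reals σ 0 0 ≡ Δ) (Γ≡ : reals σ gapᴬ 0 ≡ Γ) where

    -- Again a running maximum is described by the numbers below it, so that each update becomes a
    -- union.
    far⇔ : ∀ t k → k ≤ n → ∀ x → x < far t k ⇔ (∃[ s ] (toℕ s < k × Reaches m t s x))
    far⇔ t zero    _   x = mk⇔ (λ ()) (λ { (_ , () , _) })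
    far⇔ t (suc k) k<n x = go (does (far t k <? nats σ reachᴬ (ix t k))) refl
      where
      s₀ = fromℕ< k<n
      s₀≡ = toℕ-fromℕ< k<n
      ih = far⇔ t k (<⇒≤ k<n) x
      here⇔ : x < nats σ reachᴬ (ix t k) ⇔ Reaches m t s₀ x
      here⇔ = subst (λ j → x < nats σ reachᴬ (ix t j) ⇔ Reaches m t s₀ x) s₀≡ (reach⇔ t s₀ x)
      old : x < far t k → ∃[ s ] (toℕ s < suc k × Reaches m t s x)
      old lt = let s , s<k , r = to ih lt in s , m<n⇒m<1+n s<k , r
      new : x < nats σ reachᴬ (ix t k) → ∃[ s ] (toℕ s < suc k × Reaches m t s x)
      new lt = s₀ , s≤s (≤-reflexive s₀≡) , to here⇔ lt
      either : ∃[ s ] (toℕ s < suc k × Reaches m t s x) → x < far t k ⊎ x < nats σ reachᴬ (ix t k)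
      either (s , s<sk , r) with m≤n⇒m<n∨m≡n (ℕ.s≤s⁻¹ s<sk)
      ... | inj₁ s<k = inj₁ (from ih (s , s<k , r))
      ... | inj₂ s≡k = inj₂ (from here⇔ (subst (λ s → Reaches m t s x) (toℕ-injective (trans s≡k (sym s₀≡))) r))
      go : ∀ b → does (far t k <? nats σ reachᴬ (ix t k)) ≡ b →
           x < (if b then nats σ reachᴬ (ix t k) else far t k) ⇔ (∃[ s ] (toℕ s < suc k × Reaches m t s x))
      go true  eq = mk⇔ new λ r → [ (λ lt → <-trans lt (does⇒ (far t k <? _) eq)) , (λ lt → lt) ]′ (either r)
      go false eq = mk⇔ old λ r → [ (λ lt → lt) , (λ lt → <-≤-trans lt (≮⇒≥ (does⇒¬ (far t k <? _) eq))) ]′ (either r)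

    joined⇔ : ∀ t (p q : Fin (length (π t))) → toℕ q ≡ suc (toℕ p) →
              toℕ q < far t (toℕ q) ⇔ CommonMeeting t (lookup (π t) p) (lookup (π t) q)
    joined⇔ t p q q≡ = mk⇔
      (λ lt → let s , s<q , r = to far′ lt in to common (s , ℕ.s≤s⁻¹ (subst (toℕ s <_) q≡ s<q) , r))
      (λ com → let s , s≤p , r = from common com in from far′ (s , subst (toℕ s <_) (sym q≡) (s≤s s≤p) , r))
      where
      far′ = far⇔ t (toℕ q) (≤-trans (<⇒≤ (toℕ<n q)) (length≤n t)) (toℕ q)
      common = reaches⇔common t p q q≡

    step : ∀ τ → (∀ t p → Entry τ t p) → ∀ t (p q : Fin (length (π t))) → toℕ q ≡ suc (toℕ p) →
      Step (reals τ packedᴬ (ix t (toℕ (lookup (π t) p)))) (reals τ packedᴬ (ix t (toℕ (lookup (π t) q))))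
           (nats τ breaksᴬ (ix t (toℕ (lookup (π t) p)))) (nats τ breaksᴬ (ix t (toℕ (lookup (π t) q))))
           (CommonMeeting t (lookup (π t) p) (lookup (π t) q))
    step τ entry t p q q≡ with entry t p | entry t q
    -- `Entry` relates position p to index p + 1, which is q; so the step from p to q is one
    -- unfolding of `total` and `broken`.
    ... | xp , bp | xq , bq
      rewrite trans xp (cong (total t) (sym q≡)) | xq | trans bp (cong (broken t) (sym q≡)) | bq = go (does (toℕ q <? far t (toℕ q))) refl
      where
      go : ∀ b → does (toℕ q <? far t (toℕ q)) ≡ b →
        Step (total t (toℕ q)) (if b then total t (toℕ q) ⊕ reals σ 0 0 else total t (toℕ q) ⊕ reals σ gapᴬ 0)
             (broken t (toℕ q)) (if b then broken t (toℕ q) else suc (broken t (toℕ q)))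
             (CommonMeeting t (lookup (π t) p) (lookup (π t) q))
      go true  eq = inj₁ (to (joined⇔ t p q q≡) (does⇒ (toℕ q <? _) eq) , cong (total t (toℕ q) ⊕_) Δ≡ , refl)
      go false eq = inj₂ ((λ com → does⇒¬ (toℕ q <? _) eq (from (joined⇔ t p q q≡) com)) , cong (total t (toℕ q) ⊕_) Γ≡ , refl)

-- Characters without wiggle are pairwise adjacent.

module Completeness (ℝ : RealField) (I : OrderedStoryline) (Δ Δ̄ : RealField.Carrier ℝ)
                    (σ : RealRAM.State ℝ) where
  open import Data.Nat using (_<_)
  open RealField ℝ renaming (_<_ to _<ᴿ_; _≤ᴿ_ to infix 4 _≤ᴿ_)
  open RealProperties ℝ
  open OrderedStoryline I
  open Coordinations ℝ I
  open Chains ℝ I σ using (packed; breaks; dist; Edge; EdgeAt; edgeAt)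
  open Geometry ℝ I Δ Δ̄

  position : ∀ {t c} → t ∈ˢ A c → ∃[ p ] lookup (π t) p ≡ c
  position a = index (∈-π a) , sym (lookup-index (∈-π a))

  module _ (first : Fin ℓ) (first≡0 : toℕ first ≡ 0) where
    constant : ∀ {y c} ((a , _) : NoWiggle y c) → ∀ t → y first c (a first) ≡ y t c (a t)
    constant {y} {c} (a , still) t = go (toℕ t) t refl
      where
      go : ∀ k t → toℕ t ≡ k → y first c (a first) ≡ y t c (a t)
      go zero    t t≡ rewrite toℕ-injective {i = t} {first} (trans t≡ (sym first≡0)) = refl
      go (suc k) t t≡ = trans (go k s (toℕ-fromℕ< k<ℓ)) (still s t (trans t≡ (cong suc (sym (toℕ-fromℕ< k<ℓ)))))
        where
        k<ℓ = <-trans (≤-reflexive (sym t≡)) (toℕ<n t)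
        s = fromℕ< k<ℓ

    module _ (n≢0 : n ≢ 0)
             (Δ-pos : ∀ t c c′ → Consecutive t c c′ → CommonMeeting t c c′ → 0# <ᴿ Δ)
             (step : ∀ t (p q : Fin (length (π t))) → toℕ q ≡ suc (toℕ p) →
               Step (packed (toℕ t) (lookup (π t) p)) (packed (toℕ t) (lookup (π t) q))
                    (breaks t (lookup (π t) p)) (breaks t (lookup (π t) q))
                    (CommonMeeting t (lookup (π t) p) (lookup (π t) q))) where
      open Packed n≢0 Δ-pos (λ t → packed (toℕ t)) breaks step

      -- Constant coordinates keep the order of the first time step, so a stretch leads from c to c′
      -- at every t. If it is rigid at some t, the constant distance is i · Δ, and `widths` bounds
      -- all packed distances by it.
      noWiggle⇒edge : ∀ {y c c′} → Nice Δ Δ̄ y → NoWiggle y c → NoWiggle y c′ → c ≺[ first ] c′ → Edge c c′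
      noWiggle⇒edge {y} {c} {c′} nice nw@(a , _) nw′@(a′ , _) c≺c′ t =
        edgeAt (a t) (a′ t) (subst (breaks t c ≤_) (sym (Stretch.breaks≡ (proj₂ (proj₂ (proj₂ (proj₂ (ends t))))))) (m≤n+m _ _))
          (tight (ends t))
        where
        y<y′ : ∀ t → y t c (a t) <ᴿ y t c′ (a′ t)
        y<y′ t = subst₂ _<ᴿ_ (constant {y} nw t) (constant {y} nw′ t) (Nice.valid nice first c c′ (a first) (a′ first) c≺c′)
        same : ∀ {t d d′} → d ≡ d′ → ∀ p p′ → y t d p ≡ y t d′ p′
        same refl _ _ = refl
        ends : ∀ t → ∃[ i ] ∃[ b ] (i + b ≢ 0 × b ≤ n × Stretch t c c′ i b)
        ends t with position (a t) | position (a′ t)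
        ... | p , refl | q , refl with <-cmp (toℕ p) (toℕ q)
        ...   | tri< p<q _ _ = stretch-< t p q p<q
        ...   | tri≈ _ p≡q _ = contradiction (y<y′ t)
                  (≤ᴿ-reflexive (same (cong (lookup (π t)) (toℕ-injective (sym p≡q))) (a′ t) (a t)))
        ...   | tri> _ _ q<p = contradiction (y<y′ t)
                  (<ᴿ⇒≤ᴿ (Nice.valid nice t c′ c (a′ t) (a t) (q , p , q<p , refl , refl)))
        width : ∀ {t i b} → Stretch t c c′ i b → packed (toℕ t) c′ ⊖ packed (toℕ t) c ≡ i · Δ ⊕ b · Γ
        width s = ⊖-unique (trans (⊕-comm _ _) (sym (Stretch.packed≡ s)))
        tight : ∃[ i ] ∃[ b ] (i + b ≢ 0 × b ≤ n × Stretch t c c′ i b) →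
                breaks t c ≡ breaks t c′ → dist c c′ ≤ᴿ packed (toℕ t) c′ ⊖ packed (toℕ t) c
        tight (i , suc b , _ , _ , s) eq =
          contradiction (trans eq (Stretch.breaks≡ s)) (<⇒≢ (s≤s (m≤n+m _ b)))
        -- The base 0 of `dist` needs 0 ≤ i · Δ; as i is not 0, Δ is positive.
        tight (i , zero , i≢0 , _ , s) _ = subst (dist c c′ ≤ᴿ_) (sym (trans (width s) (⊕-identityʳ _)))
          (sup-least ℓ (·-nonneg i (<ᴿ⇒≤ᴿ (Stretch.Δ>0 s (i≢0 ∘ trans (+-identityʳ i)))))
            λ j<ℓ _ → subst (λ j → packed j c′ ⊖ packed j c ≤ᴿ i · Δ) (toℕ-fromℕ< j<ℓ) (bound (fromℕ< j<ℓ)))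
          where
          bound : ∀ t′ → packed (toℕ t′) c′ ⊖ packed (toℕ t′) c ≤ᴿ i · Δ
          bound t′ with ends t′
          ... | i′ , b′ , _ , b′≤n , s′ = subst (_≤ᴿ i · Δ) (sym (width s′))
            (widths nice (i≢0 ∘ trans (+-identityʳ i)) b′≤n (a t) (a′ t) (a t′) (a′ t′)
              (trans (sym (constant {y} nw t)) (constant {y} nw t′))
              (trans (sym (constant {y} nw′ t)) (constant {y} nw′ t′)) s s′)

-- Realising a path by a nice coordination.

module Soundness (ℝ : RealField) (I : OrderedStoryline) (Δ Δ̄ : RealField.Carrier ℝ)
                 (σ : RealRAM.State ℝ) where
  open import Data.Nat using (_<_)
  open RealField ℝ renaming (_<_ to _<ᴿ_; _≤ᴿ_ to infix 4 _≤ᴿ_)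
  open RealRAM ℝ
  open RealProperties ℝ
  open OrderedStoryline I
  open Coordinations ℝ I
  open Preparation ℝ I using (ix)
  open Placement ℝ I σ using (low; shift; placed)
  open Tracing ℝ {n} σ using (Marking)
  open Geometry ℝ I Δ Δ̄

  X : Fin ℓ → Fin n → Carrier
  X t c = reals σ packedᴬ (ix t (toℕ c))

  B : Fin ℓ → Fin n → ℕ
  B t c = nats σ breaksᴬ (ix t (toℕ c))

  offset : Fin ℓ → Fin n → Carrier
  offset t c = reals σ heightᴬ (toℕ c) ⊖ X t c

  infix 4 _≼_
  -- The equality at equal breaks matters because `shift t c` is a maximum that includes later path
  -- characters with as many breaks as c, and these must not push c away from its height.
  _≼_ : Fin n → Fin n → Set
  c ≼ c′ = ∀ t → B t c ≤ B t c′ × offset t c ≤ᴿ offset t c′ × (B t c ≡ B t c′ → offset t c ≡ offset t c′)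

  -- Equal breaks at both ends are squeezed onto the middle character, so the two equalities of
  -- offsets chain.
  ≼-trans : ∀ {a b c} → a ≼ b → b ≼ c → a ≼ c
  ≼-trans {a} {b} {c} a≼b b≼c t with a≼b t | b≼c t
  ... | B₁ , o₁ , e₁ | B₂ , o₂ , e₂ = ≤-trans B₁ B₂ , ≤ᴿ-trans o₁ o₂ , λ eq →
    trans (e₁ (≤-antisym B₁ (subst (B t b ≤_) (sym eq) B₂))) (e₂ (≤-antisym B₂ (subst (_≤ B t b) eq B₁)))

  -- More breaks admit more marked characters into the maximum.
  shift-mono : ∀ t {c d} → B t c ≤ B t d → shift t c ≤ᴿ shift t d
  shift-mono t {c} {d} B≤ = sup-least n (sup-base n) λ {e} e<n g →
    sup-upper {g = λ e → does (nats σ breaksᴬ (ix t e) ∸ B t d <? nats σ markᴬ e)} e<n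
      (does-yes (_ <? _) (≤-<-trans (∸-monoʳ-≤ (nats σ breaksᴬ (ix t e)) B≤) (does⇒ (_ <? nats σ markᴬ e) g)))

  module _ (xs : List (Fin n)) (marking : Marking σ xs) (ordered : AllPairs _≼_ xs) where

    -- The marked characters in the maximum either precede c in `_≼_`, so their offsets are no
    -- larger, or follow it with equally many breaks and hence the same offset. The character c
    -- itself takes part, and the base is below all marked offsets.
    shift-marked : ∀ t {c} → c ∈ xs → shift t c ≡ offset t c
    shift-marked t {c} c∈ = ≤ᴿ-antisym
        (sup-least n base λ {e} e<n g → subst (λ e → reals σ heightᴬ e ⊖ reals σ packedᴬ (ix t e) ≤ᴿ offset t c)
          (toℕ-fromℕ< e<n) (other (fromℕ< e<n)
            (subst (λ e → nats σ breaksᴬ (ix t e) ∸ B t c < nats σ markᴬ e) (sym (toℕ-fromℕ< e<n)) (does⇒ (_ <? nats σ markᴬ e) g))))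
        (sup-upper {g = λ e → does (nats σ breaksᴬ (ix t e) ∸ B t c <? nats σ markᴬ e)} (toℕ<n c)
          (does-yes (_ <? _) (subst₂ _<_ (sym (n∸n≡0 (B t c))) (sym (marked c∈)) (s≤s z≤n))))
      where
      marked : ∀ {d} → d ∈ xs → nats σ markᴬ (toℕ d) ≡ 1
      marked {d} d∈ with marking d
      ... | inj₁ (m1 , _)  = m1
      ... | inj₂ (_ , d∉) = contradiction d∈ d∉
      base : 0# ⊖ low t ≤ᴿ offset t c
      base = subst₂ _≤ᴿ_ (sym (⊕-identityˡ _)) (neg-⊖ (X t c) _)
        (neg-anti-≤ (sup-upper {g = λ e → does (0 <? nats σ markᴬ e)} (toℕ<n c)
          (does-yes (_ <? _) (subst (0 <_) (sym (marked c∈)) (s≤s z≤n)))))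
      other : ∀ d → B t d ∸ B t c < nats σ markᴬ (toℕ d) → offset t d ≤ᴿ offset t c
      other d lt with marking d
      ... | inj₂ (m0 , _) = contradiction (subst (B t d ∸ B t c <_) m0 lt) λ ()
      ... | inj₁ (m1 , d∈) with allPairs-∈ ordered d∈ c∈
      ...   | inj₁ refl       = ≤ᴿ-refl
      ...   | inj₂ (inj₁ d≼c) = proj₁ (proj₂ (d≼c t))
      ...   | inj₂ (inj₂ c≼d) with c≼d t
      ...     | B≤ , _ , eq = ≤ᴿ-reflexive (sym (eq (≤-antisym B≤
                  (m∸n≡0⇒m≤n (n<1⇒n≡0 (subst (B t d ∸ B t c <_) m1 lt))))))

    placed-marked : ∀ t {c} → c ∈ xs → placed t c ≡ reals σ heightᴬ (toℕ c)
    placed-marked t {c} c∈ = trans (cong (X t c ⊕_) (shift-marked t c∈)) (trans (⊕-comm _ _) (⊖-⊕ _ _))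

    module _ (n≢0 : n ≢ 0)
             (Δ-pos : ∀ t c c′ → Consecutive t c c′ → CommonMeeting t c c′ → 0# <ᴿ Δ)
             (step : ∀ t (p q : Fin (length (π t))) → toℕ q ≡ suc (toℕ p) →
               Step (X t (lookup (π t) p)) (X t (lookup (π t) q))
                    (B t (lookup (π t) p)) (B t (lookup (π t) q))
                    (CommonMeeting t (lookup (π t) p) (lookup (π t) q)))
             (y : Coordination) (y≡ : ∀ t c .(a : t ∈ˢ A c) → y t c a ≡ placed t c) where
      open Packed n≢0 Δ-pos X B step

      placed-valid : Valid y
      placed-valid t c c′ p q (i , j , i<j , refl , refl) = subst₂ _<ᴿ_ (sym (y≡ t c p)) (sym (y≡ t c′ q))
        (⊕-mono-<-≤ (packed-< t i j i<j) (shift-mono t (breaks-≤ t i j i<j)))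

      -- Within a meeting the number of breaks, and with it the shift, stays the same, so the packed
      -- gap Δ survives. Across a break the shift can only grow, so the gap stays at least Γ.
      placed-nice : Nice Δ Δ̄ y
      Nice.valid    placed-nice = placed-valid
      Nice.together placed-nice t c c′ p q con@(i , j , j≡ , refl , refl) com with step t i j j≡
      ... | inj₂ (¬com , _) = contradiction com ¬com
      ... | inj₁ (_ , x≡ , b≡) = trans (cong abs diff) (abs-nonneg (<ᴿ⇒≤ᴿ (Δ-pos t c c′ con com)))
        where
        diff : y t c′ q ⊖ y t c p ≡ Δ
        diff = ⊖-unique (begin
          Δ ⊕ y t c p               ≡⟨ cong (Δ ⊕_) (y≡ t c p) ⟩
          Δ ⊕ (X t c ⊕ shift t c)   ≡⟨ ⊕-assoc Δ _ _ ⟨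
          (Δ ⊕ X t c) ⊕ shift t c   ≡⟨ cong₂ _⊕_ (trans (⊕-comm Δ _) (sym x≡))
                                         (≤ᴿ-antisym (shift-mono t (≤-reflexive (sym b≡))) (shift-mono t (≤-reflexive b≡))) ⟩
          X t c′ ⊕ shift t c′       ≡⟨ y≡ t c′ q ⟨
          y t c′ q                  ∎)
          where open ≡-Reasoning
      Nice.apart    placed-nice t c c′ p q (i , j , j≡ , refl , refl) ¬com with step t i j j≡
      ... | inj₁ (com , _) = contradiction com ¬com
      ... | inj₂ (_ , x≡ , b≡) = subst (Δ̄ ≤ᴿ_) (sym (abs-nonneg (<ᴿ⇒≤ᴿ (x<y⇒0<y⊖x lt)))) bound
        where
        lt : y t c p <ᴿ y t c′ q
        lt = placed-valid t c c′ p q (i , j , ≤-reflexive (sym j≡) , refl , refl)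
        raised : Γ ⊕ y t c p ≤ᴿ y t c′ q
        raised = subst₂ _≤ᴿ_ (trans (cong (_⊕ shift t c) (trans x≡ (⊕-comm _ Γ)))
                               (trans (⊕-assoc Γ _ _) (cong (Γ ⊕_) (sym (y≡ t c p)))))
                             (sym (y≡ t c′ q))
          (⊕-monoʳ-≤ (X t c′) (shift-mono t (subst (B t c ≤_) (sym b≡) (n≤1+n _))))
        bound : Δ̄ ≤ᴿ y t c′ q ⊖ y t c p
        bound = ≤ᴿ-trans (Δ̄≤Γ n≢0) (subst (_≤ᴿ y t c′ q ⊖ y t c p) (⊕-⊖ Γ (y t c p)) (⊕-monoˡ-≤ (neg (y t c p)) raised))

-- The whole program and its correctness.

pipeline : Cmd
pipeline =
  computeRows ⨟ computeReach ⨟ computeGap ⨟ computePacked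
  ⨟ computeLongest ⨟ selectBest ⨟ traceChain ⨟ placeAll

-- Opaque, as Agda would otherwise compare multiples of this large literal in unary.
opaque
  pipelineFactor : ℕ
  pipelineFactor = factor pipeline

  unfold-factor : ∀ c s → c ≤ factor pipeline * s → c ≤ pipelineFactor * s
  unfold-factor _ _ c≤ = c≤

module Correctness (ℝ : RealField) (I : OrderedStoryline) (Δ Δ̄ : RealField.Carrier ℝ) where
  open import Data.Nat using (_<_)
  open RealField ℝ renaming (_<_ to _<ᴿ_; _≤ᴿ_ to infix 4 _≤ᴿ_)
  open RealRAM ℝ
  open LoopPrograms ℝ
  open RealProperties ℝ
  open Memory ℝ
  open OrderedStoryline I
  open Storyline I
  open Coordinations ℝ I
  open Preparation ℝ I
  open Geometry ℝ I Δ Δ̄ using (∈-π; active; Step; step-cong; Γ)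
  open Equivalence

  σ₀ : State
  σ₀ = input I Δ Δ̄

  -- The intermediate states are variables, as unfolding them is infeasible.
  module Stages (σ₁ σ₂ σ₃ σ₄ σ₅ σ₆ σ₇ σ₈ : State)
    (e₁ : exec computeRows σ₀ ≡ σ₁) (e₂ : exec computeReach σ₁ ≡ σ₂)
    (e₃ : exec computeGap σ₂ ≡ σ₃) (e₄ : exec computePacked σ₃ ≡ σ₄)
    (e₅ : exec computeLongest σ₄ ≡ σ₅) (e₆ : exec selectBest σ₅ ≡ σ₆)
    (e₇ : exec traceChain σ₆ ≡ σ₇) (e₈ : exec placeAll σ₇ ≡ σ₈) where

    F₁ : Frame computeRows σ₀ σ₁
    F₁ = subst (Frame _ _) e₁ (frame computeRows σ₀)
    G₂ : Frame computeReach σ₁ σ₂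
    G₂ = subst (Frame _ _) e₂ (frame computeReach σ₁)
    G₃ : Frame computeGap σ₂ σ₃
    G₃ = subst (Frame _ _) e₃ (frame computeGap σ₂)
    G₄ : Frame computePacked σ₃ σ₄
    G₄ = subst (Frame _ _) e₄ (frame computePacked σ₃)
    G₅ : Frame computeLongest σ₄ σ₅
    G₅ = subst (Frame _ _) e₅ (frame computeLongest σ₄)
    G₆ : Frame selectBest σ₅ σ₆
    G₆ = subst (Frame _ _) e₆ (frame selectBest σ₅)
    G₇ : Frame traceChain σ₆ σ₇
    G₇ = subst (Frame _ _) e₇ (frame traceChain σ₆)

    F₂ = frame-⨟ F₁ G₂
    F₃ = frame-⨟ F₂ G₃
    F₄ = frame-⨟ F₃ G₄
    F₅ = frame-⨟ F₄ G₅
    F₆ = frame-⨟ F₅ G₆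
    F₇ = frame-⨟ F₆ G₇
    G₂₃ = frame-⨟ G₂ G₃
    G₆₇ = frame-⨟ G₆ G₇
    G₅₇ = frame-⨟ G₅ G₆₇

    row₁ : ∀ t → nats σ₁ rowᴬ (toℕ t) ≡ toℕ t * n
    row₁ t = trans (cong (λ σ → nats σ rowᴬ (toℕ t)) (sym e₁)) (rows-spec σ₀ refl refl refl (toℕ t) (<⇒≤ (toℕ<n t)))

    row₃ : ∀ t → nats σ₃ rowᴬ (toℕ t) ≡ toℕ t * n
    row₃ t = trans (frameᴺ G₂₃ rowᴬ _) (row₁ t)

    row₄ : ∀ t → nats σ₄ rowᴬ (toℕ t) ≡ toℕ t * n
    row₄ t = trans (frameᴺ G₄ rowᴬ _) (row₃ t)

    row₇ : ∀ t → nats σ₇ rowᴬ (toℕ t) ≡ toℕ t * n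
    row₇ t = trans (frameᴺ G₅₇ rowᴬ _) (row₄ t)

    reach₃ : ∀ t s x → x < nats σ₃ reachᴬ (ix t (toℕ s)) ⇔ Reaches m t s x
    reach₃ t s x = subst (λ r → x < r ⇔ Reaches m t s x) (sym (trans (frameᴺ G₃ reachᴬ _) (cong (λ σ → nats σ reachᴬ (ix t (toℕ s))) (sym e₂))))
      (reach-spec σ₁ row₁ (frameᴺ F₁ 0 2)
        (λ M → trans (frameᴺ F₁ timeᴬ _) (array-entry 0 (toℕ ∘ tm) M))
        (λ M → trans (frameᴺ F₁ startᴬ _) (array-entry 0 meetingStart M))
        (λ M → trans (frameᴺ F₁ sizeᴬ _) (array-entry 0 meetingSize M))
        (λ j → frameᴺ F₁ reachᴬ j) t s x)

    Γ₃ : reals σ₃ gapᴬ 0 ≡ Γ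
    Γ₃ = trans (trans (cong (λ σ → reals σ gapᴬ 0) (sym e₃)) (gap-spec σ₂ (frameᴺ F₂ 0 0) (frameᴿ F₂ unitsᴬ 0)))
               (cong₂ effectiveGap (frameᴿ F₂ 0 0) (frameᴿ F₂ 0 1))

    count₀ : ∀ t → inputNats I countᴬ (toℕ t) ≡ length (π t)
    count₀ = array-entry 0 (length ∘ π)

    order₀ : ∀ t (p : Fin (length (π t))) → inputNats I orderᴬ (ix t (toℕ p)) ≡ toℕ (lookup (π t) p)
    order₀ t p = trans (cong (λ j → inputNats I orderᴬ (ix t j)) (sym p≡))
      (trans (matrix-entry 0 (λ t i → array 0 (toℕ ∘ lookup (π t)) (toℕ i)) t (fromℕ< p<n))
        (trans (cong (array 0 (toℕ ∘ lookup (π t))) p≡) (array-entry 0 (toℕ ∘ lookup (π t)) p)))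
      where
      p<n = <-≤-trans (toℕ<n p) (length≤n t)
      p≡ = toℕ-fromℕ< p<n

    entry₄ : ∀ t p → Packing.Entry ℝ I σ₃ σ₄ t p
    entry₄ t p = subst (λ τ → Packing.Entry ℝ I σ₃ τ t p) e₄ (Packing.packed-spec ℝ I σ₃ row₃ (frameᴺ F₃ 0 0) (frameᴺ F₃ 0 1)
      (λ t → trans (frameᴺ F₃ countᴬ _) (count₀ t)) (λ t p → trans (frameᴺ F₃ orderᴬ _) (order₀ t p)) t p)

    module C = Chains ℝ I σ₄

    step₄ : ∀ t (p q : Fin (length (π t))) → toℕ q ≡ suc (toℕ p) →
      Step (C.packed (toℕ t) (lookup (π t) p)) (C.packed (toℕ t) (lookup (π t) q))
           (C.breaks t (lookup (π t) p)) (C.breaks t (lookup (π t) q))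
           (CommonMeeting t (lookup (π t) p) (lookup (π t) q))
    step₄ = Steps.step ℝ I Δ Δ̄ σ₃ reach₃ (frameᴿ F₃ 0 0) Γ₃ σ₄ entry₄

    active₄ : ∀ t c → nats σ₄ activeᴬ (toℕ t * n + toℕ c) ≡ (if does (t ∈? A c) then 1 else 0)
    active₄ t c = trans (frameᴺ F₄ activeᴬ _) (matrix-entry 0 (λ t c → if does (t ∈? A c) then 1 else 0) t c)

    n₄ : nats σ₄ 0 0 ≡ n
    n₄ = frameᴺ F₄ 0 0

    ℓ₄ : nats σ₄ 0 1 ≡ ℓ
    ℓ₄ = frameᴺ F₄ 0 1

    module S = Selection ℝ I σ₄

    fixed₅ : S.Fixed row₄ n₄ ℓ₄ active₄ σ₅
    fixed₅ = agree-frame G₅ agree-refl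

    rest₅ : nats σ₅ restᴬ 0 ≡ 0
    rest₅ = frameᴺ F₅ restᴬ 0

    depth : Fin n → ℕ
    depth c = nats σ₅ depthᴬ (toℕ c)

    selected : S.Selected row₄ n₄ ℓ₄ active₄ σ₅ fixed₅ rest₅ n σ₆
    selected = subst (S.Selected row₄ n₄ ℓ₄ active₄ σ₅ fixed₅ rest₅ n) e₆ (S.select-spec row₄ n₄ ℓ₄ active₄ σ₅ fixed₅ rest₅)

    -- All packed differences of c with itself vanish, so `dist c c` is 0 and tightness is
    -- automatic.
    active⇒edge : ∀ c → AlwaysActive c → C.Edge c c
    active⇒edge c a t = C.edgeAt (a t) (a t) ≤-refl λ _ →
      sup-least ℓ (≤ᴿ-reflexive (sym (-‿inverseʳ _))) λ _ _ →
        ≤ᴿ-reflexive (trans (-‿inverseʳ _) (sym (-‿inverseʳ _)))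

    open Soundness ℝ I Δ Δ̄ σ₇

    packed₇ : ∀ t c → X t c ≡ C.packed (toℕ t) c
    packed₇ t c = frameᴿ G₅₇ packedᴬ _

    breaks₇ : ∀ t c → B t c ≡ C.breaks t c
    breaks₇ t c = frameᴺ G₅₇ breaksᴬ _

    step₇ : ∀ t (p q : Fin (length (π t))) → toℕ q ≡ suc (toℕ p) →
      Step (X t (lookup (π t) p)) (X t (lookup (π t) q)) (B t (lookup (π t) p)) (B t (lookup (π t) q))
           (CommonMeeting t (lookup (π t) p) (lookup (π t) q))
    step₇ t p q q≡ = step-cong (packed₇ t _) (packed₇ t _) (breaks₇ t _) (breaks₇ t _) (step₄ t p q q≡)

    -- The offset of c exceeds that of b by `dist b c` minus the packed distance at t. This is
    -- nonnegative because `dist` is a maximum, and zero where the edge is tight.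
    edge⇒≼ : ∀ {b c} → C.Edge b c →
             reals σ₅ heightᴬ (toℕ c) ≡ reals σ₅ heightᴬ (toℕ b) ⊕ C.dist b c → b ≼ c
    edge⇒≼ {b} {c} e h t =
      subst₂ _≤_ (sym (breaks₇ t b)) (sym (breaks₇ t c)) (C.EdgeAt.ordered (e t)) ,
      subst₂ _≤ᴿ_ (sym left) (sym right) (⊕-monoˡ-≤ _ (⊕-monoʳ-≤ H D≤)) ,
      (λ B≡ → trans left (trans (cong (λ d → (H ⊕ d) ⊖ X t c)
          (≤ᴿ-antisym D≤ (subst (C.dist b c ≤ᴿ_) (sym D≡)
            (C.EdgeAt.tight (e t) (trans (sym (breaks₇ t b)) (trans B≡ (breaks₇ t c))))))) (sym right)))
      where
      H = reals σ₅ heightᴬ (toℕ b)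
      D = X t c ⊖ X t b
      height₇ : ∀ d → reals σ₇ heightᴬ (toℕ d) ≡ reals σ₅ heightᴬ (toℕ d)
      height₇ d = frameᴿ G₆₇ heightᴬ _
      D≡ : D ≡ C.packed (toℕ t) c ⊖ C.packed (toℕ t) b
      D≡ = cong₂ _⊖_ (packed₇ t c) (packed₇ t b)
      D≤ : D ≤ᴿ C.dist b c
      D≤ = subst (_≤ᴿ C.dist b c) (sym D≡)
        (sup-upper {g = λ _ → true} {f = λ t → C.packed t c ⊖ C.packed t b} (toℕ<n t) refl)
      left : offset t b ≡ (H ⊕ D) ⊖ X t c
      left = trans (cong (_⊖ X t b) (height₇ b)) (sym (⊖-unique
        (trans (⊕-assoc H _ _) (cong (H ⊕_) (⊕-comm _ (X t c))))))
      right : offset t c ≡ (H ⊕ C.dist b c) ⊖ X t c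
      right = cong (_⊖ X t c) (trans (height₇ c) h)

    module _ (n≢0 : n ≢ 0) (first : Fin ℓ) (first≡0 : toℕ first ≡ 0) where
      order₄ : ∀ p → nats σ₄ orderᴬ (toℕ p) ≡ toℕ (lookup (π first) p)
      order₄ p = trans (frameᴺ F₄ orderᴬ _)
        (trans (cong (λ t → inputNats I orderᴬ (t * n + toℕ p)) (sym first≡0)) (order₀ first p))

      count₄ : nats σ₄ countᴬ 0 ≡ length (π first)
      count₄ = trans (frameᴺ F₄ countᴬ 0) (trans (cong (inputNats I countᴬ) (sym first≡0)) (count₀ first))

      module L = C.Longest row₄ n₄ ℓ₄ active₄ (π first) (π-unique first) count₄ order₄

      longest : L.Inv n 0 σ₅
      longest = subst (L.Inv n 0) e₅ (L.longest-spec (frameᴺ F₄ depthᴬ))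

      depth-< : ∀ {p q : Fin (length (π first))} → toℕ p < toℕ q →
                C.Edge (lookup (π first) p) (lookup (π first) q) → depth (lookup (π first) p) < depth (lookup (π first) q)
      depth-< {p} {q} p<q = proj₁ longest p q p<q (inj₁ (<-≤-trans (toℕ<n q) (length≤n first)))

      link : ∀ c → AlwaysActive c → depth c ≡ 0 ⊎
        ∃[ b ] (nats σ₆ predᴬ (toℕ c) ≡ toℕ b × AlwaysActive b × depth c ≡ suc (depth b) × b ≼ c)
      link c a = subst Link (sym (lookup-index (∈-π (a first)))) (at-position (index (∈-π (a first))))
        where
        Link : Fin n → Set
        Link c = depth c ≡ 0 ⊎
          ∃[ b ] (nats σ₆ predᴬ (toℕ c) ≡ toℕ b × AlwaysActive b × depth c ≡ suc (depth b) × b ≼ c)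
        at-position : ∀ q → Link (lookup (π first) q)
        at-position q = [ inj₁ , (λ { (_ , p , l) → inj₂ (lookup (π first) p ,
            trans (frameᴺ G₆ predᴬ _) (L.LinkTo.pred≡ l) ,
            (λ t → C.EdgeAt.source (L.LinkTo.edge l t)) , L.LinkTo.depth≡ l ,
            edge⇒≼ (L.LinkTo.edge l) (L.LinkTo.height≡ l)) }) ]′ (proj₂ longest q)

      module Tr = Tracing ℝ {n} σ₆

      traced : ∃[ xs ] (AllPairs (Tr.Above (frameᴺ F₆ 0 0) (frameᴺ F₆ markᴬ) depth AlwaysActive _≼_ ≼-trans link) xs ×
                        All AlwaysActive xs × Tr.Marking σ₇ xs × length xs ≡ nats σ₆ restᴬ 0)
      traced = subst (λ τ → ∃[ xs ] (AllPairs (Tr.Above (frameᴺ F₆ 0 0) (frameᴺ F₆ markᴬ) depth AlwaysActive _≼_ ≼-trans link) xs ×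
                        All AlwaysActive xs × Tr.Marking τ xs × length xs ≡ nats σ₆ restᴬ 0)) e₇ (Tr.trace-spec (frameᴺ F₆ 0 0) (frameᴺ F₆ markᴬ) depth AlwaysActive _≼_ ≼-trans link
        ([ inj₁ , (λ { (c , b , e , r) → inj₂ (c , b , (λ t → C.EdgeAt.source (e t)) , r) }) ]′ (proj₂ selected)))

      xs : List (Fin n)
      xs = proj₁ traced

      xs-unique : Unique xs
      xs-unique = Tr.above⇒unique (frameᴺ F₆ 0 0) (frameᴺ F₆ markᴬ) depth AlwaysActive _≼_ ≼-trans link (proj₁ (proj₂ traced))

      xs-ordered : AllPairs _≼_ xs
      xs-ordered = AllPairs.map proj₂ (proj₁ (proj₂ traced))

      placed₈ : ∀ t c → reals σ₈ outᴬ (ix t (toℕ c)) ≡ Placement.placed ℝ I σ₇ t c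
      placed₈ t c = trans (cong (λ σ → reals σ outᴬ (ix t (toℕ c))) (sym e₈))
        (Placement.place-spec ℝ I σ₇ row₇ (frameᴺ F₇ 0 0) (frameᴺ F₇ 0 1) t c)

      y : Coordination
      y = output I σ₈

      y≡ : ∀ t c .(a : t ∈ˢ A c) → y t c a ≡ Placement.placed ℝ I σ₇ t c
      y≡ t c _ = trans (cong (reals σ₈ outᴬ) (toℕ-combine′ t c))
        (placed₈ t c)

      xs-noWiggle : ∀ {c} → c ∈ xs → NoWiggle y c
      xs-noWiggle {c} c∈ = All.lookup (proj₁ (proj₂ (proj₂ traced))) c∈ , λ t t′ _ → trans (at-height t) (sym (at-height t′))
        where
        at-height : ∀ t → reals σ₈ outᴬ (toℕ (combine t c)) ≡ reals σ₇ heightᴬ (toℕ c)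
        at-height t = trans (cong (reals σ₈ outᴬ) (toℕ-combine′ t c))
          (trans (placed₈ t c)
                 (placed-marked xs (proj₁ (proj₂ (proj₂ (proj₂ traced)))) xs-ordered t c∈))

      rest≤count : nats σ₆ restᴬ 0 ≤ noWiggleCount y
      rest≤count = subst (_≤ noWiggleCount y) (proj₂ (proj₂ (proj₂ (proj₂ traced))))
        (unique⊆⇒length≤ xs-unique λ {c} c∈ → ∈-filter⁺ (noWiggle? y) (∈-allFin c) (xs-noWiggle c∈))

      module _ (Δ-pos : ∀ t c c′ → Consecutive t c c′ → CommonMeeting t c c′ → 0# <ᴿ Δ) where
        open Completeness ℝ I Δ Δ̄ σ₄

        -- Listed along π₀, the characters without wiggle in z are adjacent in pairs, so their
        -- depths strictly increase. All of these depths lie below the selected value.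
        count≤rest : ∀ z → Nice Δ Δ̄ z → noWiggleCount z ≤ nats σ₆ restᴬ 0
        count≤rest z nice = ≤-trans
          (unique⊆⇒length≤ (Uniqueₚ.filter⁺ (noWiggle? z) (Uniqueₚ.allFin⁺ n)) λ {c} c∈ →
            let _ , nw = ∈-filter⁻ (noWiggle? z) {xs = allFin n} c∈ in
            ∈-filter⁺ (noWiggle? z) (∈-π (proj₁ nw first)) nw)
          (increasing⇒length≤ depth z≤n
            (allPairs-given noWiggles (AllPairsₚ.filter⁺ (noWiggle? z) (allPairs-lookup (π first) λ p q p<q nw nw′ →
              depth-< p<q (noWiggle⇒edge first first≡0 n≢0 Δ-pos step₄ nice nw nw′ (p , q , p<q , refl , refl)))))
            (All.map (λ {c} nw → z≤n , proj₁ selected c (toℕ<n c) (active⇒edge c (proj₁ nw))) noWiggles))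
          where
          noWiggles : All (NoWiggle z) (filter (noWiggle? z) (π first))
          noWiggles = all-filter (noWiggle? z) (π first)

        optimal : Optimal Δ Δ̄ y
        optimal = placed-nice xs (proj₁ (proj₂ (proj₂ (proj₂ traced)))) xs-ordered n≢0 Δ-pos step₇ y y≡ ,
                  λ z nice → ≤-trans (count≤rest z nice) rest≤count

  -- Validity makes the difference of the two neighbours positive, and niceness makes it equal to Δ.
  together⇒0<Δ : 0# <ᴿ Δ ⊎ ∃ (Nice Δ Δ̄) →
                 ∀ t c c′ → Consecutive t c c′ → CommonMeeting t c c′ → 0# <ᴿ Δ
  together⇒0<Δ (inj₁ 0<Δ) _ _ _ _ _ = 0<Δ
  together⇒0<Δ (inj₂ (y , nice)) t c c′ con@(i , j , j≡ , refl , refl) com =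
    subst (0# <ᴿ_) (trans (sym (abs-nonneg (<ᴿ⇒≤ᴿ width>0))) (Nice.together nice t c c′ p q con com)) width>0
    where
    p = active t i
    q = active t j
    width>0 : 0# <ᴿ y t c′ q ⊖ y t c p
    width>0 = x<y⇒0<y⊖x (Nice.valid nice t c c′ p q (i , j , ≤-reflexive (sym j≡) , refl , refl))

  -- Without a pair of a time step and a character, niceness is vacuous and every character is free
  -- of wiggles in any coordination.
  optimal-if-empty : (Fin ℓ → ¬ Fin n) → ∀ y → Optimal Δ Δ̄ y
  Nice.valid    (proj₁ (optimal-if-empty none y)) t c = contradiction c (none t)
  Nice.together (proj₁ (optimal-if-empty none y)) t c = contradiction c (none t)
  Nice.apart    (proj₁ (optimal-if-empty none y)) t c = contradiction c (none t)
  proj₂ (optimal-if-empty none y) z _ = unique⊆⇒length≤ (Uniqueₚ.filter⁺ (noWiggle? z) (Uniqueₚ.allFin⁺ n)) λ {c} _ →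
    ∈-filter⁺ (noWiggle? y) (∈-allFin c) ((λ t → contradiction c (none t)) , λ t → contradiction c (none t))

  optimal-output : n ≢ 0 → (first : Fin ℓ) → toℕ first ≡ 0 → 0# <ᴿ Δ ⊎ ∃ (Nice Δ Δ̄) →
                   Optimal Δ Δ̄ (output I (exec pipeline σ₀))
  optimal-output n≢0 first first≡0 ok = Stages.optimal _ _ _ _ _ _ _ _ refl refl refl refl refl refl refl
    refl n≢0 first first≡0 (together⇒0<Δ ok)

  cost-pipeline : 1 ≤ n → 1 ≤ ℓ → cost (nats σ₀ 0) pipeline ≤ pipelineFactor * (n * n * ℓ)
  cost-pipeline 1≤n 1≤ℓ = subst (λ s → cost (nats σ₀ 0) pipeline ≤ pipelineFactor * s) (square n ℓ)
      (unfold-factor _ _ (cost≤ n ℓ (nats σ₀ 0) 1≤n 1≤ℓ dims pipeline))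
    where
    square : ∀ n ℓ → (n * (n * 1)) * (ℓ * 1) ≡ n * n * ℓ
    square = solve-∀
    times4 : ∀ x → x ≤ 4 * x
    times4 x = m≤m+n x _
    dims : ∀ k → nats σ₀ 0 k ≤ 4 * monomial n ℓ (nats σ₀ 0) 1≤n 1≤ℓ (dimDegree k)
    dims 0 = ≤-trans (≤-reflexive (eq n)) (times4 _)
      where
      eq : ∀ n → n ≡ n * 1 * 1
      eq = solve-∀
    dims 1 = ≤-trans (≤-reflexive (eq ℓ)) (times4 _)
      where
      eq : ∀ ℓ → ℓ ≡ 1 * (ℓ * 1)
      eq = solve-∀
    -- From 1 ≤ n follows n + 1 ≤ n + n; its square is the origin of the factor 4.
    dims 2 = begin
      m                                ≤⟨ Meetings.meetings≤ I ⟩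
      ℓ * (suc n * suc n)              ≤⟨ *-monoʳ-≤ ℓ (*-mono-≤ (+-monoˡ-≤ n 1≤n) (+-monoˡ-≤ n 1≤n)) ⟩
      ℓ * ((n + n) * (n + n))          ≡⟨ eq n ℓ ⟩
      4 * ((n * (n * 1)) * (ℓ * 1))    ∎
      where
      open ≤-Reasoning
      eq : ∀ n ℓ → ℓ * ((n + n) * (n + n)) ≡ 4 * ((n * (n * 1)) * (ℓ * 1))
      eq = solve-∀
    dims (suc (suc (suc k))) = z≤n

-- The phases take at least ℓ steps even if n = 0 and at least n² even if ℓ = 0, which 1 + n² ℓ does
-- not bound; such instances have to be answered at once.
guarded : Program → Program
guarded p =
  `if `lit 0 `<ᴺ dim 0
  then (`if `lit 0 `<ᴺ dim 1 then p else `skip)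
  else `skip

-- Each guard test costs 4, and 9 = 4 + 4 + 1 also pays for leaving through the second test and
-- `skip`.
guard-cost : ∀ c f s → c ≤ f * s → 4 + (4 + c) ≤ (9 + f) * (1 + s)
guard-cost c f s c≤ = begin
  4 + (4 + c)              ≤⟨ +-monoʳ-≤ 4 (+-monoʳ-≤ 4 c≤) ⟩
  4 + (4 + f * s)          ≤⟨ m≤m+n _ (1 + 9 * s + f) ⟩
  4 + (4 + f * s) + (1 + 9 * s + f) ≡⟨ eq f s ⟩
  (9 + f) * (1 + s)        ∎
  where
  open ≤-Reasoning
  eq : ∀ f s → 4 + (4 + f * s) + (1 + 9 * s + f) ≡ (9 + f) * (1 + s)
  eq = solve-∀

skip-cost : ∀ f s → 9 ≤ (9 + f) * (1 + s)
skip-cost f s = *-mono-≤ {9} {9 + f} {1} {1 + s} (m≤m+n 9 f) (s≤s z≤n)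

module Guarded (ℝ : RealField) (I : OrderedStoryline) (Δ Δ̄ : RealField.Carrier ℝ) where
  open import Data.Nat using (_<_)
  open RealRAM ℝ
  open OrderedStoryline I

  Outcome : Program → State → ℕ → Set
  Outcome p σ bound = ∃[ k ] (⟨ p , input I Δ Δ̄ ⟩⇓⟨ σ , k ⟩) × k ≤ bound

  guarded-empty : ∀ p f s → ¬ (0 < n) ⊎ ¬ (0 < ℓ) → Outcome (guarded p) (input I Δ Δ̄) ((9 + f) * (1 + s))
  guarded-empty p f s (inj₁ n≮0) =
    5 , ifFalse⇓ (does-no (0 <? n) n≮0) skip⇓ , ≤-trans (m≤m+n 5 4) (skip-cost f s)
  guarded-empty p f s (inj₂ ℓ≮0) with 0 <? n
  ... | no  n≮0 = guarded-empty p f s (inj₁ n≮0)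
  ... | yes 0<n =
    9 , ifTrue⇓ (does-yes (0 <? n) 0<n) (ifFalse⇓ (does-no (0 <? ℓ) ℓ≮0) skip⇓) , skip-cost f s

  guarded-run : ∀ p σ f s → 0 < n → 0 < ℓ → Outcome p σ (f * s) → Outcome (guarded p) σ ((9 + f) * (1 + s))
  guarded-run p σ f s 0<n 0<ℓ (k , r , k≤) =
    4 + (4 + k) , ifTrue⇓ (does-yes (0 <? n) 0<n) (ifTrue⇓ (does-yes (0 <? ℓ) 0<ℓ) r) , guard-cost k f s k≤

  open LoopPrograms ℝ
  open Correctness ℝ I Δ Δ̄

  pipeline-run : 0 < n → 0 < ℓ → Outcome (compile pipeline) (exec pipeline σ₀) (pipelineFactor * (n * n * ℓ))
  pipeline-run 0<n 0<ℓ = widen (halts pipeline tt tt (nats σ₀ 0) σ₀ (λ _ → refl)) (cost-pipeline 0<n 0<ℓ)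
    where
    widen : ∀ {p σ b c} → Outcome p σ b → b ≤ c → Outcome p σ c
    widen (k , r , k≤) b≤c = k , r , ≤-trans k≤ b≤c

-- If Δ ≤ 0 and some neighbours share a meeting, no nice coordination exists, so optimality is
-- claimed when Δ is positive or a nice coordination exists; termination and the time bound are
-- unconditional. The summand 1 accounts for instances without characters or time steps.
theorem3 : (ℝ : RealField) →
  let open RealField ℝ
      open RealRAM ℝ
  in
  ∃[ p ] ∃[ K ]
    ((I : OrderedStoryline) (Δ Δ̄ : Carrier) →
      let open OrderedStoryline I
          open Coordinations ℝ I
      in
      ∃[ σ ] ∃[ k ]
        ((⟨ p , input I Δ Δ̄ ⟩⇓⟨ σ , k ⟩) ×
         k ≤ K * (1 + n * n * ℓ) ×
         (0# < Δ ⊎ ∃ (Nice Δ Δ̄) → Optimal Δ Δ̄ (output I σ))))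
theorem3 ℝ = guarded (compile pipeline) , 9 + pipelineFactor , solve
  where
  open RealField ℝ
  open RealRAM ℝ
  open LoopPrograms ℝ
  solve : (I : OrderedStoryline) (Δ Δ̄ : Carrier) →
    let open OrderedStoryline I
        open Coordinations ℝ I
    in
    ∃[ σ ] ∃[ k ]
      ((⟨ guarded (compile pipeline) , input I Δ Δ̄ ⟩⇓⟨ σ , k ⟩) ×
       k ≤ (9 + pipelineFactor) * (1 + n * n * ℓ) ×
       (0# < Δ ⊎ ∃ (Nice Δ Δ̄) → Optimal Δ Δ̄ (output I σ)))
  solve I Δ Δ̄ = go (0 <? n) (0 <? ℓ)
    where
    open OrderedStoryline I
    open Coordinations ℝ I
    open Correctness ℝ I Δ Δ̄
    open Guarded ℝ I Δ Δ̄
    attach : ∀ {σ} → Outcome (guarded (compile pipeline)) σ ((9 + pipelineFactor) * (1 + n * n * ℓ)) →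
             (0# < Δ ⊎ ∃ (Nice Δ Δ̄) → Optimal Δ Δ̄ (output I σ)) →
             ∃[ σ ] ∃[ k ]
               ((⟨ guarded (compile pipeline) , input I Δ Δ̄ ⟩⇓⟨ σ , k ⟩) ×
                k ≤ (9 + pipelineFactor) * (1 + n * n * ℓ) ×
                (0# < Δ ⊎ ∃ (Nice Δ Δ̄) → Optimal Δ Δ̄ (output I σ)))
    attach {σ} (k , r , k≤) opt = σ , k , r , k≤ , opt
    go : Dec (0 ℕ.< n) → Dec (0 ℕ.< ℓ) →
         ∃[ σ ] ∃[ k ]
           ((⟨ guarded (compile pipeline) , input I Δ Δ̄ ⟩⇓⟨ σ , k ⟩) ×
            k ≤ (9 + pipelineFactor) * (1 + n * n * ℓ) ×
            (0# < Δ ⊎ ∃ (Nice Δ Δ̄) → Optimal Δ Δ̄ (output I σ)))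
    go (no n≮0) _ = attach (guarded-empty _ pipelineFactor (n * n * ℓ) (inj₁ n≮0))
      λ _ → optimal-if-empty (λ _ c → n≮0 (≤-<-trans z≤n (toℕ<n c))) (output I σ₀)
    go _ (no ℓ≮0) = attach (guarded-empty _ pipelineFactor (n * n * ℓ) (inj₂ ℓ≮0))
      λ _ → optimal-if-empty (λ t _ → ℓ≮0 (≤-<-trans z≤n (toℕ<n t))) (output I σ₀)
    go (yes 0<n) (yes 0<ℓ) = attach (guarded-run (compile pipeline) (exec pipeline σ₀) pipelineFactor (n * n * ℓ) 0<n 0<ℓ (pipeline-run 0<n 0<ℓ))
      (optimal-output (m<n⇒n≢0 0<n) (fromℕ< 0<ℓ) (toℕ-fromℕ< 0<ℓ))
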